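{- Let $T$ be an unrooted tree (serving as the communication network) and let $r\in V(T)$ be an arbitrary node, where each node knows whether it is $r$. There is a deterministic $\tilde O(1)$-round Minor-Aggregation algorithm that constructs a heavy-light decomposition of $T$ rooted at $r$; specifically, upon termination each node learns its HL-info.
   Context: Minor-Aggregation model. The communication network is a connected undirected graph $G=(V,E)$ with $n=|V|$ nodes; both nodes and edges are computational units with private memory. Initially nodes know only their unique $\tilde O(1)$-bit ID (and inputs) and edges know the IDs of their endpoints. Computation proceeds in synchronous rounds, each of three steps: (i) Contraction: each edge $e$ chooses $c_e\in\{\bot,\top\}$, defining the minor $G'=G/\{e:c_e=\top\}$ (self-loops removed), whose vertices (supernodes) are identified with the sets of nodes they contain. (ii) Consensus: each node $v$ chooses an $\tilde O(1)$-bit value $x_v$; for each supernode $s$ all nodes of $s$ learn $y_s=\bigoplus_{v\in s}x_v$ for a predefined aggregation operator $\bigoplus$. (iii) Aggregation: each edge $e$ of $G'$ joining supernodes $a,b$ learns $y_a,y_b$ and chooses $\tilde O(1)$-bit values $z_{e,a},z_{e,b}$; all nodes of each supernode $s$ learn the same aggregate $\bigotimes_{e \text{ incident to } s} z_{e,s}$ for a predefined aggregation operator $\bigotimes$. An aggregation operator maps two $B$-bit messages ($B=\tilde O(1)$) to one $B$-bit message, applied pairwise in arbitrary order to aggregate several messages. $\tilde O(\cdot)$ hides $\mathrm{poly}(\log n)$ factors. Heavy-light decomposition of a tree rooted at $r$: letting $S(v)$ be the number of descendants of $v$ (including $v$), for each non-leaf node $u$ the edge to a child $v$ maximizing $S(v)$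 (ties broken arbitrarily) is labeled heavy and all other edges light. The HL-info of a node $v$ consists of the depth of $v$ in $T$ and the list of all light edges on the root-to-$v$ path, with, for each, the depths and IDs of both endpoints. -}

module Defs where

open import Data.Nat using (ℕ; zero; suc; _+_; _*_; _^_; _≤_; _<_)
open import Data.Nat.Logarithm using (⌊log₂_⌋)
open import Data.Bool using (Bool; true; false)
open import Data.Fin using (Fin; _≟_)
open import Data.List using (List; []; _∷_; _++_; length; map; lookup)
open import Data.List.Membership.Propositional using (_∈_)
open import Data.List.Relation.Unary.Unique.Propositional using (Unique)
open import Data.List.Relation.Binary.Permutation.Propositional using (_↭_)
open import Data.Maybe using (Maybe; just; nothing)
open import Data.Vec using (Vec)
open import Data.Product using (Σ; ∃; ∃-syntax; _×_; _,_; proj₁; proj₂)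
open import Data.Sum using (_⊎_)
open import Function using (_∘_)
open import Function.Bundles using (_⇔_)
open import Relation.Binary.PropositionalEquality using (_≡_; _≢_)
open import Relation.Binary.Construct.Closure.ReflexiveTransitive using (Star)
open import Relation.Nullary using (¬_)
open import Relation.Nullary.Decidable using (⌊_⌋)

EdgeList : ℕ → Set
EdgeList n = List (Fin n × Fin n)

Adj : ∀ {n} → EdgeList n → Fin n → Fin n → Set
Adj es u v = ((u , v) ∈ es) ⊎ ((v , u) ∈ es)

IsTree : ∀ {n} → EdgeList n → Set
IsTree {n} es = (suc (length es) ≡ n) × (∀ u v → Star (Adj es) u v)

data Walk {n} (es : EdgeList n) : Fin n → Fin n → ℕ → Set where
  here : ∀ {u} → Walk es u u 0
  step : ∀ {u w v k} → Adj es u w → Walk es w v k → Walk es u v (suc k)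

Dist : ∀ {n} → EdgeList n → Fin n → Fin n → ℕ → Set
Dist es u v d = Walk es u v d × (∀ d' → Walk es u v d' → d ≤ d')

data PathL {n} (es : EdgeList n) : Fin n → Fin n → List (Fin n) → Set where
  here : ∀ {u} → PathL es u u (u ∷ [])
  step : ∀ {u w v P} → Adj es u w → PathL es w v P → PathL es u v (u ∷ P)

RootPath : ∀ {n} → EdgeList n → Fin n → Fin n → List (Fin n) → Set
RootPath es r v P = PathL es r v P × Unique P

Depth : ∀ {n} → EdgeList n → Fin n → Fin n → ℕ → Set
Depth es r v d = Dist es r v d

Child : ∀ {n} → EdgeList n → Fin n → Fin n → Fin n → Set
Child es r u c = Adj es u c × ∃[ d ] (Depth es r u d × Depth es r c (suc d))

Desc : ∀ {n} → EdgeList n → Fin n → Fin n → Fin n → Set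
Desc es r v w = ∃[ P ] (RootPath es r w P × v ∈ P)

SubtreeSize : ∀ {n} → EdgeList n → Fin n → Fin n → ℕ → Set
SubtreeSize {n} es r v s =
  ∃[ L ] (Unique L × (∀ (w : Fin n) → (w ∈ L) ⇔ Desc es r v w) × length L ≡ s)

-- a heavy-light decomposition: the heavy child of each non-leaf node
HeavyChoice : ℕ → Set
HeavyChoice n = Fin n → Maybe (Fin n)

IsHLD : ∀ {n} → EdgeList n → Fin n → HeavyChoice n → Set
IsHLD {n} es r hc = ∀ (u : Fin n) →
  (∀ h → hc u ≡ just h →
     Child es r u h ×
     (∀ c sc sh → Child es r u c → SubtreeSize es r c sc → SubtreeSize es r h sh → sc ≤ sh))
  × (hc u ≡ nothing → ∀ c → ¬ Child es r u c)

-- a light edge entry: (depth u , ID u , depth w , ID w) for light edge {u,w},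
-- u the parent
HLEntry : Set
HLEntry = ℕ × ℕ × ℕ × ℕ

HLInfo : Set
HLInfo = ℕ × List HLEntry

data LightEntries {n} (es : EdgeList n) (r : Fin n) (ids : Fin n → ℕ) (hc : HeavyChoice n)
     : List (Fin n) → List HLEntry → Set where
  nil   : LightEntries es r ids hc [] []
  one   : ∀ {u} → LightEntries es r ids hc (u ∷ []) []
  heavy : ∀ {u w P L} → hc u ≡ just w →
          LightEntries es r ids hc (w ∷ P) L →
          LightEntries es r ids hc (u ∷ w ∷ P) L
  light : ∀ {u w P L du dw} → hc u ≢ just w →
          Depth es r u du → Depth es r w dw →
          LightEntries es r ids hc (w ∷ P) L →
          LightEntries es r ids hc (u ∷ w ∷ P) ((du , ids u , dw , ids w) ∷ L)

IsHLInfo : ∀ {n} → EdgeList n → Fin n → (Fin n → ℕ) → HeavyChoice n → Fin n → HLInfo → Set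
IsHLInfo es r ids hc v (d , L) =
  Depth es r v d × ∃[ P ] (RootPath es r v P × LightEntries es r ids hc P L)

Msg : ℕ → Set
Msg B = Vec Bool B

-- a value obtained by applying f pairwise, in arbitrary order and bracketing,
-- to the (multiset of) messages in the list
data Combines {M : Set} (f : M → M → M) : List M → M → Set where
  single : ∀ {x} → Combines f (x ∷ []) x
  join   : ∀ {L L' K a b} → Combines f L a → Combines f L' b →
           (L ++ L') ↭ K → Combines f K (f a b)

AggOf : {M : Set} → (M → M → M) → List M → Maybe M → Set
AggOf f [] m = m ≡ nothing
AggOf f (x ∷ xs) m = ∃[ a ] (m ≡ just a × Combines f (x ∷ xs) a)

Enumerates : {A : Set} → List A → (A → Set) → Set
Enumerates {A} L P = Unique L × (∀ (a : A) → (a ∈ L) ⇔ P a)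

-- a deterministic Minor-Aggregation algorithm with B-bit messages;
-- the round number t : ℕ is passed to every local rule
record Algorithm (B : ℕ) : Set₁ where
  field
    NodeState     : Set
    EdgeState     : Set
    rounds        : ℕ
    initNode      : (myId : ℕ) → (isRoot : Bool) → NodeState
    initEdge      : (idFst idSnd : ℕ) → EdgeState
    contract      : ℕ → EdgeState → Bool
    consensusVal  : ℕ → NodeState → Msg B
    consensusOp   : ℕ → Msg B → Msg B → Msg B
    edgeMsgs      : ℕ → EdgeState → Msg B → Msg B → Msg B × Msg B
                    -- (y_a , y_b) ↦ (z_{e,a} , z_{e,b}), a ∋ first endpoint
    edgeUpdate    : ℕ → EdgeState → Msg B → Msg B → EdgeState
    aggregationOp : ℕ → Msg B → Msg B → Msg B
    nodeUpdate    : ℕ → NodeState → Msg B → Maybe (Msg B) → NodeState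
    output        : NodeState → HLInfo

module Execution {B : ℕ} (A : Algorithm B) {n : ℕ} (es : EdgeList n)
                 (ids : Fin n → ℕ) (r : Fin n) where
  open Algorithm A

  E : Set
  E = Fin (length es)

  fstE sndE : E → Fin n
  fstE e = proj₁ (lookup es e)
  sndE e = proj₂ (lookup es e)

  endp : E → Bool → Fin n
  endp e true  = fstE e
  endp e false = sndE e

  Config : Set
  Config = (Fin n → NodeState) × (E → EdgeState)

  initConfig : Config
  initConfig = (λ v → initNode (ids v) ⌊ v ≟ r ⌋) , (λ e → initEdge (ids (fstE e)) (ids (sndE e)))

  Step : ℕ → Config → Config → Set
  Step t (ns , est) (ns' , est') =
    Σ (Fin n → Msg B) λ y → Σ (Fin n → Maybe (Msg B)) λ agg →
      ( (∀ u v → Same u v → y u ≡ y v)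
      × (∀ v → Σ (List (Fin n)) λ L → (Enumerates L (Same v) × Combines (consensusOp t) (map (consensusVal t ∘ ns) L) (y v)))
      × (∀ u v → Same u v → agg u ≡ agg v)
      × (∀ v → Σ (List (E × Bool)) λ L → (Enumerates L (Inc y v) × AggOf (aggregationOp t) (map (z y) L) (agg v)))
      × (∀ v → ns' v ≡ nodeUpdate t (ns v) (y v) (agg v))
      × (∀ e → (InG' e → est' e ≡ edgeUpdate t (est e) (y (fstE e)) (y (sndE e)))
             × (¬ InG' e → est' e ≡ est e)))
    where
      CAdj : Fin n → Fin n → Set
      CAdj u v = ∃[ e ] (contract t (est e) ≡ true × ((fstE e ≡ u × sndE e ≡ v) ⊎ (fstE e ≡ v × sndE e ≡ u)))
      Same : Fin n → Fin n → Set
      Same = Star CAdj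
      InG' : E → Set
      InG' e = contract t (est e) ≡ false × ¬ Same (fstE e) (sndE e)
      Inc : (Fin n → Msg B) → Fin n → E × Bool → Set
      Inc y v (e , side) = InG' e × Same v (endp e side)
      z : (Fin n → Msg B) → E × Bool → Msg B
      z y (e , true)  = proj₁ (edgeMsgs t (est e) (y (fstE e)) (y (sndE e)))
      z y (e , false) = proj₂ (edgeMsgs t (est e) (y (fstE e)) (y (sndE e)))

  -- configurations reachable after t rounds (over all aggregation orders)
  data Reach : ℕ → Config → Set where
    start : Reach 0 initConfig
    next  : ∀ {t c c'} → Reach t c → Step t c c' → Reach (suc t) c'

lg : ℕ → ℕ
lg n = suc ⌊log₂ n ⌋

{-# OPTIONS --safe #-}
module Submission where

-- Components of the tree are merged in O(log n) phases.  A component smaller than 2^(p+1) in phase p moves into a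
-- neighbour whose identifier differs from its own in the bit under consideration; since movers and their targets
-- disagree on that bit, every merging step contracts a forest of stars.  The step at which an edge is contracted is its
-- level.  Going down the levels, each star learns on which side the root lies, which orients all edges.  Splitting
-- every level in two according to whether the moving side is the child yields a rank with the following property:
-- contract all edges of smaller rank; then the parent edge of the component that an edge hangs from has larger rank.
-- Hence going down the ranks computes subtree sizes (a component's size plus the sizes hanging from it), and going up
-- computes depths relative to the top of the component.  Finally, with the heavy paths contracted, the light edges
-- above each vertex are passed down one per round; there are at most log n of them because sizes halve.

open import Defs
import Data.Bool as Bool
open import Data.Bool using (Bool; true; false; not; if_then_else_; _∨_)
open import Data.Bool.Properties using (not-involutive; ∨-zeroʳ)
open import Data.Empty using (⊥-elim; ⊥-elim-irr; ⊥)
open import Data.Fin using (Fin; zero; suc; punchIn; punchOut)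
open import Data.Fin.Properties using (_≟_; any?; injective⇒≤; punchInᵢ≢i; punchIn-injective; punchOut-injective)
open import Data.List using (List; []; _∷_; _++_; map; allFin; filter; tabulate; length; lookup; take; replicate; reverse)
import Data.List.Membership.DecPropositional as DecMembership
open import Data.List.Membership.Propositional using (_∈_; _∉_)
open import Data.List.Membership.Propositional.Properties using (∈-++⁻; ∈-++⁺ˡ; ∈-++⁺ʳ; ∈-map⁺; ∈-map⁻; ∈-allFin; ∈-filter⁺; ∈-filter⁻; ∈-lookup)
open import Data.List.Membership.Propositional.Properties.WithK using (unique∧set⇒bag)
open import Data.List.Properties using (map-++; map-cong; map-∘; map-tabulate; ++-assoc; ++-identityʳ; length-++; take-all; unfold-reverse; reverse-++; length-replicate)
open import Data.List.Relation.Binary.BagAndSetEquality using (∼bag⇒↭)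
open import Data.List.Relation.Binary.Permutation.Propositional using (_↭_; ↭-sym)
open import Data.List.Relation.Binary.Permutation.Propositional.Properties using (∈-resp-↭; map⁺)
open import Data.List.Relation.Unary.All as All using (All; []; _∷_)
open import Data.List.Relation.Unary.AllPairs using ([]; _∷_)
open import Data.List.Relation.Unary.Any using (here; there; index)
open import Data.List.Relation.Unary.Any.Properties using (lookup-index)
open import Data.List.Relation.Unary.Unique.Propositional using (Unique)
import Data.List.Relation.Unary.Unique.Propositional.Properties as Unique
open import Data.Maybe using (Maybe; just; nothing)
open import Data.Maybe.Properties using (just-injective)
import Data.Nat as ℕ
open import Data.Nat using (ℕ; zero; suc; _+_; _*_; _^_; _≤_; _<_; _<ᵇ_; ⌊_/2⌋; z≤n; s≤s; z<s; _<?_)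
open import Data.Nat.ListAction using (sum)
open import Data.Nat.ListAction.Properties using (sum-++; sum-↭)
open import Data.Nat.Logarithm using (⌊log₂⌋-mono-≤; ⌊log₂[2^n]⌋≡n)
open import Data.Nat.Properties hiding (_≟_)
open import Data.Nat.Solver using (module +-*-Solver)
open import Data.Product using (Σ; ∃-syntax; _×_; _,_; proj₁; proj₂)
open import Data.Product.Properties using (≡-dec)
open import Data.Sum using (_⊎_; inj₁; inj₂)
open import Data.Vec as Vec using (Vec; []; _∷_)
open import Data.Vec.Properties using (++-injectiveˡ; ++-injectiveʳ; take++drop≡id)
open import Function using (_∘_)
open import Function.Bundles using (mk⇔; module Equivalence)
open import Function.Definitions using (Injective)
open import Relation.Binary.Construct.Closure.ReflexiveTransitive using (Star; ε; _◅_; _◅◅_) renaming (reverse to star-reverse)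
open import Relation.Binary.PropositionalEquality
open import Relation.Nullary using (¬_; Dec; yes; no; invert)
open import Relation.Nullary.Decidable using (_×-dec_; _⊎-dec_; map′; ⌊_⌋; ¬?)
open +-*-Solver using (solve; _:+_; _:*_; _:=_; con)

-- Binary expansions

-- The number of rounds must not grow with the height of the tree, so information can only travel
-- through contracted components. In a star formed by one merging step, two edges can lie one above
-- the other only as leaf, centre, leaf: along the lower edge the child moves, along the upper one
-- the parent. This is the origin of the split of each level in two, of the order of its halves, and
-- of the two orientation rounds per level. A component may change its identifier in the middle of a
-- sweep over the bits, but only by moving, and a component that has moved has already reached the
-- size demanded by the phase. Two features of the model shape the formal side. Messages are bit
-- vectors and are re-encoded at every pairwise combination, so no intermediate value may overflow.
-- Aggregation takes place in an arbitrary order, so only two operators occur: a sum and a maximum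
-- of the first field, both carrying along the other fields of some contributor.

odd : ℕ → Bool
odd zero    = false
odd (suc x) = not (odd x)

bit : ℕ → ℕ → Bool
bit zero    x = odd x
bit (suc i) x = bit i ⌊ x /2⌋

toBits : ∀ w → ℕ → Vec Bool w
toBits zero    x = []
toBits (suc w) x = odd x ∷ toBits w ⌊ x /2⌋

𝔹 : Bool → ℕ
𝔹 b = if b then 1 else 0

fromBits : ∀ {w} → Vec Bool w → ℕ
fromBits []       = 0
fromBits (b ∷ bs) = 𝔹 b + 2 * fromBits bs

odd-half : ∀ x → 𝔹 (odd x) + 2 * ⌊ x /2⌋ ≡ x
odd-half zero = refl
odd-half (suc zero) = refl
odd-half (suc (suc x)) with odd x | odd-half x
... | true  | ih = cong suc (trans (*-suc 2 ⌊ x /2⌋) (cong suc ih))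
... | false | ih = trans (*-suc 2 ⌊ x /2⌋) (cong (2 +_) ih)

half-< : ∀ {x y} → x < 2 * y → ⌊ x /2⌋ < y
half-< {x} {y} x<2y = *-cancelˡ-< 2 _ _
  (≤-<-trans (≤-trans (m≤n+m _ (𝔹 (odd x))) (≤-reflexive (odd-half x))) x<2y)

fromBits-toBits : ∀ w {x} → x < 2 ^ w → fromBits (toBits w x) ≡ x
fromBits-toBits zero    {zero}  _         = refl
fromBits-toBits zero    {suc x} (s≤s ())
fromBits-toBits (suc w) {x}     x<        =
  trans (cong (λ z → 𝔹 (odd x) + 2 * z) (fromBits-toBits w (half-< x<))) (odd-half x)

fromBits-< : ∀ {w} (bs : Vec Bool w) → fromBits bs < 2 ^ w
fromBits-< []       = s≤s z≤n
fromBits-< {suc w} (b ∷ bs) = begin-strict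
  𝔹 b + 2 * fromBits bs       ≤⟨ +-monoˡ-≤ _ (𝔹≤1 b) ⟩
  1 + 2 * fromBits bs         <⟨ n<1+n _ ⟩
  2 + 2 * fromBits bs         ≡⟨ *-suc 2 (fromBits bs) ⟨
  2 * suc (fromBits bs)       ≤⟨ *-monoʳ-≤ 2 (fromBits-< bs) ⟩
  2 * 2 ^ w                   ∎
  where
  open ≤-Reasoning
  𝔹≤1 : ∀ b → 𝔹 b ≤ 1
  𝔹≤1 true  = ≤-refl
  𝔹≤1 false = z≤n

separating-bit : ∀ w {x y} → x < 2 ^ w → y < 2 ^ w → x ≢ y → ∃[ i ] (i < w × bit i x ≢ bit i y)
separating-bit zero    {zero}  {zero}  _ _ x≢y = ⊥-elim (x≢y refl)
separating-bit zero    {suc x} (s≤s ()) _ _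
separating-bit zero    {zero}  {suc y} _ (s≤s ()) _
separating-bit (suc w) {x} {y} x< y< x≢y with odd x Bool.≟ odd y
... | no  o≢ = 0 , z<s , o≢
... | yes o≡ with separating-bit w (half-< x<) (half-< y<)
                   (λ h≡ → x≢y (trans (sym (odd-half x))
                     (trans (cong₂ (λ b h → 𝔹 b + 2 * h) o≡ h≡) (odd-half y))))
...   | i , i<w , b≢ = suc i , s≤s i<w , b≢

n<2^lg : ∀ n → n < 2 ^ lg n
n<2^lg n = ≰⇒> λ 2^≤n → <-irrefl refl
  (≤-trans (≤-reflexive (sym (⌊log₂[2^n]⌋≡n (lg n)))) (⌊log₂⌋-mono-≤ 2^≤n))

-- Finite sums and indicators

𝟙 : ∀ {a} {A : Set a} → Dec A → ℕ
𝟙 (yes _) = 1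
𝟙 (no  _) = 0

𝟙-yes : ∀ {a} {A : Set a} (d : Dec A) → A → 𝟙 d ≡ 1
𝟙-yes (yes _) _ = refl
𝟙-yes (no ¬a) a = ⊥-elim (¬a a)

𝟙-no : ∀ {a} {A : Set a} (d : Dec A) → ¬ A → 𝟙 d ≡ 0
𝟙-no (yes a) ¬a = ⊥-elim (¬a a)
𝟙-no (no  _) _  = refl

𝟙-cong : ∀ {a b} {A : Set a} {B : Set b} (d : Dec A) (d' : Dec B) → (A → B) → (B → A) → 𝟙 d ≡ 𝟙 d'
𝟙-cong (yes a) d' f g = sym (𝟙-yes d' (f a))
𝟙-cong (no ¬a) d' f g = sym (𝟙-no d' (¬a ∘ g))

𝟙≤1 : ∀ {a} {A : Set a} (d : Dec A) → 𝟙 d ≤ 1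
𝟙≤1 (yes _) = ≤-refl
𝟙≤1 (no  _) = z≤n

∑ : ∀ {n} → (Fin n → ℕ) → ℕ
∑ {zero}  f = 0
∑ {suc n} f = f zero + ∑ (f ∘ suc)

∑-cong : ∀ {n} {f g : Fin n → ℕ} → (∀ i → f i ≡ g i) → ∑ f ≡ ∑ g
∑-cong {zero}  _   = refl
∑-cong {suc n} f≡g = cong₂ _+_ (f≡g zero) (∑-cong (f≡g ∘ suc))

∑-distrib-+ : ∀ {n} (f g : Fin n → ℕ) → ∑ (λ i → f i + g i) ≡ ∑ f + ∑ g
∑-distrib-+ {zero}  f g = refl
∑-distrib-+ {suc n} f g = trans (cong (f zero + g zero +_) (∑-distrib-+ (f ∘ suc) (g ∘ suc)))
  (solve 4 (λ a b c d → (a :+ b) :+ (c :+ d) := (a :+ c) :+ (b :+ d)) refl (f zero) (g zero) (∑ (f ∘ suc)) (∑ (g ∘ suc)))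

∑-swap : ∀ {m n} (f : Fin m → Fin n → ℕ) → ∑ (λ i → ∑ (f i)) ≡ ∑ (λ j → ∑ (λ i → f i j))
∑-swap {zero}  {zero}  f = refl
∑-swap {zero}  {suc n} f = ∑-swap {zero} {n} (λ i j → f i (suc j))
∑-swap {suc m} {n}     f = trans (cong (∑ (f zero) +_) (∑-swap (f ∘ suc))) (sym (∑-distrib-+ (f zero) _))

∑-mono : ∀ {n} {f g : Fin n → ℕ} → (∀ i → f i ≤ g i) → ∑ f ≤ ∑ g
∑-mono {zero}  _   = z≤n
∑-mono {suc n} f≤g = +-mono-≤ (f≤g zero) (∑-mono (f≤g ∘ suc))

∑-zero : ∀ {n} {f : Fin n → ℕ} → (∀ i → f i ≡ 0) → ∑ f ≡ 0
∑-zero {zero}  _   = refl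
∑-zero {suc n} f≡0 = cong₂ _+_ (f≡0 zero) (∑-zero (f≡0 ∘ suc))

∑-single : ∀ {n} (f : Fin n → ℕ) i → (∀ j → j ≢ i → f j ≡ 0) → ∑ f ≡ f i
∑-single f zero    others =
  trans (cong (f zero +_) (∑-zero (λ j → others (suc j) λ ()))) (+-identityʳ _)
∑-single f (suc i) others =
  trans (cong (_+ ∑ (f ∘ suc)) (others zero λ ()))
        (∑-single (f ∘ suc) i (λ j j≢i → others (suc j) λ { refl → j≢i refl }))

term≤∑ : ∀ {n} (f : Fin n → ℕ) i → f i ≤ ∑ f
term≤∑ f zero    = m≤m+n _ _
term≤∑ f (suc i) = ≤-trans (term≤∑ (f ∘ suc) i) (m≤n+m _ _)

∑≤n : ∀ {n} {f : Fin n → ℕ} → (∀ i → f i ≤ 1) → ∑ f ≤ n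
∑≤n {zero}  _   = z≤n
∑≤n {suc n} f≤1 = +-mono-≤ (f≤1 zero) (∑≤n (f≤1 ∘ suc))

∑-pos : ∀ {n} (f : Fin n → ℕ) → 0 < ∑ f → ∃[ i ] 0 < f i
∑-pos {suc n} f 0<∑ with f zero in eq
... | suc _ = zero , subst (0 <_) (sym eq) z<s
... | zero with ∑-pos (f ∘ suc) 0<∑
...   | i , p = suc i , p

sum-allFin : ∀ {n} (f : Fin n → ℕ) → sum (map f (allFin n)) ≡ ∑ f
sum-allFin {n} f = trans (cong sum (map-tabulate {n = n} (λ i → i) f)) (go f)
  where
  go : ∀ {n} (f : Fin n → ℕ) → sum (tabulate f) ≡ ∑ f
  go {zero}  f = refl
  go {suc n} f = cong (f zero +_) (go (f ∘ suc))

-- An execution may list the members of a supernode in any order; this makes sums over such a list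
-- independent of that choice.
enumerations-↭ : ∀ {A : Set} {L L' : List A} {P : A → Set} → Enumerates L P → Enumerates L' P → L ↭ L'
enumerations-↭ (uL , mL) (uL' , mL') = ∼bag⇒↭ (unique∧set⇒bag uL uL'
  (mk⇔ (Equivalence.from (mL' _) ∘ Equivalence.to (mL _))
       (Equivalence.from (mL _) ∘ Equivalence.to (mL' _))))

sum-filter : ∀ {A : Set} {P : A → Set} (P? : ∀ a → Dec (P a)) (f : A → ℕ) U →
             sum (map f (filter P? U)) ≡ sum (map (λ a → 𝟙 (P? a) * f a) U)
sum-filter P? f []      = refl
sum-filter P? f (a ∷ U) with P? a
... | yes _ = cong₂ _+_ (sym (+-identityʳ (f a))) (sum-filter P? f U)
... | no  _ = sum-filter P? f U

sum-enumeration : ∀ {A : Set} {L U : List A} {P : A → Set} (P? : ∀ a → Dec (P a)) (f : A → ℕ) →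
  Unique U → (∀ a → a ∈ U) → Enumerates L P →
  sum (map f L) ≡ sum (map (λ a → 𝟙 (P? a) * f a) U)
sum-enumeration {U = U} P? f uU all∈U enum = trans
  (sum-↭ (map⁺ f (enumerations-↭ enum
    (Unique.filter⁺ P? uU , λ a → mk⇔ (proj₂ ∘ ∈-filter⁻ P? {xs = U}) (∈-filter⁺ P? (all∈U a))))))
  (sum-filter P? f U)

sum-enumeration-Fin : ∀ {n} {L : List (Fin n)} {P : Fin n → Set} (P? : ∀ v → Dec (P v)) (f : Fin n → ℕ) →
  Enumerates L P → sum (map f L) ≡ ∑ (λ v → 𝟙 (P? v) * f v)
sum-enumeration-Fin {n} P? f enum =
  trans (sum-enumeration P? f (Unique.allFin⁺ n) ∈-allFin enum) (sum-allFin {n} _)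

sum-enumeration-Fin×Bool : ∀ {n} {L : List (Fin n × Bool)} {P : Fin n × Bool → Set}
  (P? : ∀ a → Dec (P a)) (f : Fin n × Bool → ℕ) → Enumerates L P →
  sum (map f L) ≡ ∑ (λ e → 𝟙 (P? (e , true)) * f (e , true) + 𝟙 (P? (e , false)) * f (e , false))
sum-enumeration-Fin×Bool {n} P? f enum = begin
  _                                   ≡⟨ sum-enumeration P? f uniq complete enum ⟩
  sum (map g (Lt ++ Lf))              ≡⟨ cong sum (map-++ g Lt Lf) ⟩
  sum (map g Lt ++ map g Lf)          ≡⟨ sum-++ (map g Lt) (map g Lf) ⟩
  sum (map g Lt) + sum (map g Lf)     ≡⟨ cong₂ _+_ (side true) (side false) ⟩
  ∑ (λ e → g (e , true)) + ∑ (λ e → g (e , false)) ≡⟨ ∑-distrib-+ (λ e → g (e , true)) _ ⟨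
  _ ∎
  where
  open ≡-Reasoning
  g : Fin n × Bool → ℕ
  g a = 𝟙 (P? a) * f a
  Lt = map (_, true) (allFin n)
  Lf = map (_, false) (allFin n)
  side : ∀ s → sum (map g (map (_, s) (allFin n))) ≡ ∑ (λ e → g (e , s))
  side s = trans (cong sum (sym (map-∘ (allFin n)))) (sum-allFin {n} _)
  uniq : Unique (Lt ++ Lf)
  uniq = Unique.++⁺ (Unique.map⁺ (cong proj₁) (Unique.allFin⁺ n)) (Unique.map⁺ (cong proj₁) (Unique.allFin⁺ n))
    λ { (p , q) → case∈ (∈-map⁻ _ p) (∈-map⁻ _ q) }
    where
    case∈ : ∀ {a} → ∃[ x ] (x ∈ allFin n × a ≡ (x , true)) → ∃[ y ] (y ∈ allFin n × a ≡ (y , false)) → _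
    case∈ (_ , _ , refl) (_ , _ , ())
  complete : ∀ a → a ∈ Lt ++ Lf
  complete (e , true)  = ∈-++⁺ˡ (∈-map⁺ _ (∈-allFin e))
  complete (e , false) = ∈-++⁺ʳ Lt (∈-map⁺ _ (∈-allFin e))

-- Messages with four numerical fields

record Quad : Set where
  constructor quad
  field f0 f1 f2 f3 : ℕ
open Quad public

rest : Quad → ℕ × ℕ × ℕ
rest m = f1 m , f2 m , f3 m

0# : Quad
0# = quad 0 0 0 0

-- Under arbitrary orders the last three fields come from an unspecified contributor. They are
-- meaningful whenever all vertices of a supernode agree on them.
_⊕_ : Quad → Quad → Quad
a ⊕ b = quad (f0 a + f0 b) (f1 a) (f2 a) (f3 a)

-- The payload of a maximizer is carried along; among ties, the order of aggregation decides.
_⊔#_ : Quad → Quad → Quad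
a ⊔# b = if f0 a <ᵇ f0 b then b else a

module Coding (W : ℕ) where

  width : ℕ
  width = W + (W + (W + W))

  record Fits (m : Quad) : Set where
    constructor fits
    field
      b0 : f0 m < 2 ^ W
      b1 : f1 m < 2 ^ W
      b2 : f2 m < 2 ^ W
      b3 : f3 m < 2 ^ W
  open Fits public

  abstract

    encode : Quad → Msg width
    encode (quad a b c d) = toBits W a Vec.++ (toBits W b Vec.++ (toBits W c Vec.++ toBits W d))

    decode : Msg width → Quad
    decode x = quad (fromBits (Vec.take W x)) (fromBits (Vec.take W (Vec.drop W x)))
      (fromBits (Vec.take W (Vec.drop W (Vec.drop W x)))) (fromBits (Vec.drop W (Vec.drop W (Vec.drop W x))))

    decode-fits : ∀ x → Fits (decode x)
    decode-fits x = fits (fromBits-< (Vec.take W x)) (fromBits-< (Vec.take W (Vec.drop W x)))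
      (fromBits-< (Vec.take W (Vec.drop W (Vec.drop W x)))) (fromBits-< (Vec.drop W (Vec.drop W (Vec.drop W x))))

    take-++ : ∀ {m n} (xs : Vec Bool m) (ys : Vec Bool n) → Vec.take m (xs Vec.++ ys) ≡ xs
    take-++ {m} xs ys = ++-injectiveˡ _ _ (take++drop≡id m (xs Vec.++ ys))

    drop-++ : ∀ {m n} (xs : Vec Bool m) (ys : Vec Bool n) → Vec.drop m (xs Vec.++ ys) ≡ ys
    drop-++ {m} xs ys = ++-injectiveʳ (Vec.take m (xs Vec.++ ys)) xs (take++drop≡id m (xs Vec.++ ys))

    decode-encode : ∀ {m} → Fits m → decode (encode m) ≡ m
    decode-encode {quad a b c d} (fits a< b< c< d<)
      rewrite drop-++ (toBits W a) (toBits W b Vec.++ (toBits W c Vec.++ toBits W d))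
            | drop-++ (toBits W b) (toBits W c Vec.++ toBits W d)
            | drop-++ (toBits W c) (toBits W d)
            | take-++ (toBits W a) (toBits W b Vec.++ (toBits W c Vec.++ toBits W d))
            | take-++ (toBits W b) (toBits W c Vec.++ toBits W d)
            | take-++ (toBits W c) (toBits W d)
            | fromBits-toBits W a< | fromBits-toBits W b< | fromBits-toBits W c< | fromBits-toBits W d< = refl

  lift : (Quad → Quad → Quad) → Msg width → Msg width → Msg width
  lift op x y = encode (op (decode x) (decode y))

  -- Every intermediate result is the sum of a part of `K`, so the bound on the whole sum excludes
  -- overflow at each re-encoding.
  combines-⊕ : ∀ {K x} → Combines (lift _⊕_) K x → sum (map (f0 ∘ decode) K) < 2 ^ W →
    f0 (decode x) ≡ sum (map (f0 ∘ decode) K) × ∃[ k ] (k ∈ K × rest (decode x) ≡ rest (decode k))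
  combines-⊕ (single {x}) _ = sym (+-identityʳ _) , x , here refl , refl
  combines-⊕ (join {L} {L'} {K} {a} {b} ca cb p) bound with
        combines-⊕ ca (≤-<-trans (m≤m+n _ _) bound')
      | combines-⊕ cb (≤-<-trans (m≤n+m _ (sum (map (f0 ∘ decode) L))) bound')
    where
    split : sum (map (f0 ∘ decode) K) ≡ sum (map (f0 ∘ decode) L) + sum (map (f0 ∘ decode) L')
    split = trans (sum-↭ (map⁺ (f0 ∘ decode) (↭-sym p)))
      (trans (cong sum (map-++ (f0 ∘ decode) L L')) (sum-++ (map (f0 ∘ decode) L) _))
    bound' : sum (map (f0 ∘ decode) L) + sum (map (f0 ∘ decode) L') < 2 ^ W
    bound' = subst (_< 2 ^ W) split bound
  ... | sa , k , k∈ , ra | sb , _ =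
    trans (cong f0 dec) total , k , ∈-resp-↭ p (∈-++⁺ˡ k∈) , trans (cong rest dec) ra
    where
    total : f0 (decode a) + f0 (decode b) ≡ sum (map (f0 ∘ decode) K)
    total = trans (cong₂ _+_ sa sb) (trans (sym (sum-++ (map (f0 ∘ decode) L) _))
      (trans (cong sum (sym (map-++ (f0 ∘ decode) L L'))) (sum-↭ (map⁺ (f0 ∘ decode) p))))
    dec : decode (lift _⊕_ a b) ≡ decode a ⊕ decode b
    dec = decode-encode (fits (subst (_< 2 ^ W) (sym total) bound)
      (b1 (decode-fits a)) (b2 (decode-fits a)) (b3 (decode-fits a)))

  ⊔#-cases : ∀ a b → (a ⊔# b ≡ a × f0 b ≤ f0 a) ⊎ (a ⊔# b ≡ b × f0 a ≤ f0 b)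
  ⊔#-cases a b with f0 a <ᵇ f0 b | <ᵇ-reflects-< (f0 a) (f0 b)
  ... | true  | r = inj₂ (refl , <⇒≤ (invert r))
  ... | false | r = inj₁ (refl , ≮⇒≥ (invert r))

  -- Each combination returns one of its two decoded operands, and decoded messages always fit;
  -- hence re-encoding loses nothing.
  combines-⊔# : ∀ {K x} → Combines (lift _⊔#_) K x →
    (∃[ k ] (k ∈ K × decode x ≡ decode k)) × (∀ k → k ∈ K → f0 (decode k) ≤ f0 (decode x))
  combines-⊔# (single {x}) = (x , here refl , refl) , λ { k (here refl) → ≤-refl }
  combines-⊔# (join {L} {L'} {K} {a} {b} ca cb p)
    with combines-⊔# ca | combines-⊔# cb | ⊔#-cases (decode a) (decode b)
  ... | (k , k∈ , ka) , ma | _ , mb | inj₁ (eq , b≤a) =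
    (k , ∈-resp-↭ p (∈-++⁺ˡ k∈) , trans dec ka) , bound
    where
    dec : decode (lift _⊔#_ a b) ≡ decode a
    dec = trans (cong (decode ∘ encode) eq) (decode-encode (decode-fits a))
    bound : ∀ k → k ∈ K → f0 (decode k) ≤ f0 (decode (lift _⊔#_ a b))
    bound k k∈ with ∈-++⁻ L (∈-resp-↭ (↭-sym p) k∈)
    ... | inj₁ q = ≤-trans (ma k q) (≤-reflexive (sym (cong f0 dec)))
    ... | inj₂ q = ≤-trans (≤-trans (mb k q) b≤a) (≤-reflexive (sym (cong f0 dec)))
  ... | _ , ma | (k , k∈ , kb) , mb | inj₂ (eq , a≤b) =
    (k , ∈-resp-↭ p (∈-++⁺ʳ L k∈) , trans dec kb) , bound
    where
    dec : decode (lift _⊔#_ a b) ≡ decode b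
    dec = trans (cong (decode ∘ encode) eq) (decode-encode (decode-fits b))
    bound : ∀ k → k ∈ K → f0 (decode k) ≤ f0 (decode (lift _⊔#_ a b))
    bound k k∈ with ∈-++⁻ L (∈-resp-↭ (↭-sym p) k∈)
    ... | inj₁ q = ≤-trans (≤-trans (ma k q) a≤b) (≤-reflexive (sym (cong f0 dec)))
    ... | inj₂ q = ≤-trans (mb k q) (≤-reflexive (sym (cong f0 dec)))

-- Rooted trees

abstract

  least : {P : ℕ → Set} → (∀ k → Dec (P k)) → ∀ k → P k → ∃[ m ] (P m × ∀ j → P j → m ≤ j)
  least {P} P? k p = go k 0 (λ _ ()) (subst P (sym (+-identityʳ k)) p)
    where
    go : ∀ k i → (∀ j → j < i → ¬ P j) → P (k + i) → ∃[ m ] (P m × ∀ j → P j → m ≤ j)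
    go k i below p with P? i
    ... | yes q = i , q , λ j r → ≮⇒≥ λ j<i → below j j<i r
    go zero    i below p | no ¬q = ⊥-elim (¬q p)
    go (suc k) i below p | no ¬q = go k (suc i)
      (λ j j<1+i q → case (m≤n⇒m<n∨m≡n (≤-pred j<1+i)) q) (subst P (sym (+-suc k i)) p)
      where
      case : ∀ {j} → j < i ⊎ j ≡ i → ¬ P j
      case (inj₁ j<i)  = below _ j<i
      case (inj₂ refl) = ¬q

-- Pigeonhole: punching a missed value out of the codomain would give an injection into a smaller
-- set.
injective-surjective : ∀ {m} {f : Fin m → Fin m} → Injective _≡_ _≡_ f → ∀ y → ∃[ x ] f x ≡ y
injective-surjective {suc m} {f} inj y with any? (λ x → f x ≟ y)
... | yes p = p
... | no ¬p = ⊥-elim (<-irrefl refl (injective⇒≤ {f = λ x → punchOut (y≢ x)}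
                (λ {x} {x'} eq → inj (punchOut-injective (y≢ x) (y≢ x') eq))))
  where
  y≢ : ∀ x → y ≢ f x
  y≢ x eq = ¬p (x , sym eq)

-- Skipping `r` with `punchIn` reduces this to the pigeonhole principle above. The inequality is
-- irrelevant so that the value of `f` cannot depend on its proof.
injective-off-point-surjective : ∀ {n m} (r : Fin n) (f : ∀ v → .(v ≢ r) → Fin m) → suc m ≡ n →
  (∀ v v' .p .p' → f v p ≡ f v' p' → v ≡ v') → ∀ e → ∃[ v ] Σ (v ≢ r) λ p → f v p ≡ e
injective-off-point-surjective r f refl inj e
  with injective-surjective {f = λ x → f (punchIn r x) (punchInᵢ≢i r x)} (λ eq → punchIn-injective r _ _ (inj _ _ _ _ eq)) e
... | x , eq = punchIn r x , punchInᵢ≢i r x , eq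

endpoint : ∀ {n} (es : EdgeList n) → Fin (length es) → Bool → Fin n
endpoint es e true  = proj₁ (lookup es e)
endpoint es e false = proj₂ (lookup es e)

edge-adj : ∀ {n} (es : EdgeList n) e s → Adj es (endpoint es e s) (endpoint es e (not s))
edge-adj es e true  = inj₁ (∈-lookup e)
edge-adj es e false = inj₂ (∈-lookup e)

adj-edge : ∀ {n} (es : EdgeList n) {u v} → Adj es u v → ∃[ e ] ∃[ s ] (endpoint es e s ≡ v × endpoint es e (not s) ≡ u)
adj-edge es (inj₁ p) = index p , false , cong proj₂ (sym (lookup-index p)) , cong proj₁ (sym (lookup-index p))
adj-edge es (inj₂ p) = index p , true , cong proj₁ (sym (lookup-index p)) , cong proj₂ (sym (lookup-index p))

-- The interface to the tree for all later arguments. By `ch-inj`, `up` and the depths, `ch` is a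
-- bijection from the edges onto the vertices other than `r`, so non-root vertices can be indexed by
-- their parent edges.
record Rooted {n} (es : EdgeList n) (r : Fin n) : Set where
  field
    childSide : Fin (length es) → Bool
    depth     : Fin n → ℕ
  ch : Fin (length es) → Fin n
  ch e = endpoint es e (childSide e)
  pa : Fin (length es) → Fin n
  pa e = endpoint es e (not (childSide e))
  field
    depth-r  : depth r ≡ 0
    depth-ch : ∀ e → depth (ch e) ≡ suc (depth (pa e))
    ch-inj   : ∀ {e e'} → ch e ≡ ch e' → e ≡ e'
    up       : ∀ v → v ≡ r ⊎ ∃[ e ] v ≡ ch e
    dist     : ∀ v → Dist es r v (depth v)

module _ {n} (es : EdgeList n) where

  adj? : ∀ u v → Dec (Adj es u v)
  adj? u v = ((u , v) ∈? es) ⊎-dec ((v , u) ∈? es)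
    where open DecMembership (≡-dec (_≟_ {n}) (_≟_ {n})) using (_∈?_)

  walk? : ∀ k u v → Dec (Walk es u v k)
  walk? zero    u v = map′ (λ { refl → here }) (λ { here → refl }) (u ≟ v)
  walk? (suc k) u v = map′ (λ { (w , a , p) → step a p }) (λ { (step a p) → _ , a , p })
    (any? (λ w → adj? u w ×-dec walk? k w v))

  star-walk : ∀ {u v} → Star (Adj es) u v → ∃[ k ] Walk es u v k
  star-walk ε       = 0 , here
  star-walk (a ◅ p) = let (k , q) = star-walk p in suc k , step a q

  walk-snoc : ∀ {k u w v} → Walk es u w k → Adj es w v → Walk es u v (suc k)
  walk-snoc here       b = step b here
  walk-snoc (step a p) b = step a (walk-snoc p b)

  walk-unsnoc : ∀ {k u v} → Walk es u v (suc k) → ∃[ w ] (Walk es u w k × Adj es w v)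
  walk-unsnoc (step a here)           = _ , here , a
  walk-unsnoc (step a p@(step _ _)) = let (w , q , b) = walk-unsnoc p in w , step a q , b

  module _ (tree : IsTree es) (r : Fin n) where

    private
      shortest : ∀ v → ∃[ k ] Dist es r v k
      shortest v = let (k , p) = star-walk (proj₂ tree r v) in least (λ j → walk? j r v) k p

      d : Fin n → ℕ
      d v = proj₁ (shortest v)

      -- The last edge of a shortest walk to `v` works: what precedes it is itself shortest, since a
      -- shorter walk could be extended by this edge.
      parentEdge : ∀ v → .(v ≢ r) → ∃[ e ] ∃[ s ] (endpoint es e s ≡ v × d v ≡ suc (d (endpoint es e (not s))))
      parentEdge v v≢r with d v in eq | proj₂ (shortest v)
      ... | zero  | here , _ = ⊥-elim-irr (v≢r refl)
      ... | suc k | p , min with walk-unsnoc p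
      ...   | w , q , a with adj-edge es a
      ...     | e , s , eq₁ , refl = e , s , eq₁ , cong suc (≤-antisym
                  (≤-pred (min _ (walk-snoc (proj₁ (proj₂ (shortest w))) a))) (proj₂ (proj₂ (shortest w)) k q))

      no-2-cycle : ∀ {a b : ℕ} → a ≡ suc b → ¬ (b ≡ suc a)
      no-2-cycle refl eq = <-irrefl eq (<-trans (n<1+n _) (n<1+n _))

      -- If one edge served both of its ends, each end would be one deeper than the other.
      parentEdge-inj : ∀ v v' .p .p' → proj₁ (parentEdge v p) ≡ proj₁ (parentEdge v' p') → v ≡ v'
      parentEdge-inj v v' p p' eq with parentEdge v p | parentEdge v' p'
      parentEdge-inj v v' p p' refl | e , s , eq₁ , dv | .e , s' , eq₁' , dv' with s | s'
      ... | true  | true  = trans (sym eq₁) eq₁'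
      ... | false | false = trans (sym eq₁) eq₁'
      ... | true  | false = ⊥-elim (no-2-cycle (subst (λ x → d v ≡ suc (d x)) eq₁' dv) (subst (λ x → d v' ≡ suc (d x)) eq₁ dv'))
      ... | false | true  = ⊥-elim (no-2-cycle (subst (λ x → d v ≡ suc (d x)) eq₁' dv) (subst (λ x → d v' ≡ suc (d x)) eq₁ dv'))

      -- There are as many edges as non-root vertices, so every edge is a parent edge.
      child : ∀ e → ∃[ v ] Σ (v ≢ r) λ p → proj₁ (parentEdge v p) ≡ e
      child = injective-off-point-surjective r (λ v p → proj₁ (parentEdge v p)) (proj₁ tree) parentEdge-inj

      side : Fin (length es) → Bool
      side e = let (v , p , _) = child e in proj₁ (proj₂ (parentEdge v p))

      side-spec : ∀ e → endpoint es e (side e) ≡ proj₁ (child e) × d (endpoint es e (side e)) ≡ suc (d (endpoint es e (not (side e))))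
      side-spec e with child e
      ... | v , p , refl = let (_ , _ , eq , dv) = parentEdge v p in eq , trans (cong d eq) dv

    rootTree : Rooted es r
    rootTree = record
      { childSide = side
      ; depth     = d
      ; depth-r   = n≤0⇒n≡0 (proj₂ (proj₂ (shortest r)) 0 here)
      ; depth-ch  = λ e → proj₂ (side-spec e)
      ; ch-inj    = λ {e} {e'} eq → same-child e e' (trans (sym (proj₁ (side-spec e))) (trans eq (proj₁ (side-spec e'))))
      ; up        = up
      ; dist      = λ v → proj₂ (shortest v)
      }
      where
      same-child : ∀ e e' → proj₁ (child e) ≡ proj₁ (child e') → e ≡ e'
      same-child e e' eq with child e | child e'
      ... | v , p , refl | v' , p' , refl = aux eq
        where
        aux : v ≡ v' → proj₁ (parentEdge v p) ≡ proj₁ (parentEdge v' p')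
        aux refl = refl
      up : ∀ v → v ≡ r ⊎ ∃[ e ] v ≡ endpoint es e (side e)
      up v with v ≟ r
      ... | yes eq = inj₁ eq
      ... | no v≢r = inj₂ (e , trans (parentEdge-inj v _ v≢r (proj₁ (proj₂ (child e))) (sym (proj₂ (proj₂ (child e)))))
                                     (sym (proj₁ (side-spec e))))
        where
        e : Fin (length es)
        e = proj₁ (parentEdge v v≢r)

bool-cases : ∀ b → b ≡ true ⊎ b ≡ false
bool-cases true  = inj₁ refl
bool-cases false = inj₂ refl

≢⇒≡not : ∀ {a b} → a ≢ b → a ≡ not b
≢⇒≡not {true}  {true}  p = ⊥-elim (p refl)
≢⇒≡not {true}  {false} _ = refl
≢⇒≡not {false} {true}  _ = refl
≢⇒≡not {false} {false} p = ⊥-elim (p refl)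

b≢not : ∀ {b} → b ≢ not b
b≢not {true}  ()
b≢not {false} ()

module RootedTheory {n} {es : EdgeList n} {r : Fin n} (R : Rooted es r) where

  open Rooted R public

  V E : Set
  V = Fin n
  E = Fin (length es)

  ep : E → Bool → V
  ep = endpoint es

  depth-pa< : ∀ e → depth (pa e) < depth (ch e)
  depth-pa< e = ≤-reflexive (sym (depth-ch e))

  ch≢r : ∀ e → ch e ≢ r
  ch≢r e eq with trans (sym (depth-ch e)) (trans (cong depth eq) depth-r)
  ... | ()

  -- This lets a message name an edge by the identifiers of its two endpoints.
  edge-unique : ∀ {e e'} → (∀ s → ep e s ≡ ep e' s) → e ≡ e'
  edge-unique {e} {e'} eq with childSide e Bool.≟ childSide e'
  ... | yes p = ch-inj (trans (eq (childSide e)) (cong (ep e') p))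
  ... | no ¬p = ⊥-elim (<-asym (depth-pa< e) (subst₂ _<_
          (cong depth (sym (trans (eq (childSide e)) (cong (ep e') (≢⇒≡not ¬p)))))
          (cong depth (sym (trans (eq (not (childSide e))) (cong (ep e') (trans (cong not (≢⇒≡not ¬p)) (not-involutive _))))))
          (depth-pa< e')))

  tree-ind : (P : V → Set) → P r → (∀ e → P (pa e) → P (ch e)) → ∀ v → P v
  tree-ind P base climb v = go (depth v) v ≤-refl
    where
    go : ∀ k v → depth v ≤ k → P v
    go k v d≤k with up v
    ... | inj₁ refl = base
    go zero    v d≤k | inj₂ (e , refl) = ⊥-elim (n≮0 (≤-trans (depth-pa< e) d≤k))
    go (suc k) v d≤k | inj₂ (e , refl) = climb e (go k (pa e) (≤-pred (≤-trans (depth-pa< e) d≤k)))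

  abstract

    -- Recursion along the path to the root, with the depth as fuel. The fuel never runs out at a
    -- non-root vertex, so the value in that branch is a dummy; being abstract, `fold` is known only
    -- through the two equations that follow.
    fold : {A : Set} → A → (E → A → A) → V → A
    fold {A} z s v = go (depth v) v
      where
      go : ℕ → V → A
      go k v with up v
      go k       v | inj₁ _       = z
      go zero    v | inj₂ _       = z
      go (suc k) v | inj₂ (e , _) = s e (go k (pa e))

    fold-r : ∀ {A : Set} (z : A) s → fold z s r ≡ z
    fold-r z s with up r
    ... | inj₁ _ = refl
    ... | inj₂ (e , eq) = ⊥-elim (ch≢r e (sym eq))

    fold-ch : ∀ {A : Set} (z : A) s e → fold z s (ch e) ≡ s e (fold z s (pa e))
    fold-ch z s e rewrite depth-ch e with up (ch e)
    ... | inj₁ eq = ⊥-elim (ch≢r e eq)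
    ... | inj₂ (e' , eq) rewrite ch-inj {e} {e'} eq = refl

  -- Components of a set of edges are represented by their vertex closest to the root

  top : (E → Bool) → V → V
  top F = fold r (λ e x → if F e then x else ch e)

  module _ (F : E → Bool) where

    top-r : top F r ≡ r
    top-r = fold-r _ _

    top-in : ∀ {e} → F e ≡ true → top F (ch e) ≡ top F (pa e)
    top-in {e} p with fold-ch r (λ e x → if F e then x else ch e) e
    ... | q rewrite p = q

    top-out : ∀ {e} → F e ≡ false → top F (ch e) ≡ ch e
    top-out {e} p with fold-ch r (λ e x → if F e then x else ch e) e
    ... | q rewrite p = q

    depth-top : ∀ v → depth (top F v) ≤ depth v
    depth-top = tree-ind _ (≤-reflexive (cong depth top-r)) λ e ih → aux e ih (bool-cases (F e))
      where
      aux : ∀ e → depth (top F (pa e)) ≤ depth (pa e) → F e ≡ true ⊎ F e ≡ false → depth (top F (ch e)) ≤ depth (ch e)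
      aux e ih (inj₁ p) rewrite top-in p = ≤-trans ih (<⇒≤ (depth-pa< e))
      aux e ih (inj₂ p) rewrite top-out p = ≤-refl

    IsTop : V → Set
    IsTop x = x ≡ r ⊎ ∃[ e ] (F e ≡ false × x ≡ ch e)

    top-view : ∀ v → IsTop (top F v)
    top-view = tree-ind _ (inj₁ top-r) λ e ih → aux e ih (bool-cases (F e))
      where
      aux : ∀ e → IsTop (top F (pa e)) → F e ≡ true ⊎ F e ≡ false → IsTop (top F (ch e))
      aux e ih (inj₁ p) = subst IsTop (sym (top-in p)) ih
      aux e ih (inj₂ p) = inj₂ (e , p , top-out p)

    top-idem : ∀ v → top F (top F v) ≡ top F v
    top-idem v with top-view v
    ... | inj₁ p rewrite p = top-r
    ... | inj₂ (e , q , p) rewrite p = top-out q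

    top-sides≢ : ∀ {e} → F e ≡ false → top F (ch e) ≢ top F (pa e)
    top-sides≢ {e} p eq = <-irrefl refl (<-≤-trans (depth-pa< e)
      (≤-trans (≤-reflexive (cong depth (trans (sym (top-out p)) eq))) (depth-top (pa e))))

    top-ends≢ : ∀ {e} → F e ≡ false → ∀ s → top F (ep e s) ≢ top F (ep e (not s))
    top-ends≢ {e} p s eq with s | childSide e in q | top-sides≢ {e} p
    ... | true  | true  | ne = ne eq
    ... | true  | false | ne = ne (sym eq)
    ... | false | true  | ne = ne (sym eq)
    ... | false | false | ne = ne eq

    top-ends≡ : ∀ {e} → F e ≡ true → ∀ s → top F (ep e s) ≡ top F (ep e (not s))
    top-ends≡ {e} p s with s | childSide e | top-in {e} p
    ... | true  | true  | eq = eq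
    ... | true  | false | eq = sym eq
    ... | false | true  | eq = sym eq
    ... | false | false | eq = eq

  top-cong : ∀ {F G : E → Bool} → (∀ e → F e ≡ G e) → ∀ v → top F v ≡ top G v
  top-cong {F} {G} F≡G = tree-ind _ (trans (top-r F) (sym (top-r G))) λ e ih → aux e ih (bool-cases (F e))
    where
    aux : ∀ e → top F (pa e) ≡ top G (pa e) → F e ≡ true ⊎ F e ≡ false → top F (ch e) ≡ top G (ch e)
    aux e ih (inj₁ p) = trans (top-in F p) (trans ih (sym (top-in G (trans (sym (F≡G e)) p))))
    aux e ih (inj₂ p) = trans (top-out F p) (sym (top-out G (trans (sym (F≡G e)) p)))

  top-const : ∀ {F} {A : Set} (f : V → A) → (∀ {e} → F e ≡ true → f (ch e) ≡ f (pa e)) → ∀ v → f v ≡ f (top F v)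
  top-const {F} f inv = tree-ind _ (cong f (sym (top-r F))) λ e ih → aux e ih (bool-cases (F e))
    where
    aux : ∀ e → f (pa e) ≡ f (top F (pa e)) → F e ≡ true ⊎ F e ≡ false → f (ch e) ≡ f (top F (ch e))
    aux e ih (inj₁ p) = trans (inv p) (trans ih (cong f (sym (top-in F p))))
    aux e ih (inj₂ p) = cong f (sym (top-out F p))

  top-mono : ∀ {F G} → (∀ {e} → F e ≡ true → G e ≡ true) → ∀ {u v} → top F u ≡ top F v → top G u ≡ top G v
  top-mono {F} {G} F⊆G {u} {v} eq = trans (lemma u) (trans (cong (top G) eq) (sym (lemma v)))
    where
    lemma : ∀ v → top G v ≡ top G (top F v)
    lemma = top-const {F} (top G) (λ p → top-in G (F⊆G p))

  top-none : ∀ {F} → (∀ e → F e ≡ false) → ∀ v → top F v ≡ v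
  top-none {F} none = tree-ind _ (top-r F) λ e _ → top-out F (none e)

  top-all : ∀ {F} → (∀ e → F e ≡ true) → ∀ v → top F v ≡ r
  top-all {F} all = tree-ind _ (top-r F) λ e ih → trans (top-in F (all e)) ih

  -- Ancestors and subtree sizes

  -- The number of occurrences of `v` on the path from `r` to `w`. As a number it can be summed:
  -- over `w` it gives the subtree size of `v`, over `v` the depth of `w` plus one.
  anc : V → V → ℕ
  anc v = fold (𝟙 (v ≟ r)) (λ e k → 𝟙 (v ≟ ch e) + k)

  anc-r : ∀ v → anc v r ≡ 𝟙 (v ≟ r)
  anc-r v = fold-r _ _

  anc-ch : ∀ v e → anc v (ch e) ≡ 𝟙 (v ≟ ch e) + anc v (pa e)
  anc-ch v e = fold-ch _ _ e

  anc-depth : ∀ v w → 0 < anc v w → depth v ≤ depth w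
  anc-depth v = tree-ind _ base climb
    where
    base : 0 < anc v r → depth v ≤ depth r
    base p rewrite anc-r v with v ≟ r
    ... | yes refl = ≤-refl
    climb : ∀ e → (0 < anc v (pa e) → depth v ≤ depth (pa e)) → 0 < anc v (ch e) → depth v ≤ depth (ch e)
    climb e ih p rewrite anc-ch v e with v ≟ ch e
    ... | yes refl = ≤-refl
    ... | no _     = ≤-trans (ih p) (<⇒≤ (depth-pa< e))

  anc-ch-pa : ∀ e → anc (ch e) (pa e) ≡ 0
  anc-ch-pa e with anc (ch e) (pa e) in eq
  ... | zero  = refl
  ... | suc _ = ⊥-elim (<-irrefl refl (<-≤-trans (depth-pa< e) (anc-depth (ch e) (pa e) (subst (0 <_) (sym eq) z<s))))

  anc≤1 : ∀ v w → anc v w ≤ 1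
  anc≤1 v = tree-ind _ (≤-trans (≤-reflexive (anc-r v)) (𝟙≤1 (v ≟ r))) climb
    where
    climb : ∀ e → anc v (pa e) ≤ 1 → anc v (ch e) ≤ 1
    climb e ih rewrite anc-ch v e with v ≟ ch e
    ... | yes refl rewrite anc-ch-pa e = ≤-refl
    ... | no _ = ih

  anc-self : ∀ v → anc v v ≡ 1
  anc-self = tree-ind _ (trans (anc-r r) (𝟙-yes (r ≟ r) refl))
    λ e _ → trans (anc-ch (ch e) e) (cong₂ _+_ (𝟙-yes (ch e ≟ ch e) refl) (anc-ch-pa e))

  size : V → ℕ
  size v = ∑ (anc v)

  size≤n : ∀ v → size v ≤ n
  size≤n v = ∑≤n (anc≤1 v)

  size-pos : ∀ v → 0 < size v
  size-pos v = ≤-trans (≤-reflexive (sym (anc-self v))) (term≤∑ (anc v) v)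

  depth<n : ∀ v → depth v < n
  depth<n v = ≤-trans (≤-reflexive (sym (count v))) (∑≤n (λ u → anc≤1 u v))
    where
    count : ∀ v → ∑ (λ u → anc u v) ≡ suc (depth v)
    count = tree-ind _
      (trans (∑-cong anc-r) (trans (∑-point r) (cong suc (sym depth-r))))
      λ e ih → trans (∑-cong (λ u → anc-ch u e)) (trans (∑-distrib-+ (λ u → 𝟙 (u ≟ ch e)) _)
        (cong₂ _+_ (∑-point (ch e)) (trans ih (sym (depth-ch e)))))
      where
      ∑-point : ∀ x → ∑ (λ u → 𝟙 (u ≟ x)) ≡ 1
      ∑-point x = trans (∑-single (λ u → 𝟙 (u ≟ x)) x (λ u ne → 𝟙-no (u ≟ x) ne)) (𝟙-yes (x ≟ x) refl)

  boundary? : ∀ F x e → Dec (F e ≡ false × top F (pa e) ≡ x)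
  boundary? F x e = (F e Bool.≟ false) ×-dec (top F (pa e) ≟ x)

  module _ (F : E → Bool) (x : V) (x-top : top F x ≡ x) where

    private
      hanging : V → ℕ
      hanging w = ∑ (λ e → 𝟙 (boundary? F x e) * anc (ch e) w)

      -- Balance of membership when descending along `e`. An edge of `F` preserves membership in the
      -- component of `x`; any other edge leaves that component, which makes it a boundary edge, or
      -- enters it, which happens only at its top, or does neither.
      shift : ∀ e → 𝟙 (x ≟ ch e) + 𝟙 (top F (pa e) ≟ x) ≡ 𝟙 (top F (ch e) ≟ x) + 𝟙 (boundary? F x e)
      shift e with bool-cases (F e)
      ... | inj₁ p = trans (cong₂ _+_ (𝟙-no (x ≟ ch e) x≢)
                              (𝟙-cong (top F (pa e) ≟ x) (top F (ch e) ≟ x) (trans (top-in F p)) (trans (sym (top-in F p)))))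
                       (trans (+-comm 0 _) (cong (𝟙 (top F (ch e) ≟ x) +_)
                          (sym (𝟙-no (boundary? F x e) λ { (q , _) → case (trans (sym p) q) }))))
        where
        case : true ≢ false
        case ()
        x≢ : x ≢ ch e
        x≢ refl = <-irrefl refl (≤-<-trans (≤-reflexive (cong depth (trans (sym x-top) (top-in F p))))
                    (≤-<-trans (depth-top F (pa e)) (depth-pa< e)))
      ... | inj₂ p = cong₂ _+_
        (𝟙-cong (x ≟ ch e) (top F (ch e) ≟ x) (λ q → trans (top-out F p) (sym q)) (λ q → trans (sym q) (top-out F p)))
        (𝟙-cong (top F (pa e) ≟ x) (boundary? F x e) (p ,_) proj₂)

      hanging-ch : ∀ e → hanging (ch e) ≡ 𝟙 (boundary? F x e) + hanging (pa e)
      hanging-ch e = begin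
        hanging (ch e)
          ≡⟨ ∑-cong (λ e' → trans (cong (𝟙 (boundary? F x e') *_) (anc-ch (ch e') e)) (*-distribˡ-+ (𝟙 (boundary? F x e')) _ _)) ⟩
        ∑ (λ e' → 𝟙 (boundary? F x e') * 𝟙 (ch e' ≟ ch e) + 𝟙 (boundary? F x e') * anc (ch e') (pa e))
          ≡⟨ ∑-distrib-+ (λ e' → 𝟙 (boundary? F x e') * 𝟙 (ch e' ≟ ch e)) _ ⟩
        ∑ (λ e' → 𝟙 (boundary? F x e') * 𝟙 (ch e' ≟ ch e)) + hanging (pa e)
          ≡⟨ cong (_+ hanging (pa e)) (∑-single _ e λ e' ne →
               trans (cong (𝟙 (boundary? F x e') *_) (𝟙-no (ch e' ≟ ch e) (ne ∘ ch-inj))) (*-zeroʳ (𝟙 (boundary? F x e')))) ⟩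
        𝟙 (boundary? F x e) * 𝟙 (ch e ≟ ch e) + hanging (pa e)
          ≡⟨ cong (_+ hanging (pa e)) (trans (cong (𝟙 (boundary? F x e) *_) (𝟙-yes (ch e ≟ ch e) refl)) (*-identityʳ _)) ⟩
        𝟙 (boundary? F x e) + hanging (pa e) ∎
        where open ≡-Reasoning

      -- A descendant of `x` lies in the component of `x` or below exactly one edge hanging from it.
      -- Each step down the tree changes both sides equally, by `shift` and `hanging-ch`.
      pointwise : ∀ w → anc x w ≡ 𝟙 (top F w ≟ x) + hanging w
      pointwise = tree-ind _ base climb
        where
        base : anc x r ≡ 𝟙 (top F r ≟ x) + hanging r
        base = trans (anc-r x) (trans (sym (+-identityʳ _)) (cong₂ _+_
          (𝟙-cong (x ≟ r) (top F r ≟ x) (λ q → trans (top-r F) (sym q)) (λ q → trans (sym q) (top-r F)))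
          (sym (∑-zero λ e → trans (cong (𝟙 (boundary? F x e) *_) (trans (anc-r (ch e)) (𝟙-no (ch e ≟ r) (ch≢r e))))
                                   (*-zeroʳ (𝟙 (boundary? F x e)))))))
        climb : ∀ e → anc x (pa e) ≡ 𝟙 (top F (pa e) ≟ x) + hanging (pa e) → anc x (ch e) ≡ 𝟙 (top F (ch e) ≟ x) + hanging (ch e)
        climb e ih = begin
          anc x (ch e)                                                    ≡⟨ anc-ch x e ⟩
          𝟙 (x ≟ ch e) + anc x (pa e)                                     ≡⟨ cong (𝟙 (x ≟ ch e) +_) ih ⟩
          𝟙 (x ≟ ch e) + (𝟙 (top F (pa e) ≟ x) + hanging (pa e))          ≡⟨ +-assoc (𝟙 (x ≟ ch e)) _ _ ⟨
          𝟙 (x ≟ ch e) + 𝟙 (top F (pa e) ≟ x) + hanging (pa e)            ≡⟨ cong (_+ hanging (pa e)) (shift e) ⟩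
          𝟙 (top F (ch e) ≟ x) + 𝟙 (boundary? F x e) + hanging (pa e)     ≡⟨ +-assoc (𝟙 (top F (ch e) ≟ x)) _ _ ⟩
          𝟙 (top F (ch e) ≟ x) + (𝟙 (boundary? F x e) + hanging (pa e))   ≡⟨ cong (𝟙 (top F (ch e) ≟ x) +_) (hanging-ch e) ⟨
          𝟙 (top F (ch e) ≟ x) + hanging (ch e)                           ∎
          where open ≡-Reasoning

    size-split : size x ≡ ∑ (λ w → 𝟙 (top F w ≟ x)) + ∑ (λ e → 𝟙 (boundary? F x e) * size (ch e))
    size-split = begin
      size x                                               ≡⟨ ∑-cong pointwise ⟩
      ∑ (λ w → 𝟙 (top F w ≟ x) + hanging w)                ≡⟨ ∑-distrib-+ (λ w → 𝟙 (top F w ≟ x)) hanging ⟩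
      ∑ (λ w → 𝟙 (top F w ≟ x)) + ∑ hanging                ≡⟨ cong (∑ (λ w → 𝟙 (top F w ≟ x)) +_) (trans
        (∑-swap (λ w e → 𝟙 (boundary? F x e) * anc (ch e) w)) (∑-cong λ e → ∑-*ˡ (𝟙 (boundary? F x e)) (anc (ch e)))) ⟩
      _ ∎
      where
      open ≡-Reasoning
      ∑-*ˡ : ∀ {k} c (f : Fin k → ℕ) → ∑ (λ w → c * f w) ≡ c * ∑ f
      ∑-*ˡ {zero}  c f = sym (*-zeroʳ c)
      ∑-*ˡ {suc k} c f = trans (cong (c * f zero +_) (∑-*ˡ c (f ∘ suc))) (sym (*-distribˡ-+ c (f zero) _))

  size-child≤ : ∀ e → size (ch e) ≤ size (pa e)
  size-child≤ e = ∑-mono (tree-ind _ base climb)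
    where
    base : anc (ch e) r ≤ anc (pa e) r
    base = ≤-trans (≤-reflexive (trans (anc-r (ch e)) (𝟙-no (ch e ≟ r) (ch≢r e)))) z≤n
    climb : ∀ e' → anc (ch e) (pa e') ≤ anc (pa e) (pa e') → anc (ch e) (ch e') ≤ anc (pa e) (ch e')
    climb e' ih rewrite anc-ch (ch e) e' | anc-ch (pa e) e' with ch e ≟ ch e'
    ... | no _ = ≤-trans ih (m≤n+m _ _)
    ... | yes eq rewrite sym (ch-inj eq) | anc-ch-pa e | anc-self (pa e) = m≤n+m _ _

  -- The subtrees of siblings are disjoint, which is checked for each vertex by descending to it.
  -- With a heavy sibling this yields the factor two along light edges.
  size-siblings : ∀ {e h} → e ≢ h → pa e ≡ pa h → size (ch e) + size (ch h) ≤ size (pa e)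
  size-siblings {e} {h} e≢h pa≡ = ≤-trans (≤-reflexive (sym (∑-distrib-+ (anc (ch e)) (anc (ch h))))) (∑-mono (tree-ind _ base climb))
    where
    open ≤-Reasoning
    base : anc (ch e) r + anc (ch h) r ≤ anc (pa e) r
    base = ≤-trans (≤-reflexive (cong₂ _+_ (trans (anc-r (ch e)) (𝟙-no (ch e ≟ r) (ch≢r e)))
                                           (trans (anc-r (ch h)) (𝟙-no (ch h ≟ r) (ch≢r h))))) z≤n
    climb : ∀ e' → anc (ch e) (pa e') + anc (ch h) (pa e') ≤ anc (pa e) (pa e') → anc (ch e) (ch e') + anc (ch h) (ch e') ≤ anc (pa e) (ch e')
    climb e' ih with e' ≟ e | e' ≟ h
    ... | yes refl | yes refl = ⊥-elim (e≢h refl)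
    ... | yes refl | no ne = begin
      anc (ch e) (ch e) + anc (ch h) (ch e)     ≡⟨ cong₂ _+_ (anc-self (ch e)) (trans (anc-ch (ch h) e) (cong₂ _+_ (𝟙-no (ch h ≟ ch e) (ne ∘ sym ∘ ch-inj)) (subst (λ v → anc (ch h) v ≡ 0) (sym pa≡) (anc-ch-pa h)))) ⟩
      1                                         ≡⟨ anc-self (pa e) ⟨
      anc (pa e) (pa e)                         ≤⟨ m≤n+m _ _ ⟩
      𝟙 (pa e ≟ ch e) + anc (pa e) (pa e)       ≡⟨ anc-ch (pa e) e ⟨
      anc (pa e) (ch e)                         ∎
    ... | no ne | yes refl = begin
      anc (ch e) (ch h) + anc (ch h) (ch h)     ≡⟨ cong₂ _+_ (trans (anc-ch (ch e) h) (cong₂ _+_ (𝟙-no (ch e ≟ ch h) (ne ∘ sym ∘ ch-inj)) (subst (λ v → anc (ch e) v ≡ 0) pa≡ (anc-ch-pa e)))) (anc-self (ch h)) ⟩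
      1                                         ≡⟨ anc-self (pa h) ⟨
      anc (pa h) (pa h)                         ≡⟨ cong (λ v → anc v (pa h)) pa≡ ⟨
      anc (pa e) (pa h)                         ≤⟨ m≤n+m _ _ ⟩
      𝟙 (pa e ≟ ch h) + anc (pa e) (pa h)       ≡⟨ anc-ch (pa e) h ⟨
      anc (pa e) (ch h)                         ∎
    ... | no ne | no ne' = begin
      anc (ch e) (ch e') + anc (ch h) (ch e')   ≡⟨ cong₂ _+_ (trans (anc-ch (ch e) e') (cong (_+ anc (ch e) (pa e')) (𝟙-no (ch e ≟ ch e') (ne ∘ sym ∘ ch-inj))))
                                                             (trans (anc-ch (ch h) e') (cong (_+ anc (ch h) (pa e')) (𝟙-no (ch h ≟ ch e') (ne' ∘ sym ∘ ch-inj)))) ⟩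
      anc (ch e) (pa e') + anc (ch h) (pa e')   ≤⟨ ih ⟩
      anc (pa e) (pa e')                        ≤⟨ m≤n+m _ _ ⟩
      𝟙 (pa e ≟ ch e') + anc (pa e) (pa e')     ≡⟨ anc-ch (pa e) e' ⟨
      anc (pa e) (ch e')                        ∎

  -- Root paths

  depth-unique : ∀ {v k} → Depth es r v k → k ≡ depth v
  depth-unique {v} (p , min) = ≤-antisym (min _ (proj₁ (dist v))) (proj₂ (dist v) _ p)

  edge-cases : ∀ e s → (ep e s ≡ ch e × ep e (not s) ≡ pa e) ⊎ (ep e s ≡ pa e × ep e (not s) ≡ ch e)
  edge-cases e s with s | childSide e
  ... | true  | true  = inj₁ (refl , refl)
  ... | true  | false = inj₂ (refl , refl)
  ... | false | true  = inj₂ (refl , refl)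
  ... | false | false = inj₁ (refl , refl)

  adj-cases : ∀ {u v} → Adj es u v → ∃[ e ] ((v ≡ ch e × u ≡ pa e) ⊎ (v ≡ pa e × u ≡ ch e))
  adj-cases a with adj-edge es a
  ... | e , s , refl , refl = e , edge-cases e s

  pa-adj : ∀ e → Adj es (pa e) (ch e)
  pa-adj e with childSide e | edge-adj es e true | edge-adj es e false
  ... | true  | _ | a = a
  ... | false | a | _ = a

  edge-child : ∀ e → Child es r (pa e) (ch e)
  edge-child e = pa-adj e , depth (pa e) , dist (pa e) , subst (Dist es r (ch e)) (depth-ch e) (dist (ch e))

  child-edge : ∀ {u c} → Child es r u c → ∃[ e ] (c ≡ ch e × u ≡ pa e)
  child-edge (a , k , du , dc) with adj-cases a
  ... | e , inj₁ p = e , p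
  ... | e , inj₂ (refl , refl) = ⊥-elim (<-irrefl refl (<-trans (n<1+n _)
          (≤-trans (≤-reflexive (trans (cong suc (depth-unique dc)) (sym (depth-ch e)))) (≤-reflexive (sym (depth-unique du))))))

  rootPath : V → List V
  rootPath = fold (r ∷ []) (λ e P → P ++ ch e ∷ [])

  rootPath-r : rootPath r ≡ r ∷ []
  rootPath-r = fold-r _ _

  rootPath-ch : ∀ e → rootPath (ch e) ≡ rootPath (pa e) ++ ch e ∷ []
  rootPath-ch = fold-ch _ _

  path-snoc : ∀ {u v w P} → PathL es u v P → Adj es v w → PathL es u w (P ++ w ∷ [])
  path-snoc here       b = step b here
  path-snoc (step a p) b = step a (path-snoc p b)

  rootPath-anc : ∀ v w → v ∈ rootPath w → 0 < anc v w
  rootPath-anc v = tree-ind _ base climb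
    where
    base : v ∈ rootPath r → 0 < anc v r
    base p rewrite rootPath-r | anc-r v with p
    ... | here eq = ≤-reflexive (sym (𝟙-yes (v ≟ r) eq))
    climb : ∀ e → (v ∈ rootPath (pa e) → 0 < anc v (pa e)) → v ∈ rootPath (ch e) → 0 < anc v (ch e)
    climb e ih p rewrite rootPath-ch e | anc-ch v e with ∈-++⁻ (rootPath (pa e)) p
    ... | inj₁ q = ≤-trans (ih q) (m≤n+m _ _)
    ... | inj₂ (here eq) rewrite 𝟙-yes (v ≟ ch e) eq = z<s

  anc-rootPath : ∀ v w → 0 < anc v w → v ∈ rootPath w
  anc-rootPath v = tree-ind _ base climb
    where
    base : 0 < anc v r → v ∈ rootPath r
    base p rewrite rootPath-r | anc-r v with v ≟ r
    ... | yes eq = here eq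
    climb : ∀ e → (0 < anc v (pa e) → v ∈ rootPath (pa e)) → 0 < anc v (ch e) → v ∈ rootPath (ch e)
    climb e ih p rewrite rootPath-ch e | anc-ch v e with v ≟ ch e
    ... | yes eq = ∈-++⁺ʳ (rootPath (pa e)) (here eq)
    ... | no _   = ∈-++⁺ˡ (ih p)

  rootPath-valid : ∀ v → RootPath es r v (rootPath v)
  rootPath-valid = tree-ind _ base climb
    where
    base : RootPath es r r (rootPath r)
    base rewrite rootPath-r = here , [] ∷ []
    climb : ∀ e → RootPath es r (pa e) (rootPath (pa e)) → RootPath es r (ch e) (rootPath (ch e))
    climb e (p , u) rewrite rootPath-ch e = path-snoc p (pa-adj e) , Unique.++⁺ u ([] ∷ [])
      λ { (q , here refl) → n≮0 (≤-trans (rootPath-anc _ _ q) (≤-reflexive (anc-ch-pa e))) }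

  start∈path : ∀ {u v P} → PathL es u v P → u ∈ P
  start∈path here       = here refl
  start∈path (step _ _) = here refl

  -- A simple path that does not enter the parent of its start can only descend.
  descending-path : ∀ {u v P} Q → PathL es u v P → Unique P → (∀ e → u ≡ ch e → pa e ∉ P) →
                    rootPath u ≡ Q ++ u ∷ [] → rootPath v ≡ Q ++ P
  descending-path Q here _ _ eq = eq
  descending-path {u} Q (step {P = P} a p) (u∉P ∷ uP) avoid eq with adj-cases a
  ... | e , inj₂ (refl , u≡) = ⊥-elim (avoid e u≡ (there (start∈path p)))
  ... | e , inj₁ (refl , refl) = trans
    (descending-path (Q ++ pa e ∷ []) p uP
      (λ e' eq' → λ pa∈ → All.lookup u∉P pa∈ (cong pa (ch-inj {e} {e'} eq')))
      (trans (rootPath-ch e) (cong (_++ ch e ∷ []) eq)))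
    (++-assoc Q (pa e ∷ []) P)

  rootPath-unique : ∀ {v P} → RootPath es r v P → P ≡ rootPath v
  rootPath-unique (p , u) = sym (descending-path [] p u (λ e eq → ⊥-elim (ch≢r e (sym eq))) rootPath-r)

  subtreeSize-unique : ∀ {v s} → SubtreeSize es r v s → s ≡ size v
  subtreeSize-unique {v} (L , uL , mem , refl) = begin
    length L                                    ≡⟨ length-sum L ⟩
    sum (map (λ _ → 1) L)                       ≡⟨ sum-enumeration-Fin (λ w → 0 <? anc v w) (λ _ → 1) (uL , λ w → mk⇔ (to w) (from w)) ⟩
    ∑ (λ w → 𝟙 (0 <? anc v w) * 1)              ≡⟨ ∑-cong (λ w → trans (*-identityʳ _) (indicator w)) ⟩
    size v                                      ∎
    where
    open ≡-Reasoning
    length-sum : ∀ (L : List V) → length L ≡ sum (map (λ _ → 1) L)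
    length-sum []      = refl
    length-sum (_ ∷ L) = cong suc (length-sum L)
    to : ∀ w → w ∈ L → 0 < anc v w
    to w p with Equivalence.to (mem w) p
    ... | P , rp , v∈P = rootPath-anc v w (subst (v ∈_) (rootPath-unique rp) v∈P)
    from : ∀ w → 0 < anc v w → w ∈ L
    from w p = Equivalence.from (mem w) (rootPath w , rootPath-valid w , anc-rootPath v w p)
    indicator : ∀ w → 𝟙 (0 <? anc v w) ≡ anc v w
    indicator w with anc v w | anc≤1 v w
    ... | zero          | _       = refl
    ... | suc zero      | _       = refl
    ... | suc (suc _)   | s≤s ()

-- The instructions of the algorithm

-- Most tasks take a pair of rounds: an aggregate reaches only the nodes, while edges learn only
-- consensus values, so what the nodes obtain must be broadcast in the following round before edges
-- can store it or pass it on. In `propose`, `θ` is the size below which components move, and `b` is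
-- the value that bit `i` of their identifier must have.
data Instr : Set where
  propose    : (level θ i : ℕ) (b : Bool) → Instr
  commit     : (level : ℕ) → Instr
  orient     : (level : ℕ) → Instr
  subtotal   : (level : ℕ) → Instr
  storeSize  : (level : ℕ) → Instr
  readDepth  : Instr
  addDepth   : (level : ℕ) → Instr
  pickHeavy  : Instr
  markHeavy  : Instr
  firstLight : Instr
  nextLight  : Instr

-- cid identifies the current component, flag marks the vertices known to be the top of their component,
-- and reg is carried over to the next round.
record NodeSt : Set where
  field
    nid  : ℕ
    cid  : ℕ
    flag : Bool
    ndep : ℕ
    reg  : Quad
    lst  : List HLEntry
open NodeSt public

-- Sides of an edge are booleans, true being the first endpoint.  tau is the step at which the edge is contracted
-- (initially out of range), mov the side that moved; ori is the side of the child once orid holds; sz is the size of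
-- the child's subtree and pd the depth of the parent.
record EdgeSt : Set where
  field
    eid  : Bool → ℕ
    tau  : ℕ
    mov  : Bool
    orid : Bool
    ori  : Bool
    sz   : ℕ
    pd   : ℕ
    hvy  : Bool
open EdgeSt public

-- Within one merging step the edges whose moving side is the child come first: this makes the levels
-- strictly increase from an edge to the parent edge of the component it hangs from.
lev : EdgeSt → ℕ
lev x = 2 * tau x + (if ⌊ mov x Bool.≟ ori x ⌋ then 0 else 1)

-- In the consensus value of `propose`, the first field has become the size of the component,
-- because every vertex contributes one, and the second is the identifier of the component.
Ready : (θ i : ℕ) (b : Bool) (own oth : Quad) → Set
Ready θ i b own oth = f0 own < θ × bit i (f1 own) ≡ b × bit i (f1 oth) ≢ b

ready? : ∀ θ i b own oth → Dec (Ready θ i b own oth)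
ready? θ i b own oth = (f0 own <? θ) ×-dec (bit i (f1 own) Bool.≟ b) ×-dec ¬? (bit i (f1 oth) Bool.≟ b)

-- A positive first field says that the component moves; the next two name the edge it moves along.
Chosen : EdgeSt → Quad → Set
Chosen x y = 0 < f0 y × f1 y ≡ eid x true × f2 y ≡ eid x false

chosen? : ∀ x y → Dec (Chosen x y)
chosen? x y = (0 <? f0 y) ×-dec (f1 y ℕ.≟ eid x true) ×-dec (f2 y ℕ.≟ eid x false)

Reached : ℕ → EdgeSt → Quad → Set
Reached t x y = orid x ≡ false × tau x ≡ t × 0 < f0 y

reached? : ∀ t x y → Dec (Reached t x y)
reached? t x y = (orid x Bool.≟ false) ×-dec (tau x ℕ.≟ t) ×-dec (0 <? f0 y)

contracts : Instr → EdgeSt → Bool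
contracts (propose s _ _ _) x = ⌊ tau x <? s ⌋
contracts (commit s)        x = ⌊ tau x <? s ⌋
contracts (orient s)        x = ⌊ tau x <? s ⌋
contracts (subtotal l)      x = ⌊ lev x <? l ⌋
contracts (storeSize l)     x = ⌊ lev x <? l ⌋
contracts (addDepth l)      x = ⌊ lev x <? l ⌋
contracts readDepth         x = false
contracts pickHeavy         x = false
contracts markHeavy         x = false
contracts firstLight        x = hvy x
contracts nextLight         x = hvy x

value : Instr → NodeSt → Quad
value (propose _ _ _ _) s = quad 1 (cid s) 0 0
value (commit _)        s = quad (f0 (reg s)) (f1 (reg s)) (f2 (reg s)) (cid s)
value (orient _)        s = quad (𝔹 (flag s)) 0 0 0
value (subtotal _)      s = quad 1 0 0 0
value (storeSize _)     s = reg s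
value readDepth         s = quad 0 (ndep s) 0 0
value (addDepth _)      s = 0#
value pickHeavy         s = 0#
value markHeavy         s = reg s
value firstLight        s = 0#
value nextLight         s = reg s

-- own is the consensus value on the receiving side s, oth the one on the other side.
message : Instr → EdgeSt → (s : Bool) (own oth : Quad) → Quad
message (propose _ θ i b) x s own oth = if ⌊ ready? θ i b own oth ⌋ then quad 1 (eid x true) (eid x false) 0 else 0#
message (commit _)        x s own oth = if ⌊ chosen? x own ⌋ then quad 1 (f3 oth) 0 0 else 0#
message (orient t)        x s own oth = if ⌊ reached? t x oth ⌋ then quad 1 (eid x s) 0 0 else 0#
message (subtotal _)      x s own oth = if ⌊ s Bool.≟ ori x ⌋ then 0# else quad (sz x) 0 0 0
message (storeSize _)     x s own oth = 0#
message readDepth         x s own oth = 0#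
message (addDepth l)      x s own oth = if ⌊ (s Bool.≟ ori x) ×-dec (lev x ℕ.≟ l) ⌋ then quad 1 (suc (pd x)) 0 0 else 0#
message pickHeavy         x s own oth = if ⌊ s Bool.≟ ori x ⌋ then 0# else quad (sz x) (eid x (ori x)) 0 0
message markHeavy         x s own oth = 0#
message firstLight        x s own oth = if ⌊ s Bool.≟ ori x ⌋ then quad 1 (pd x) (eid x (not (ori x))) (eid x (ori x)) else 0#
message nextLight         x s own oth =
  if ⌊ (s Bool.≟ ori x) ×-dec (0 <? f0 oth) ⌋ then quad 1 (f1 oth) (f2 oth) (f3 oth) else 0#

aggregate : Instr → Quad → Quad → Quad
aggregate (subtotal _) = _⊕_
aggregate _            = _⊔#_

updateEdge : Instr → EdgeSt → (Bool → Quad) → EdgeSt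
updateEdge (commit s) x y = record x
  { tau = if ⌊ chosen? x (y true) ⊎-dec chosen? x (y false) ⌋ then s else tau x
  -- Unmerged edges overwrite this value at every step. It becomes final when the edge is merged,
  -- because contracted edges are not updated.
  ; mov = ⌊ chosen? x (y true) ⌋ }
updateEdge (orient t) x y = record x
  { orid = orid x ∨ ⌊ reached? t x (y true) ⊎-dec reached? t x (y false) ⌋
  -- The side already reached from the root is the parent side, so the child is on the opposite one.
  ; ori  = if ⌊ reached? t x (y true) ⌋ then false else if ⌊ reached? t x (y false) ⌋ then true else ori x }
updateEdge (storeSize l) x y = record x { sz = if ⌊ lev x ℕ.≟ l ⌋ then f1 (y (ori x)) else sz x }
updateEdge readDepth     x y = record x { pd = f1 (y (not (ori x))) }
updateEdge markHeavy     x y = record x { hvy = ⌊ f1 (y (not (ori x))) ℕ.≟ eid x (ori x) ⌋ }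
updateEdge _             x y = x

entry : Quad → HLEntry
entry g = f1 g , f2 g , suc (f1 g) , f3 g

updateNode : Instr → NodeSt → (y g : Quad) → NodeSt
updateNode (propose _ _ _ _) s y g = record s { reg = g }
updateNode (commit _)        s y g = record s { cid = if ⌊ 0 <? f0 g ⌋ then f1 g else cid s }
updateNode (orient _)        s y g = record s { flag = flag s ∨ ⌊ (0 <? f0 g) ×-dec (f1 g ℕ.≟ nid s) ⌋ }
updateNode (subtotal _)      s y g = record s { reg = quad 0 (f0 y + f0 g) 0 0 }
updateNode (storeSize _)     s y g = s
updateNode readDepth         s y g = s
updateNode (addDepth _)      s y g = record s { ndep = if ⌊ 0 <? f0 g ⌋ then ndep s + f1 g else ndep s }
updateNode pickHeavy         s y g = record s { reg = quad 0 (f1 g) 0 0 }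
updateNode markHeavy         s y g = s
updateNode firstLight        s y g = record s
  { reg = if ⌊ 0 <? f0 g ⌋ then g else 0# ; lst = if ⌊ 0 <? f0 g ⌋ then entry g ∷ lst s else lst s }
updateNode nextLight         s y g = record s
  { reg = if ⌊ 0 <? f0 g ⌋ then g else 0# ; lst = if ⌊ 0 <? f0 g ⌋ then entry g ∷ lst s else lst s }

⌊⌋-yes : ∀ {a} {A : Set a} (d : Dec A) → A → ⌊ d ⌋ ≡ true
⌊⌋-yes (yes _) _ = refl
⌊⌋-yes (no ¬a) a = ⊥-elim (¬a a)

⌊⌋-no : ∀ {a} {A : Set a} (d : Dec A) → ¬ A → ⌊ d ⌋ ≡ false
⌊⌋-no (yes a) ¬a = ⊥-elim (¬a a)
⌊⌋-no (no  _) _  = refl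

⌊⌋-true : ∀ {a} {A : Set a} (d : Dec A) → ⌊ d ⌋ ≡ true → A
⌊⌋-true (yes a) _ = a

⌊⌋-false : ∀ {a} {A : Set a} (d : Dec A) → ⌊ d ⌋ ≡ false → ¬ A
⌊⌋-false (no ¬a) _ = ¬a

if-yes : ∀ {a b} {A : Set a} {B : Set b} (d : Dec A) {x y : B} → A → (if ⌊ d ⌋ then x else y) ≡ x
if-yes (yes _) _ = refl
if-yes (no ¬a) a = ⊥-elim (¬a a)

if-no : ∀ {a b} {A : Set a} {B : Set b} (d : Dec A) {x y : B} → ¬ A → (if ⌊ d ⌋ then x else y) ≡ y
if-no (yes a) ¬a = ⊥-elim (¬a a)
if-no (no _)  _  = refl

-- Compilation to a Minor-Aggregation algorithm, and the meaning of one round on a tree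

-- The default is a filler: the run under study stops at the length of the program.
nth : List Instr → ℕ → Instr
nth []       _       = readDepth
nth (i ∷ _)  zero    = i
nth (_ ∷ is) (suc t) = nth is t

module Compile (W T : ℕ) (prog : List Instr) where

  open Coding W public

  -- A supernode without incident edges is treated as having received `0#`. A zero first field thus
  -- always reads as the absence of a message.
  decodeMaybe : Maybe (Msg width) → Quad
  decodeMaybe (just m) = decode m
  decodeMaybe nothing  = 0#

  decodeMaybe-fits : ∀ m → Fits (decodeMaybe m)
  decodeMaybe-fits (just m) = decode-fits m
  decodeMaybe-fits nothing  = fits (m^n>0 2 W) (m^n>0 2 W) (m^n>0 2 W) (m^n>0 2 W)

  select : {A : Set} → A → A → Bool → A
  select a b s = if s then a else b

  algorithm : Algorithm width
  algorithm = record
    { NodeState     = NodeSt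
    ; EdgeState     = EdgeSt
    ; rounds        = length prog
    ; initNode      = λ v root → record { nid = v ; cid = v ; flag = root ; ndep = 0 ; reg = 0# ; lst = [] }
    ; initEdge      = λ u v → record { eid = select u v ; tau = T ; mov = false ; orid = false ; ori = false
                                     ; sz = 0 ; pd = 0 ; hvy = false }
    ; contract      = λ t → contracts (nth prog t)
    ; consensusVal  = λ t s → encode (value (nth prog t) s)
    ; consensusOp   = λ t → lift _⊕_
    ; edgeMsgs      = λ t x yF yS → encode (message (nth prog t) x true (decode yF) (decode yS))
                                  , encode (message (nth prog t) x false (decode yS) (decode yF))
    ; edgeUpdate    = λ t x yF yS → updateEdge (nth prog t) x (select (decode yF) (decode yS))
    ; aggregationOp = λ t → lift (aggregate (nth prog t))
    ; nodeUpdate    = λ t s y g → updateNode (nth prog t) s (decode y) (decodeMaybe g)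
    ; output        = λ s → ndep s , lst s
    }

  module OnTree {n} {es : EdgeList n} {r : Fin n} (R : Rooted es r) (ids : Fin n → ℕ) where

    open RootedTheory R public
    module X = Execution algorithm es ids r
    open X using (Config; initConfig; Reach)

    -- Bounding the sum over all vertices bounds the sum over every supernode at once, whatever is
    -- contracted.
    Sendable : Instr → Config → Set
    Sendable ins (ns , _) = (∀ v → Fits (value ins (ns v))) × ∑ (λ v → f0 (value ins (ns v))) < 2 ^ W

    -- The view of a round on which the analysis rests: supernodes are the fibres of `top F`, and
    -- the unknown aggregation order survives only as the choice of a contributor in `Y-rest` and of
    -- a maximizer in `G-from`.
    record Round (ins : Instr) (c c' : Config) : Set where
      ns = proj₁ c
      est = proj₂ c
      F : E → Bool
      F e = contracts ins (est e)
      field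
        Y : V → Quad
        G : V → Quad
        Y-fits : ∀ v → Fits (Y v)
        G-fits : ∀ v → Fits (G v)
      sent : E → Bool → Quad
      sent e s = message ins (est e) s (Y (ep e s)) (Y (ep e (not s)))
      incident? : ∀ v e s → Dec (F e ≡ false × top F (ep e s) ≡ top F v)
      incident? v e s = (F e Bool.≟ false) ×-dec (top F (ep e s) ≟ top F v)
      received : V → ℕ
      received v = ∑ (λ e → 𝟙 (incident? v e true) * f0 (sent e true) + 𝟙 (incident? v e false) * f0 (sent e false))
      field
        G-same : ∀ {u v} → top F u ≡ top F v → G u ≡ G v
        Y-sum  : Sendable ins c → ∀ v → f0 (Y v) ≡ ∑ (λ u → 𝟙 (top F u ≟ top F v) * f0 (value ins (ns u)))
        Y-rest : Sendable ins c → ∀ v → ∃[ u ] (top F u ≡ top F v × rest (Y v) ≡ rest (value ins (ns u)))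
        G-from : aggregate ins ≡ _⊔#_ → (∀ e s → Fits (sent e s)) → ∀ v → 0 < f0 (G v) →
                 ∃[ e ] ∃[ s ] (F e ≡ false × top F (ep e s) ≡ top F v × G v ≡ sent e s)
        G-max  : aggregate ins ≡ _⊔#_ → (∀ e s → Fits (sent e s)) → ∀ v e s →
                 F e ≡ false → top F (ep e s) ≡ top F v → f0 (sent e s) ≤ f0 (G v)
        G-sum  : aggregate ins ≡ _⊕_ → (∀ e s → Fits (sent e s)) → ∀ v → received v < 2 ^ W → f0 (G v) ≡ received v
        node   : ∀ v → proj₁ c' v ≡ updateNode ins (ns v) (Y v) (G v)
        edge   : ∀ e → proj₂ c' e ≡ (if F e then est e else updateEdge ins (est e) (select (Y (ep e true)) (Y (ep e false))))

      keepNode : {A : Set} (f : NodeSt → A) → (∀ x y g → f (updateNode ins x y g) ≡ f x) → ∀ v → f (proj₁ c' v) ≡ f (ns v)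
      keepNode f k v = trans (cong f (node v)) (k (ns v) (Y v) (G v))

      keepEdge : {A : Set} (f : EdgeSt → A) → (∀ x y → f (updateEdge ins x y) ≡ f x) → ∀ e → f (proj₂ c' e) ≡ f (est e)
      keepEdge f k e with F e | edge e
      ... | true  | eq = cong f eq
      ... | false | eq = trans (cong f eq) (k (est e) _)

      edge-in : ∀ {e} → F e ≡ true → proj₂ c' e ≡ est e
      edge-in {e} p with F e | edge e
      ... | true | eq = eq

      edge-out : ∀ {e} → F e ≡ false → proj₂ c' e ≡ updateEdge ins (est e) (select (Y (ep e true)) (Y (ep e false)))
      edge-out {e} p with F e | edge e
      ... | false | eq = eq

    select-ep : ∀ {A : Set} (Y : V → A) e s → select (Y (ep e true)) (Y (ep e false)) s ≡ Y (ep e s)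
    select-ep Y e true  = refl
    select-ep Y e false = refl

    module _ (t : ℕ) (c c' : Config) (stp : X.Step t c c') where

      private
        ins = nth prog t
        ns = proj₁ c
        est = proj₂ c
        F : E → Bool
        F e = contracts ins (est e)

        Joined : V → V → Set
        Joined u v = ∃[ e ] (F e ≡ true × ((ep e true ≡ u × ep e false ≡ v) ⊎ (ep e true ≡ v × ep e false ≡ u)))

        same→top : ∀ {u v} → Star Joined u v → top F u ≡ top F v
        same→top ε = refl
        same→top ((e , p , inj₁ (refl , refl)) ◅ q) = trans (top-ends≡ F p true) (same→top q)
        same→top ((e , p , inj₂ (refl , refl)) ◅ q) = trans (top-ends≡ F p false) (same→top q)

        joined-sym : ∀ {u v} → Joined u v → Joined v u
        joined-sym (e , p , inj₁ q) = e , p , inj₂ q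
        joined-sym (e , p , inj₂ q) = e , p , inj₁ q

        joined-up : ∀ e → F e ≡ true → Joined (ch e) (pa e)
        joined-up e p with childSide e
        ... | true  = e , p , inj₁ (refl , refl)
        ... | false = e , p , inj₂ (refl , refl)

        to-top : ∀ v → Star Joined v (top F v)
        to-top = tree-ind _ (subst (Star Joined r) (sym (top-r F)) ε) λ e ih → aux e ih (bool-cases (F e))
          where
          aux : ∀ e → Star Joined (pa e) (top F (pa e)) → F e ≡ true ⊎ F e ≡ false → Star Joined (ch e) (top F (ch e))
          aux e ih (inj₁ p) = joined-up e p ◅ subst (Star Joined (pa e)) (sym (top-in F p)) ih
          aux e ih (inj₂ p) = subst (Star Joined (ch e)) (sym (top-out F p)) ε

        top→same : ∀ {u v} → top F u ≡ top F v → Star Joined u v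
        top→same {u} {v} eq = subst (Star Joined u) eq (to-top u) ◅◅ star-reverse joined-sym (to-top v)

        y = proj₁ stp
        agg = proj₁ (proj₂ stp)
        combY = proj₁ (proj₂ (proj₂ (proj₂ stp)))
        combG = proj₁ (proj₂ (proj₂ (proj₂ (proj₂ (proj₂ stp)))))

        Y G : V → Quad
        Y v = decode (y v)
        G v = decodeMaybe (agg v)

        sent : E → Bool → Quad
        sent e s = message ins (est e) s (Y (ep e s)) (Y (ep e (not s)))

        -- In a tree an uncontracted edge never becomes a self-loop: its child end is the top of its
        -- component, and its parent end lies above it.
        kept : ∀ {e} → F e ≡ false → F e ≡ false × ¬ Star Joined (ep e true) (ep e false)
        kept p = p , λ q → top-ends≢ F p true (same→top q)

        map-decode : ∀ {A : Set} (f : A → Quad) (m : A → Msg width) → (∀ a → decode (m a) ≡ f a) →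
                     ∀ L → map (f0 ∘ decode) (map m L) ≡ map (f0 ∘ f) L
        map-decode f m eq L = trans (sym (map-∘ L)) (map-cong (λ a → cong f0 (eq a)) L)

        sameClass : ∀ v {L} → Enumerates L (Star Joined v) → Enumerates L (λ u → top F u ≡ top F v)
        sameClass v (uL , mem) = uL , λ u → mk⇔ (λ p → sym (same→top (Equivalence.to (mem u) p)))
                                                 (λ p → Equivalence.from (mem u) (top→same (sym p)))

        consensus : Sendable ins c → ∀ v → f0 (Y v) ≡ ∑ (λ u → 𝟙 (top F u ≟ top F v) * f0 (value ins (ns u)))
                    × ∃[ u ] (top F u ≡ top F v × rest (Y v) ≡ rest (value ins (ns u)))
        consensus (fit , bound) v with combY v
        ... | L , enum , comb with combines-⊕ comb (subst (_< 2 ^ W) (sym total) (≤-<-trans below bound))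
          where
          m : V → Msg width
          m u = encode (value ins (ns u))
          total : sum (map (f0 ∘ decode) (map m L)) ≡ ∑ (λ u → 𝟙 (top F u ≟ top F v) * f0 (value ins (ns u)))
          total = trans (cong sum (map-decode (value ins ∘ ns) m (λ u → decode-encode (fit u)) L))
                        (sum-enumeration-Fin (λ u → top F u ≟ top F v) (f0 ∘ value ins ∘ ns) (sameClass v enum))
          below : ∑ (λ u → 𝟙 (top F u ≟ top F v) * f0 (value ins (ns u))) ≤ ∑ (λ u → f0 (value ins (ns u)))
          below = ∑-mono (λ u → ≤-trans (*-monoˡ-≤ _ (𝟙≤1 (top F u ≟ top F v))) (≤-reflexive (*-identityˡ _)))
        ... | sm , k , k∈ , rst with ∈-map⁻ _ k∈
        ...   | u , u∈ , refl =
          trans sm (trans (cong sum (map-decode (value ins ∘ ns) _ (λ u → decode-encode (fit u)) L))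
                     (sum-enumeration-Fin (λ u → top F u ≟ top F v) (f0 ∘ value ins ∘ ns) (sameClass v enum)))
          , u , sym (same→top (Equivalence.to (proj₂ enum u) u∈)) , trans rst (cong rest (decode-encode (fit u)))

        msg-of : E × Bool → Msg width
        msg-of (e , s) = encode (sent e s)

        record Gathered (v : V) : Set where
          constructor gathered
          field
            L    : List (E × Bool)
            enum : Enumerates L (λ a → F (proj₁ a) ≡ false × top F (ep (proj₁ a) (proj₂ a)) ≡ top F v)
            res  : AggOf (lift (aggregate ins)) (map msg-of L) (agg v)

        gather : ∀ v → Gathered v
        gather v with combG v
        ... | L , (uL , mem) , res = gathered L
          (uL , λ { (e , s) → mk⇔ (to e s) (from e s) })
          (subst (λ M → AggOf (lift (aggregate ins)) M (agg v)) (map-cong (λ { (e , true) → refl ; (e , false) → refl }) L) res)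
          where
          to : ∀ e s → (e , s) ∈ L → F e ≡ false × top F (ep e s) ≡ top F v
          to e true  p = let ((q , _) , sm) = Equivalence.to (mem (e , true)) p in q , sym (same→top sm)
          to e false p = let ((q , _) , sm) = Equivalence.to (mem (e , false)) p in q , sym (same→top sm)
          from : ∀ e s → F e ≡ false × top F (ep e s) ≡ top F v → (e , s) ∈ L
          from e true  (q , p) = Equivalence.from (mem (e , true)) (kept q , top→same (sym p))
          from e false (q , p) = Equivalence.from (mem (e , false)) (kept q , top→same (sym p))

        module Max (isMax : aggregate ins ≡ _⊔#_) (fit : ∀ e s → Fits (sent e s)) (v : V) where

          result : (0 < f0 (G v) → ∃[ e ] ∃[ s ] (F e ≡ false × top F (ep e s) ≡ top F v × G v ≡ sent e s))
                   × (∀ e s → F e ≡ false → top F (ep e s) ≡ top F v → f0 (sent e s) ≤ f0 (G v))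
          result with gather v
          ... | gathered [] (_ , mem) res =
                (λ 0<G → case (n≮0 (subst (λ g → 0 < f0 (decodeMaybe g)) res 0<G)))
                , λ e s p q → case∈ (Equivalence.from (mem (e , s)) (p , q))
            where
            case : ∀ {A : Set} → ⊥ → A
            case ()
            case∈ : ∀ {A : Set} {a : E × Bool} → a ∈ [] → A
            case∈ ()
          ... | gathered L@(_ ∷ _) (_ , mem) (a , eq , comb)
                with combines-⊔# (subst (λ op → Combines (lift op) (map msg-of L) a) isMax comb)
          ...   | (k , k∈ , dk) , mx = (λ _ → witness (∈-map⁻ msg-of k∈)) , bound
            where
            Gv : G v ≡ decode a
            Gv = cong decodeMaybe eq
            witness : ∃[ x ] (x ∈ L × k ≡ msg-of x) → ∃[ e ] ∃[ s ] (F e ≡ false × top F (ep e s) ≡ top F v × G v ≡ sent e s)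
            witness ((e , s) , x∈ , refl) = let (p , q) = Equivalence.to (mem (e , s)) x∈ in
              e , s , p , q , trans Gv (trans dk (decode-encode (fit e s)))
            bound : ∀ e s → F e ≡ false → top F (ep e s) ≡ top F v → f0 (sent e s) ≤ f0 (G v)
            bound e s p q = ≤-trans (≤-reflexive (sym (cong f0 (decode-encode (fit e s)))))
              (≤-trans (mx (msg-of (e , s)) (∈-map⁺ msg-of (Equivalence.from (mem (e , s)) (p , q))))
                       (≤-reflexive (cong f0 (sym Gv))))

        gather-sum : aggregate ins ≡ _⊕_ → (∀ e s → Fits (sent e s)) → ∀ v →
          let rec = ∑ (λ e → 𝟙 ((F e Bool.≟ false) ×-dec (top F (ep e true) ≟ top F v)) * f0 (sent e true)
                           + 𝟙 ((F e Bool.≟ false) ×-dec (top F (ep e false) ≟ top F v)) * f0 (sent e false)) in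
          rec < 2 ^ W → f0 (G v) ≡ rec
        gather-sum isAdd fit v bound with gather v
        ... | gathered L enum res = aux L enum res
          where
          total : ∀ L → Enumerates L _ → sum (map (f0 ∘ decode) (map msg-of L)) ≡ _
          total L enum = trans (cong sum (map-decode (λ a → sent (proj₁ a) (proj₂ a)) msg-of (λ a → decode-encode (fit (proj₁ a) (proj₂ a))) L))
            (sum-enumeration-Fin×Bool (λ a → (F (proj₁ a) Bool.≟ false) ×-dec (top F (ep (proj₁ a) (proj₂ a)) ≟ top F v))
              (λ a → f0 (sent (proj₁ a) (proj₂ a))) enum)
          aux : ∀ L → Enumerates L (λ a → F (proj₁ a) ≡ false × top F (ep (proj₁ a) (proj₂ a)) ≡ top F v) →
                AggOf (lift (aggregate ins)) (map msg-of L) (agg v) → f0 (G v) ≡ _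
          aux []        enum res = trans (cong (f0 ∘ decodeMaybe) res) (total [] enum)
          aux L@(_ ∷ _) enum (a , eq , comb) = trans (cong (f0 ∘ decodeMaybe) eq)
            (trans (proj₁ (combines-⊕ (subst (λ op → Combines (lift op) (map msg-of L) a) isAdd comb)
                                      (subst (_< 2 ^ W) (sym (total L enum)) bound))) (total L enum))

      stepRound : Round (nth prog t) c c'
      stepRound = record
        { Y = Y
        ; G = G
        ; Y-fits = λ v → decode-fits (y v)
        ; G-fits = λ v → decodeMaybe-fits (agg v)
        ; G-same = λ eq → cong decodeMaybe (proj₁ (proj₂ (proj₂ (proj₂ (proj₂ stp)))) _ _ (top→same eq))
        ; Y-sum  = λ snd v → proj₁ (consensus snd v)
        ; Y-rest = λ snd v → proj₂ (consensus snd v)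
        ; G-from = λ m f v → proj₁ (Max.result m f v)
        ; G-max  = λ m f v → proj₂ (Max.result m f v)
        ; G-sum  = gather-sum
        ; node   = proj₁ (proj₂ (proj₂ (proj₂ (proj₂ (proj₂ (proj₂ stp))))))
        ; edge   = edge
        }
        where
        edges = proj₂ (proj₂ (proj₂ (proj₂ (proj₂ (proj₂ (proj₂ stp))))))
        edge : ∀ e → proj₂ c' e ≡ (if F e then est e else updateEdge ins (est e) (select (Y (ep e true)) (Y (ep e false))))
        edge e with F e in p
        ... | true  = proj₂ (edges e) (λ { (q , _) → case (trans (sym p) q) })
          where
          case : true ≢ false
          case ()
        ... | false = proj₁ (edges e) (kept p)

    data Run : List Instr → Config → Config → Set where
      []  : ∀ {c} → Run [] c c
      _∷_ : ∀ {i is c c' c''} → Round i c c' → Run is c' c'' → Run (i ∷ is) c c''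

    run-++ : ∀ is {js c c''} → Run (is ++ js) c c'' → ∃[ c' ] (Run is c c' × Run js c' c'')
    run-++ []       p       = _ , [] , p
    run-++ (i ∷ is) (q ∷ p) = let (c' , a , b) = run-++ is p in c' , q ∷ a , b

    run-snoc : ∀ {is i c c' c''} → Run is c c' → Round i c' c'' → Run (is ++ i ∷ []) c c''
    run-snoc []      q = q ∷ []
    run-snoc (x ∷ p) q = x ∷ run-snoc p q

    take-suc : ∀ (is : List Instr) t → t < length is → take (suc t) is ≡ take t is ++ nth is t ∷ []
    take-suc (i ∷ is) zero    _         = refl
    take-suc (i ∷ is) (suc t) (s≤s t<) = cong (i ∷_) (take-suc is t t<)

    reach-run : ∀ {t c} → Reach t c → t ≤ length prog → Run (take t prog) initConfig c
    reach-run X.start _ = []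
    reach-run (X.next {t} {c} {c'} p q) t< = subst (λ is → Run is initConfig c') (sym (take-suc prog t t<))
      (run-snoc (reach-run p (<⇒≤ t<)) (stepRound t c c' q))

    run-program : ∀ {c} → Reach (length prog) c → Run prog initConfig c
    run-program p = subst (λ is → Run is initConfig _) (take-all (length prog) prog ≤-refl) (reach-run p ≤-refl)

-- Ranks of edges in a hierarchy of star contractions

module Ranking {n} {es : EdgeList n} {r : Fin n} (R : Rooted es r) (τ : Fin (length es) → ℕ) (μ : Fin (length es) → Bool) where

  open RootedTheory R

  Below : ℕ → E → Bool
  Below t e = ⌊ τ e <? t ⌋

  parity : E → ℕ
  parity e = if ⌊ μ e Bool.≟ childSide e ⌋ then 0 else 1

  rank : E → ℕ
  rank e = 2 * τ e + parity e

  Lower : ℕ → E → Bool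
  Lower l e = ⌊ rank e <? l ⌋

  -- The first condition makes each component a leaf or a centre but not both; the second gives each
  -- leaf a single edge.
  StarAt : ℕ → Set
  StarAt t = ∀ e e' → τ e ≡ t → τ e' ≡ t → top (Below t) (ep e (μ e)) ≢ top (Below t) (ep e' (not (μ e'))) ×
             (top (Below t) (ep e (μ e)) ≡ top (Below t) (ep e' (μ e')) → e ≡ e')

  not-below : ∀ {t e} → t ≤ τ e → Below t e ≡ false
  not-below {t} {e} t≤ = ⌊⌋-no (τ e <? t) (λ lt → <⇒≱ lt t≤)

  private
    double-< : ∀ {a b} x → a < b → 2 * a + x < 2 * b ⊎ 1 < x
    double-< {a} {b} zero a<b = inj₁ (≤-trans (s≤s (≤-reflexive (+-identityʳ _))) (*-monoʳ-< 2 a<b))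
    double-< {a} {b} (suc zero) a<b = inj₁ (≤-trans (≤-reflexive (cong suc (+-comm (2 * a) 1)))
      (≤-trans (≤-reflexive (sym (*-suc 2 a))) (*-monoʳ-≤ 2 a<b)))
    double-< (suc (suc _)) _ = inj₂ (s≤s (s≤s z≤n))

    parity≤1 : ∀ e → parity e ≤ 1
    parity≤1 e with ⌊ μ e Bool.≟ childSide e ⌋
    ... | true  = z≤n
    ... | false = ≤-refl

  rank-< : ∀ {e t} → τ e < t → rank e < 2 * t
  rank-< {e} lt with double-< (parity e) lt
  ... | inj₁ p = p
  ... | inj₂ p = ⊥-elim (<⇒≱ p (parity≤1 e))

  module _ (star : ∀ t → StarAt t) where

    private
      data Ends (t : ℕ) (e : E) : Set where
        child-moves  : μ e ≡ childSide e → top (Below t) (ep e (μ e)) ≡ ch e →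
                       top (Below t) (ep e (not (μ e))) ≡ top (Below t) (pa e) → Ends t e
        parent-moves : μ e ≢ childSide e → top (Below t) (ep e (μ e)) ≡ top (Below t) (pa e) →
                       top (Below t) (ep e (not (μ e))) ≡ ch e → Ends t e

      ends : ∀ {t e} → τ e ≡ t → Ends t e
      ends {t} {e} eq with μ e Bool.≟ childSide e
      ... | yes p = child-moves p (trans (cong (top (Below t) ∘ ep e) p) up-top) (cong (top (Below t) ∘ ep e ∘ not) p)
        where
        up-top : top (Below t) (ch e) ≡ ch e
        up-top = top-out (Below t) (not-below (≤-reflexive (sym eq)))
      ... | no ¬p = parent-moves ¬p (cong (top (Below t) ∘ ep e) (≢⇒≡not ¬p))
          (trans (cong (top (Below t) ∘ ep e) (trans (cong not (≢⇒≡not ¬p)) (not-involutive _))) up-top)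
        where
        up-top : top (Below t) (ch e) ≡ ch e
        up-top = top-out (Below t) (not-below (≤-reflexive (sym eq)))

      not-own-top : ∀ t e → top (Below t) (pa e) ≢ ch e
      not-own-top t e eq = <-irrefl refl (<-≤-trans (depth-pa< e)
        (≤-trans (≤-reflexive (cong depth (sym eq))) (depth-top (Below t) (pa e))))

    -- A star contains no path of three edges, so at most two edges of one step follow each other on
    -- the way to the root.
    no-3-chain : ∀ {t e e' e''} → τ e ≡ t → τ e' ≡ t → τ e'' ≡ t →
                 top (Below t) (pa e) ≡ ch e' → top (Below t) (pa e') ≡ ch e'' → ⊥
    no-3-chain {t} {e} {e'} {e''} q q' q'' p p' with ends q | ends q' | ends q''
    ... | child-moves _ _ C | child-moves _ M' _ | _ = proj₁ (star t e' e q' q) (trans M' (trans (sym p) (sym C)))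
    ... | child-moves _ _ _ | parent-moves _ M' _ | child-moves _ M'' _ =
          not-own-top t e' (trans p' (cong ch (proj₂ (star t e'' e' q'' q') (trans M'' (trans (sym p') (sym M'))))))
    ... | child-moves _ _ _ | parent-moves _ M' _ | parent-moves _ _ C'' =
          proj₁ (star t e' e'' q' q'') (trans M' (trans p' (sym C'')))
    ... | parent-moves _ M _ | child-moves _ M' _ | _ =
          not-own-top t e (trans p (cong ch (proj₂ (star t e' e q' q) (trans M' (trans (sym p) (sym M))))))
    ... | parent-moves _ M _ | parent-moves _ _ C' | _ = proj₁ (star t e e' q q') (trans M (trans p (sym C')))

    private
      <-rank : ∀ {e t} → rank e < 2 * t → τ e < t
      <-rank {e} {t} lt = *-cancelˡ-< 2 _ _ (≤-<-trans (m≤m+n _ _) lt)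

      rank-τ : ∀ {e f} → rank e ≡ rank f → τ e ≡ τ f
      rank-τ {e} {f} eq = ≤-antisym (le e f eq) (le f e (sym eq))
        where
        le : ∀ e f → rank e ≡ rank f → τ e ≤ τ f
        le e f eq = ≮⇒≥ λ lt → <-irrefl (sym eq) (<-≤-trans (rank-< lt) (m≤m+n _ _))

      parity-child : ∀ {e} → μ e ≡ childSide e → parity e ≡ 0
      parity-child {e} p = if-yes (μ e Bool.≟ childSide e) p

      parity-parent : ∀ {e} → μ e ≢ childSide e → parity e ≡ 1
      parity-parent {e} p = if-no (μ e Bool.≟ childSide e) p

      parity-0 : ∀ {e} → parity e ≡ 0 → μ e ≡ childSide e
      parity-0 {e} p with μ e Bool.≟ childSide e
      ... | yes q = q

      rank-parity : ∀ {e f} → rank e ≡ rank f → parity e ≡ parity f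
      rank-parity {e} {f} eq = +-cancelˡ-≡ (2 * τ e) _ _ (trans eq (cong (λ t → 2 * t + parity f) (sym (rank-τ eq))))

      bool-iff : ∀ {a b} {A : Set a} {B : Set b} (d : Dec A) (d' : Dec B) → (A → B) → (B → A) → ⌊ d ⌋ ≡ ⌊ d' ⌋
      bool-iff (yes a) d' f g = sym (⌊⌋-yes d' (f a))
      bool-iff (no ¬a) d' f g = sym (⌊⌋-no d' (¬a ∘ g))

      even-lower : ∀ t e → Lower (2 * t) e ≡ Below t e
      even-lower t e = bool-iff (rank e <? 2 * t) (τ e <? t) <-rank rank-<

      -- Equal ranks mean the same step and the same kind of mover. If both children move, the
      -- component between `e` and `f` is the centre for `e` and a mover along `f`; if both parents
      -- move, it moves along `e` and is the centre for `f`. The star condition forbids both.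
      equal-rank-impossible : ∀ {e f} → rank e ≡ rank f → top (Lower (rank e)) (pa e) ≡ ch f → ⊥
      equal-rank-impossible {e} {f} eq p with ends {τ e} {e} refl | ends {τ e} {f} (sym (rank-τ eq))
      ... | child-moves c _ C | child-moves _ M' _ = proj₁ (star (τ e) f e (sym (rank-τ eq)) refl)
            (trans M' (trans (sym (trans (sym (top-cong lower≡ (pa e))) p)) (sym C)))
        where
        lower≡ : ∀ g → Lower (rank e) g ≡ Below (τ e) g
        lower≡ g = trans (cong (λ l → Lower l g) (trans (cong (2 * τ e +_) (parity-child c)) (+-identityʳ _))) (even-lower (τ e) g)
      ... | child-moves c _ _ | parent-moves ¬c _ _ = ⊥-elim (¬c (parity-0 (trans (sym (rank-parity eq)) (parity-child c))))
      ... | parent-moves ¬c _ _ | child-moves c _ _ = ⊥-elim (¬c (parity-0 (trans (rank-parity eq) (parity-child c))))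
      ... | parent-moves ¬c M _ | parent-moves _ _ C' = climb (top-view (Below (τ e)) (pa e))
        where
        rank≡ : rank e ≡ suc (2 * τ e)
        rank≡ = trans (cong (2 * τ e +_) (parity-parent ¬c)) (+-comm _ 1)
        -- In this case `Lower (rank e)` exceeds `Below (τ e)` by the edges of the same step whose
        -- child moves. Such an edge cannot be the parent edge of the component above `e`: that
        -- component already moves along `e`, and only along one edge. Hence the larger contraction
        -- has the same top there.
        below⊆lower : ∀ {g} → Below (τ e) g ≡ true → Lower (rank e) g ≡ true
        below⊆lower {g} q = ⌊⌋-yes (rank g <? rank e)
          (≤-trans (m<n⇒m<1+n (rank-< (⌊⌋-true (τ g <? τ e) q))) (≤-reflexive (sym rank≡)))
        lower-top : top (Lower (rank e)) (top (Below (τ e)) (pa e)) ≡ ch f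
        lower-top = trans (top-mono below⊆lower (top-idem (Below (τ e)) (pa e))) p
        same-edge : ∀ {g} → top (Below (τ e)) (pa e) ≡ ch g → Below (τ e) g ≡ false → Lower (rank e) g ≡ true → ⊥
        same-edge {g} q out in' = case (ends {τ e} {g} τg)
          where
          τg : τ g ≡ τ e
          τg = ≤-antisym (≮⇒≥ λ lt → <⇒≱ (⌊⌋-true (rank g <? rank e) in')
                 (≤-trans (≤-reflexive rank≡) (≤-trans (s≤s (m≤n+m _ 1)) (≤-trans (≤-reflexive (sym (*-suc 2 (τ e))))
                   (≤-trans (*-monoʳ-≤ 2 lt) (m≤m+n _ _))))))
               (≮⇒≥ (⌊⌋-false (τ g <? τ e) out))
          case : Ends (τ e) g → ⊥
          case (child-moves _ Mg _) = not-own-top (τ e) e (trans q (cong ch (proj₂ (star (τ e) g e τg refl) (trans Mg (trans (sym q) (sym M))))))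
          case (parent-moves ¬cg _ _) = <⇒≱ (⌊⌋-true (rank g <? rank e) in')
            (≤-reflexive (trans rank≡ (sym (trans (cong₂ (λ a b → 2 * a + b) τg (parity-parent ¬cg)) (+-comm _ 1)))))
        climb : IsTop (Below (τ e)) (top (Below (τ e)) (pa e)) → ⊥
        climb (inj₁ q) = ch≢r f (trans (sym lower-top) (trans (cong (top (Lower (rank e))) q) (top-r (Lower (rank e)))))
        climb (inj₂ (g , out , q)) with bool-cases (Lower (rank e) g)
        ... | inj₁ in'  = same-edge q out in'
        ... | inj₂ out' = proj₁ (star (τ e) e f refl (sym (rank-τ eq))) (trans M (trans q (trans ch≡ (sym C'))))
          where
          ch≡ : ch g ≡ ch f
          ch≡ = trans (sym (top-out (Lower (rank e)) out')) (trans (cong (top (Lower (rank e))) (sym q)) lower-top)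

    rank-increases : ∀ {e f} → Lower (rank e) f ≡ false → top (Lower (rank e)) (pa e) ≡ ch f → rank e < rank f
    rank-increases {e} {f} out p with m≤n⇒m<n∨m≡n (≮⇒≥ (⌊⌋-false (rank f <? rank e) out))
    ... | inj₁ lt = lt
    ... | inj₂ eq = ⊥-elim (equal-rank-impossible eq p)

-- Correctness of a merging step

true≢false : true ≢ false
true≢false ()

decide : ∀ a b → ¬ (a ≡ not b) → a ≡ b
decide true  true  _ = refl
decide true  false p = ⊥-elim (p refl)
decide false true  p = ⊥-elim (p refl)
decide false false _ = refl

-- L≤W and n<W ensure that no message overflows its W-bit fields.
record Setting : Set where
  field
    n W T L : ℕ
    prog    : List Instr
    es      : EdgeList n
    r       : Fin n
    R       : Rooted es r
    ids     : Fin n → ℕ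
    ids-inj : Injective _≡_ _≡_ ids
    ids<    : ∀ v → ids v < 2 ^ L
    L≤W     : 2 ^ L ≤ 2 ^ W
    n<W     : n < 2 ^ W

module Analysis (S : Setting) where

  open Setting S public
  open Compile W T prog public
  open OnTree R ids public
  open X using (Config; initConfig) public

  0<2^W : 0 < 2 ^ W
  0<2^W = ≤-<-trans z≤n n<W

  1<2^W : 1 < 2 ^ W
  1<2^W = ≤-<-trans (≤-trans (s≤s z≤n) (depth<n r)) n<W

  ids<W : ∀ v → ids v < 2 ^ W
  ids<W v = <-≤-trans (ids< v) L≤W

  0#-fits : Fits 0#
  0#-fits = fits 0<2^W 0<2^W 0<2^W 0<2^W

  if-fits : ∀ {a} {A : Set a} (d : Dec A) {m} → (A → Fits m) → Fits (if ⌊ d ⌋ then m else 0#)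
  if-fits (yes a) f = f a
  if-fits (no _)  f = 0#-fits

  merged : ℕ → Config → E → Bool
  merged s c e = ⌊ tau (proj₂ c e) <? s ⌋

  csize : (E → Bool) → V → ℕ
  csize F v = ∑ (λ u → 𝟙 (top F u ≟ top F v))

  csize≤n : ∀ F v → csize F v ≤ n
  csize≤n F v = ∑≤n (λ u → 𝟙≤1 (top F u ≟ top F v))

  csize-cong : ∀ F {u v} → top F u ≡ top F v → csize F u ≡ csize F v
  csize-cong F eq = ∑-cong (λ w → 𝟙-cong (top F w ≟ _) (top F w ≟ _) (λ p → trans p eq) (λ p → trans p (sym eq)))

  -- Bundles of fields that the rounds of a stage leave untouched, so that one use of `keepNode` or
  -- `keepEdge` transports all of them.
  nodeId : NodeSt → ℕ × Bool × ℕ × List HLEntry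
  nodeId x = nid x , flag x , ndep x , lst x

  nodeFix : NodeSt → ℕ × ℕ × List HLEntry
  nodeFix x = nid x , ndep x , lst x

  edgeId : EdgeSt → (Bool → ℕ) × Bool × ℕ
  edgeId x = eid x , orid x , sz x

  endIds : E → Bool → ℕ
  endIds e = select (ids (ep e true)) (ids (ep e false))

  endIds-ep : ∀ e s → endIds e s ≡ ids (ep e s)
  endIds-ep e = select-ep ids e

  endIds-inj : ∀ {e e'} → (∀ s → endIds e s ≡ endIds e' s) → e ≡ e'
  endIds-inj {e} {e'} eq = edge-unique λ s → ids-inj (trans (sym (endIds-ep e s)) (trans (eq s) (endIds-ep e' s)))

  moverTop centreTop : ℕ → Config → E → V
  moverTop  s c e = top (merged s c) (ep e (mov (proj₂ c e)))
  centreTop s c e = top (merged s c) (ep e (not (mov (proj₂ c e))))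

  StarAt : ℕ → Config → Set
  StarAt s c = ∀ e e' → tau (proj₂ c e) ≡ s → tau (proj₂ c e') ≡ s →
             moverTop s c e ≢ centreTop s c e' × (moverTop s c e ≡ moverTop s c e' → e ≡ e')

  -- By `cid-top` and `top-cid` the identifier names the component, so an edge can compare its two
  -- sides locally. Identifiers are only copied from one vertex to another, which preserves `cid<`;
  -- unmerged edges keep the level `T`.
  record Clustered (s : ℕ) (c : Config) : Set where
    field
      node-id : ∀ v → nodeId (proj₁ c v) ≡ (ids v , ⌊ v ≟ r ⌋ , 0 , [])
      edge-id : ∀ e → edgeId (proj₂ c e) ≡ (endIds e , false , 0)
      level   : ∀ e → tau (proj₂ c e) < s ⊎ tau (proj₂ c e) ≡ T
      cid<    : ∀ v → cid (proj₁ c v) < 2 ^ L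
      cid-top : ∀ u v → cid (proj₁ c u) ≡ cid (proj₁ c v) → top (merged s c) u ≡ top (merged s c) v
      top-cid : ∀ u v → top (merged s c) u ≡ top (merged s c) v → cid (proj₁ c u) ≡ cid (proj₁ c v)
      stars   : ∀ s' → s' < s → StarAt s' c

  module MergeStep (s θ i : ℕ) (b : Bool) (s<T : s < T) {c c₁ c₂ : Config}
    (p₁ : Round (propose s θ i b) c c₁) (p₂ : Round (commit s) c₁ c₂) (inv : Clustered s c) where

    open Clustered inv
    private
      module P = Round p₁
      module Q = Round p₂
      ns = proj₁ c
      est = proj₂ c
      F : E → Bool
      F = merged s c
      F₂ : E → Bool
      F₂ = merged (suc s) c₂
      cd : V → ℕ
      cd v = cid (ns v)

      est₁≡ : ∀ e → proj₂ c₁ e ≡ est e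
      est₁≡ = P.keepEdge (λ x → x) (λ _ _ → refl)

      F₁≡ : ∀ e → Q.F e ≡ F e
      F₁≡ e = cong (λ x → ⌊ tau x <? s ⌋) (est₁≡ e)

      top₁≡ : ∀ v → top Q.F v ≡ top F v
      top₁≡ = top-cong F₁≡

      eid≡ : ∀ e → eid (est e) ≡ endIds e
      eid≡ e = cong proj₁ (edge-id e)

      send₁ : Sendable (propose s θ i b) c
      send₁ = (λ v → fits 1<2^W (<-≤-trans (cid< v) L≤W) 0<2^W 0<2^W) , ≤-<-trans (∑≤n {n} (λ _ → ≤-refl)) n<W

      Y₁-size : ∀ v → f0 (P.Y v) ≡ csize F v
      Y₁-size v = trans (P.Y-sum send₁ v) (∑-cong {n} (λ u → *-identityʳ _))

      Y₁-cid : ∀ v → f1 (P.Y v) ≡ cd v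
      Y₁-cid v with P.Y-rest send₁ v
      ... | u , eq , rs = trans (cong proj₁ rs) (top-cid u v eq)

      sent₁-fits : ∀ e σ → Fits (P.sent e σ)
      sent₁-fits e σ = if-fits (ready? θ i b (P.Y (ep e σ)) (P.Y (ep e (not σ)))) λ _ →
        fits 1<2^W (eid< true) (eid< false) 0<2^W
        where
        eid< : ∀ σ' → eid (est e) σ' < 2 ^ W
        eid< σ' = subst (_< 2 ^ W) (trans (sym (endIds-ep e σ')) (cong (λ f → f σ') (sym (eid≡ e)))) (ids<W (ep e σ'))

    Candidate : E → Bool → Set
    Candidate e σ = csize F (ep e σ) < θ × bit i (cd (ep e σ)) ≡ b × bit i (cd (ep e (not σ))) ≢ b

    record Move (v : V) : Set where
      field
        via   : E
        σ     : Bool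
        out   : F via ≡ false
        at    : top F (ep via σ) ≡ top F v
        cand  : Candidate via σ
        picks : P.G v ≡ quad 1 (endIds via true) (endIds via false) 0
    open Move

    private
      ready-cand : ∀ e σ → Ready θ i b (P.Y (ep e σ)) (P.Y (ep e (not σ))) → Candidate e σ
      ready-cand e σ (a , p , q) = subst (_< θ) (Y₁-size _) a , trans (cong (bit i) (sym (Y₁-cid _))) p
        , λ p' → q (trans (cong (bit i) (Y₁-cid _)) p')

      cand-ready : ∀ e σ → Candidate e σ → Ready θ i b (P.Y (ep e σ)) (P.Y (ep e (not σ)))
      cand-ready e σ (a , p , q) = subst (_< θ) (sym (Y₁-size _)) a , trans (cong (bit i) (Y₁-cid _)) p
        , λ p' → q (trans (cong (bit i) (sym (Y₁-cid _))) p')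

      mkMove : ∀ v → 0 < f0 (P.G v) → Move v
      mkMove v 0<G with P.G-from refl sent₁-fits v 0<G
      ... | e , σ , out , at , eq with ready? θ i b (P.Y (ep e σ)) (P.Y (ep e (not σ)))
      ...   | yes rd = record { via = e ; σ = σ ; out = out ; at = at ; cand = ready-cand e σ rd
                              ; picks = trans eq (cong (λ f → quad 1 (f true) (f false) 0) (eid≡ e)) }
      ...   | no _   = ⊥-elim (n≮0 (subst (λ g → 0 < f0 g) eq 0<G))

      move? : ∀ v → f0 (P.G v) ≡ 0 ⊎ Move v
      move? v with f0 (P.G v) in eq
      ... | zero  = inj₁ refl
      ... | suc _ = inj₂ (mkMove v (subst (0 <_) (sym eq) z<s))

      moves : ∀ {v} → Move v → 0 < f0 (P.G v)
      moves m = subst (λ g → 0 < f0 g) (sym (picks m)) z<s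

    candidate-moves : ∀ {e σ} → F e ≡ false → Candidate e σ → Move (ep e σ)
    candidate-moves {e} {σ} out cand = mkMove (ep e σ)
      (≤-trans (≤-reflexive (sym one')) (P.G-max refl sent₁-fits (ep e σ) e σ out refl))
      where
      one' : f0 (P.sent e σ) ≡ 1
      one' = cong f0 (if-yes (ready? θ i b (P.Y (ep e σ)) (P.Y (ep e (not σ)))) (cand-ready e σ cand))

    private
      move-bit : ∀ {v} → Move v → bit i (cd v) ≡ b
      move-bit m = trans (cong (bit i) (sym (top-cid _ _ (at m)))) (proj₁ (proj₂ (cand m)))

      move-transport : ∀ {u v} → top F u ≡ top F v → Move u → Move v
      move-transport eq m = record { via = via m ; σ = σ m ; out = out m ; at = trans (at m) eq ; cand = cand m
                                   ; picks = trans (sym (P.G-same eq)) (picks m) }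

      centre-still : ∀ {u v} (m : Move u) → top F v ≡ top F (ep (via m) (not (σ m))) → ¬ Move v
      centre-still m eq m' = proj₂ (proj₂ (cand m)) (trans (cong (bit i) (sym (top-cid _ _ eq))) (move-bit m'))

      -- All vertices of a component receive the same aggregate, and the endpoint identifiers in it
      -- determine the edge. The side follows because the two ends of an unmerged edge lie in
      -- different components.
      move-unique : ∀ {u v} → top F u ≡ top F v → (m : Move u) (m' : Move v) → via m ≡ via m' × σ m ≡ σ m'
      move-unique {u} {v} eq m m' = via≡ , σ≡
        where
        same : quad 1 (endIds (via m) true) (endIds (via m) false) 0 ≡ quad 1 (endIds (via m') true) (endIds (via m') false) 0
        same = trans (sym (picks m)) (trans (P.G-same eq) (picks m'))
        via≡ : via m ≡ via m'
        via≡ = endIds-inj λ { true → cong f1 same ; false → cong f2 same }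
        σ≡ : σ m ≡ σ m'
        σ≡ = decide (σ m) (σ m') λ ne → top-ends≢ F (out m) (σ m) (trans (trans (at m) eq)
                (trans (sym (at m')) (cong₂ (λ e σ → top F (ep e σ)) (sym via≡)
                  (trans (sym (not-involutive (σ m'))) (cong not (sym ne))))))

      centre-of : ∀ v → f0 (P.G v) ≡ 0 ⊎ Move v → V
      centre-of v (inj₁ _) = v
      centre-of v (inj₂ m) = ep (via m) (not (σ m))

    -- A vertex whose old component absorbs that of `v`. The components after the step are the
    -- fibres of `top F ∘ centre`, and the new identifier of `v` is the old one of `centre v`;
    -- matching the two shows that identifiers still name components.
    centre : V → V
    centre v = centre-of v (move? v)

    private
      centre-move : ∀ {v} (m : Move v) → centre v ≡ ep (via m) (not (σ m))
      centre-move {v} m with move? v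
      ... | inj₁ z  = ⊥-elim (n≮0 (subst (0 <_) z (moves m)))
      ... | inj₂ m' = let (p , q) = move-unique {v} {v} refl m' m in cong₂ (λ e σ → ep e (not σ)) p q

      centre-stay : ∀ {v} → ¬ Move v → centre v ≡ v
      centre-stay {v} ¬m with move? v
      ... | inj₁ _ = refl
      ... | inj₂ m = ⊥-elim (¬m m)

      centre-class : ∀ u v → top F u ≡ top F v → top F (centre u) ≡ top F (centre v)
      centre-class u v eq with move? u
      ... | inj₂ m = cong (top F) (sym (centre-move (move-transport eq m)))
      ... | inj₁ z = trans eq (cong (top F) (sym (centre-stay
              (λ m → n≮0 (subst (0 <_) z (moves (move-transport (sym eq) m)))))))

      reg₁ : ∀ v → reg (proj₁ c₁ v) ≡ P.G v
      reg₁ v = cong reg (P.node v)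

      cid₁ : ∀ v → cid (proj₁ c₁ v) ≡ cd v
      cid₁ = P.keepNode cid (λ _ _ _ → refl)

      val : V → Quad
      val v = quad (f0 (P.G v)) (f1 (P.G v)) (f2 (P.G v)) (cd v)

      value≡ : ∀ v → value (commit s) (proj₁ c₁ v) ≡ val v
      value≡ v rewrite reg₁ v | cid₁ v = refl

      G≤1 : ∀ v → f0 (P.G v) ≤ 1
      G≤1 v with move? v
      ... | inj₁ z = ≤-trans (≤-reflexive z) z≤n
      ... | inj₂ m = ≤-reflexive (cong f0 (picks m))

      send₂ : Sendable (commit s) c₁
      send₂ = (λ v → subst Fits (sym (value≡ v))
                 (fits (b0 (P.G-fits v)) (b1 (P.G-fits v)) (b2 (P.G-fits v)) (<-≤-trans (cid< v) L≤W)))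
            , ≤-<-trans (∑≤n {n} (λ v → ≤-trans (≤-reflexive (cong f0 (value≡ v))) (G≤1 v))) n<W

      Y₂-rest : ∀ v → rest (Q.Y v) ≡ rest (val v)
      Y₂-rest v with Q.Y-rest send₂ v
      ... | u , eq , rs = trans rs (trans (cong rest (value≡ u))
              (cong₂ (λ g k → f1 g , f2 g , k) (P.G-same same) (top-cid u v same)))
        where
        same : top F u ≡ top F v
        same = trans (sym (top₁≡ u)) (trans eq (top₁≡ v))

      Y₂-pos : ∀ v → 0 < f0 (P.G v) → 0 < f0 (Q.Y v)
      Y₂-pos v 0<G = ≤-trans 0<G (≤-trans (≤-reflexive (sym
          (trans (cong₂ _*_ (𝟙-yes (top Q.F v ≟ top Q.F v) refl) (cong f0 (value≡ v))) (*-identityˡ _))))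
        (≤-trans (term≤∑ (λ u → 𝟙 (top Q.F u ≟ top Q.F v) * f0 (value (commit s) (proj₁ c₁ u))) v)
                 (≤-reflexive (sym (Q.Y-sum send₂ v)))))

      pos-Y₂ : ∀ v → 0 < f0 (Q.Y v) → 0 < f0 (P.G v)
      pos-Y₂ v 0<Y with ∑-pos (λ u → 𝟙 (top Q.F u ≟ top Q.F v) * f0 (value (commit s) (proj₁ c₁ u)))
                              (subst (0 <_) (Q.Y-sum send₂ v) 0<Y)
      ... | u , p with top Q.F u ≟ top Q.F v
      ...   | yes eq = subst (0 <_) (trans (*-identityˡ _) (trans (cong f0 (value≡ u))
                (cong f0 (P.G-same (trans (sym (top₁≡ u)) (trans eq (top₁≡ v))))))) p
      ...   | no _   = ⊥-elim (n≮0 p)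

      eid₁≡ : ∀ e → eid (proj₂ c₁ e) ≡ endIds e
      eid₁≡ e = trans (cong eid (est₁≡ e)) (eid≡ e)

    Picked : E → Bool → Set
    Picked e σ' = Σ (Move (ep e σ')) λ m → via m ≡ e × σ m ≡ σ'

    private
      chosen-picked : ∀ e σ' → Chosen (proj₂ c₁ e) (Q.Y (ep e σ')) → Picked e σ'
      chosen-picked e σ' (0<Y , p , q) = m , via≡ , σ≡
        where
        m : Move (ep e σ')
        m = mkMove _ (pos-Y₂ _ 0<Y)
        via≡ : via m ≡ e
        via≡ = endIds-inj λ
          { true  → trans (cong f1 (sym (picks m))) (trans (sym (cong proj₁ (Y₂-rest _))) (trans p (cong (λ f → f true) (eid₁≡ e))))
          ; false → trans (cong f2 (sym (picks m))) (trans (sym (cong (proj₁ ∘ proj₂) (Y₂-rest _))) (trans q (cong (λ f → f false) (eid₁≡ e)))) }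
        σ≡ : σ m ≡ σ'
        σ≡ = decide (σ m) σ' λ ne → top-ends≢ F {e} (subst (λ e → F e ≡ false) via≡ (out m)) σ'
                (sym (trans (cong₂ (λ e σ → top F (ep e σ)) (sym via≡) (sym ne)) (at m)))

      picked-chosen : ∀ e σ' → Picked e σ' → Chosen (proj₂ c₁ e) (Q.Y (ep e σ'))
      picked-chosen e σ' (m , refl , _) = Y₂-pos _ (moves m)
        , trans (cong proj₁ (Y₂-rest _)) (trans (cong f1 (picks m)) (cong (λ f → f true) (sym (eid₁≡ e))))
        , trans (cong (proj₁ ∘ proj₂) (Y₂-rest _)) (trans (cong f2 (picks m)) (cong (λ f → f false) (sym (eid₁≡ e))))

      sent₂-fits : ∀ e σ → Fits (Q.sent e σ)
      sent₂-fits e σ = if-fits (chosen? (proj₂ c₁ e) (Q.Y (ep e σ))) λ _ →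
        fits 1<2^W (b3 (Q.Y-fits (ep e (not σ)))) 0<2^W 0<2^W

      toPicked : ∀ {v} (m : Move v) → Picked (via m) (σ m)
      toPicked m = move-transport (sym (at m)) m , refl , refl

      G₂-pos : ∀ {v} → Move v → 0 < f0 (Q.G v)
      G₂-pos {v} m = ≤-trans (≤-reflexive (sym one')) (Q.G-max refl sent₂-fits v (via m) (σ m)
          (trans (F₁≡ _) (out m)) (trans (top₁≡ _) (trans (at m) (sym (top₁≡ v)))))
        where
        one' : f0 (Q.sent (via m) (σ m)) ≡ 1
        one' = cong f0 (if-yes (chosen? (proj₂ c₁ (via m)) (Q.Y (ep (via m) (σ m)))) (picked-chosen _ _ (toPicked m)))

      G₂-value : ∀ v → 0 < f0 (Q.G v) → Σ (Move v) λ m → f1 (Q.G v) ≡ cd (ep (via m) (not (σ m)))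
      G₂-value v 0<G = let (e , σ' , _ , at' , eq) = Q.G-from refl sent₂-fits v 0<G in
          aux e σ' at' eq (chosen? (proj₂ c₁ e) (Q.Y (ep e σ')))
        where
        moved : ∀ {e σ'} → Picked e σ' → top Q.F (ep e σ') ≡ top Q.F v → f1 (Q.G v) ≡ f3 (Q.Y (ep e (not σ'))) →
                Σ (Move v) λ m → f1 (Q.G v) ≡ cd (ep (via m) (not (σ m)))
        moved (m , refl , refl) at' eq = move-transport (trans (sym (top₁≡ _)) (trans at' (top₁≡ v))) m
          , trans eq (cong (proj₂ ∘ proj₂) (Y₂-rest (ep (via m) (not (σ m)))))
        aux : ∀ e σ' → top Q.F (ep e σ') ≡ top Q.F v → Q.G v ≡ Q.sent e σ' → Dec (Chosen (proj₂ c₁ e) (Q.Y (ep e σ'))) →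
              Σ (Move v) λ m → f1 (Q.G v) ≡ cd (ep (via m) (not (σ m)))
        aux e σ' at' eq (no ¬h) = ⊥-elim (n≮0 (subst (0 <_) (trans (cong f0 eq)
          (cong f0 (if-no (chosen? (proj₂ c₁ e) (Q.Y (ep e σ'))) ¬h))) 0<G))
        aux e σ' at' eq (yes h) = moved (chosen-picked e σ' h) at' (trans (cong f1 eq)
          (cong f1 (if-yes (chosen? (proj₂ c₁ e) (Q.Y (ep e σ'))) h)))

      cid₂ : ∀ v → cid (proj₁ c₂ v) ≡ cd (centre v)
      cid₂ v = trans (cong cid (Q.node v)) (aux (0 <? f0 (Q.G v)))
        where
        aux : (d : Dec (0 < f0 (Q.G v))) → (if ⌊ d ⌋ then f1 (Q.G v) else cid (proj₁ c₁ v)) ≡ cd (centre v)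
        aux (yes p) = let (m , eq) = G₂-value v p in trans eq (cong cd (sym (centre-move m)))
        aux (no ¬p) = trans (cid₁ v) (cong cd (sym (centre-stay (λ m → ¬p (G₂-pos m)))))

      joined? : ∀ e → Dec (Chosen (proj₂ c₁ e) (Q.Y (ep e true)) ⊎ Chosen (proj₂ c₁ e) (Q.Y (ep e false)))
      joined? e = chosen? (proj₂ c₁ e) (Q.Y (ep e true)) ⊎-dec chosen? (proj₂ c₁ e) (Q.Y (ep e false))

      est₂-in : ∀ {e} → F e ≡ true → proj₂ c₂ e ≡ est e
      est₂-in {e} p = trans (Q.edge-in (trans (F₁≡ e) p)) (est₁≡ e)

      tau₂-out : ∀ {e} → F e ≡ false → tau (proj₂ c₂ e) ≡ (if ⌊ joined? e ⌋ then s else tau (est e))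
      tau₂-out {e} p = trans (cong tau (Q.edge-out (trans (F₁≡ e) p)))
        (cong (λ x → if ⌊ joined? e ⌋ then s else tau x) (est₁≡ e))

      mov₂-out : ∀ {e} → F e ≡ false → mov (proj₂ c₂ e) ≡ ⌊ chosen? (proj₂ c₁ e) (Q.Y (ep e true)) ⌋
      mov₂-out {e} p = cong mov (Q.edge-out (trans (F₁≡ e) p))

      out-T : ∀ {e} → F e ≡ false → tau (est e) ≡ T
      out-T {e} p with level e
      ... | inj₁ lt = ⊥-elim (⌊⌋-false (tau (est e) <? s) p lt)
      ... | inj₂ eq = eq

      tau₂-view : ∀ e → F e ≡ true × tau (proj₂ c₂ e) < s
                      ⊎ F e ≡ false × tau (proj₂ c₂ e) ≡ s × Picked e (mov (proj₂ c₂ e))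
                      ⊎ F e ≡ false × tau (proj₂ c₂ e) ≡ T
      tau₂-view e with bool-cases (F e)
      ... | inj₁ p = inj₁ (p , subst (_< s) (cong tau (sym (est₂-in p))) (⌊⌋-true (tau (est e) <? s) p))
      ... | inj₂ p = inj₂ (aux (joined? e) (chosen? (proj₂ c₁ e) (Q.Y (ep e true))) (tau₂-out p) (mov₂-out p))
        where
        aux : (d : Dec (Chosen (proj₂ c₁ e) (Q.Y (ep e true)) ⊎ Chosen (proj₂ c₁ e) (Q.Y (ep e false))))
              (d' : Dec (Chosen (proj₂ c₁ e) (Q.Y (ep e true)))) →
              tau (proj₂ c₂ e) ≡ (if ⌊ d ⌋ then s else tau (est e)) → mov (proj₂ c₂ e) ≡ ⌊ d' ⌋ →
              F e ≡ false × tau (proj₂ c₂ e) ≡ s × Picked e (mov (proj₂ c₂ e)) ⊎ F e ≡ false × tau (proj₂ c₂ e) ≡ T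
        aux (no _)         _       eq _   = inj₂ (p , trans eq (out-T p))
        aux (yes _)        (yes h) eq eq' = inj₁ (p , eq , subst (Picked e) (sym eq') (chosen-picked e true h))
        aux (yes (inj₁ h)) (no ¬h) eq eq' = ⊥-elim (¬h h)
        aux (yes (inj₂ h)) (no ¬h) eq eq' = inj₁ (p , eq , subst (Picked e) (sym eq') (chosen-picked e false h))

      picked-tau : ∀ {e σ'} → F e ≡ false → Picked e σ' → tau (proj₂ c₂ e) ≡ s
      picked-tau {e} {σ'} p pk = trans (tau₂-out p) (if-yes (joined? e) (which σ' pk))
        where
        which : ∀ σ' → Picked e σ' → Chosen (proj₂ c₁ e) (Q.Y (ep e true)) ⊎ Chosen (proj₂ c₁ e) (Q.Y (ep e false))
        which true  pk = inj₁ (picked-chosen e true pk)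
        which false pk = inj₂ (picked-chosen e false pk)

      F₂-view : ∀ {e} → F₂ e ≡ true → F e ≡ true ⊎ F e ≡ false × Picked e (mov (proj₂ c₂ e))
      F₂-view {e} p with tau₂-view e
      ... | inj₁ (q , _) = inj₁ q
      ... | inj₂ (inj₁ (q , _ , pk)) = inj₂ (q , pk)
      ... | inj₂ (inj₂ (_ , eq)) = ⊥-elim (<⇒≱ s<T (≤-pred (subst (_< suc s) eq (⌊⌋-true (tau (proj₂ c₂ e) <? suc s) p))))

    F⊆F₂ : ∀ {e} → F e ≡ true → F₂ e ≡ true
    F⊆F₂ {e} p = ⌊⌋-yes (tau (proj₂ c₂ e) <? suc s)
      (m<n⇒m<1+n (subst (_< s) (cong tau (sym (est₂-in p))) (⌊⌋-true (tau (est e) <? s) p)))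

    private
      top₂-picked : ∀ {v} (m : Move v) → top F₂ v ≡ top F₂ (ep (via m) (not (σ m)))
      top₂-picked m = trans (sym (top-mono F⊆F₂ (at m))) (top-ends≡ F₂
        (⌊⌋-yes (tau (proj₂ c₂ (via m)) <? suc s) (≤-reflexive (cong suc (picked-tau (out m) (toPicked m))))) (σ m))

      top₂-centre : ∀ v → top F₂ v ≡ top F₂ (centre v)
      top₂-centre v with move? v
      ... | inj₁ _ = refl
      ... | inj₂ m = top₂-picked m

      -- The class of `centre` is constant along each edge contracted after the step. On a newly
      -- picked edge, the centre of the mover is the other end, and this end does not move, so it is
      -- its own centre.
      centre-top₂ : ∀ u v → top F₂ u ≡ top F₂ v → top F (centre u) ≡ top F (centre v)
      centre-top₂ u v eq = trans (const u) (trans (cong (top F ∘ centre) eq) (sym (const v)))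
        where
        across : ∀ {e σ'} → Picked e σ' → top F (centre (ep e σ')) ≡ top F (centre (ep e (not σ')))
        across (m , refl , refl) = cong (top F) (trans (centre-move m) (sym (centre-stay (centre-still m refl))))
        flip : ∀ e σ' → top F (centre (ep e σ')) ≡ top F (centre (ep e (not σ'))) → top F (centre (ch e)) ≡ top F (centre (pa e))
        flip e σ' eq with edge-cases e σ'
        ... | inj₁ (p , q) = trans (cong (top F ∘ centre) (sym p)) (trans eq (cong (top F ∘ centre) q))
        ... | inj₂ (p , q) = trans (cong (top F ∘ centre) (sym q)) (trans (sym eq) (cong (top F ∘ centre) p))
        along : ∀ {e} → F₂ e ≡ true → top F (centre (ch e)) ≡ top F (centre (pa e))
        along {e} p with F₂-view {e} p
        ... | inj₁ q        = centre-class _ _ (top-in F q)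
        ... | inj₂ (q , pk) = flip e (mov (proj₂ c₂ e)) (across pk)
        const : ∀ v → top F (centre v) ≡ top F (centre (top F₂ v))
        const = top-const {F₂} (top F ∘ centre) along

      -- The level of an edge can only drop from `T` to `s`, and both are at least `s'`. Hence the
      -- components of earlier steps, and with them the earlier star conditions, persist.
      below≡ : ∀ s' → s' ≤ s → ∀ e → merged s' c₂ e ≡ merged s' c e
      below≡ s' s'≤s e with tau₂-view e
      ... | inj₁ (p , _) = cong (λ x → ⌊ tau x <? s' ⌋) (est₂-in p)
      ... | inj₂ (inj₁ (p , eq , _)) = trans (⌊⌋-no (tau (proj₂ c₂ e) <? s') (λ lt → <⇒≱ lt (≤-trans s'≤s (≤-reflexive (sym eq)))))
              (sym (⌊⌋-no (tau (est e) <? s') (λ lt → <⇒≱ (≤-<-trans s'≤s s<T) (≤-trans (≤-reflexive (sym (out-T p))) (<⇒≤ lt)))))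
      ... | inj₂ (inj₂ (p , eq)) = cong (λ t → ⌊ t <? s' ⌋) (trans eq (sym (out-T p)))

      old-star : ∀ s' → s' < s → StarAt s' c₂
      old-star s' s'<s e e' t t' with tau₂-view e | tau₂-view e'
      ... | inj₂ (inj₁ (_ , eq , _)) | _ = ⊥-elim (<-irrefl (trans (sym t) eq) s'<s)
      ... | inj₂ (inj₂ (_ , eq)) | _ = ⊥-elim (<-irrefl (trans (sym t) eq) (<-trans s'<s s<T))
      ... | _ | inj₂ (inj₁ (_ , eq , _)) = ⊥-elim (<-irrefl (trans (sym t') eq) s'<s)
      ... | _ | inj₂ (inj₂ (_ , eq)) = ⊥-elim (<-irrefl (trans (sym t') eq) (<-trans s'<s s<T))
      ... | inj₁ (p , _) | inj₁ (p' , _) =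
        let (a , b) = stars s' s'<s e e' (trans (cong tau (sym (est₂-in p))) t) (trans (cong tau (sym (est₂-in p'))) t') in
        (λ eq → a (trans (sym (m≡ p)) (trans eq (c≡ p')))) , λ eq → b (trans (sym (m≡ p)) (trans eq (m≡ p')))
        where
        m≡ : ∀ {e} → F e ≡ true → moverTop s' c₂ e ≡ moverTop s' c e
        m≡ {e} p = trans (top-cong (below≡ s' (<⇒≤ s'<s)) _) (cong (λ x → top (merged s' c) (ep e (mov x))) (est₂-in p))
        c≡ : ∀ {e} → F e ≡ true → centreTop s' c₂ e ≡ centreTop s' c e
        c≡ {e} p = trans (top-cong (below≡ s' (<⇒≤ s'<s)) _) (cong (λ x → top (merged s' c) (ep e (not (mov x)))) (est₂-in p))

      new-picked : ∀ e → tau (proj₂ c₂ e) ≡ s → Picked e (mov (proj₂ c₂ e))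
      new-picked e t with tau₂-view e
      ... | inj₁ (_ , lt) = ⊥-elim (<-irrefl t lt)
      ... | inj₂ (inj₁ (_ , _ , pk)) = pk
      ... | inj₂ (inj₂ (_ , eq)) = ⊥-elim (<-irrefl (trans (sym t) eq) s<T)

      new-star : StarAt s c₂
      new-star e e' t t' = (λ eq → clash (new-picked e t) (new-picked e' t') (trans (sym (top≡ _)) (trans eq (top≡ _))))
                         , (λ eq → unique (new-picked e t) (new-picked e' t') (trans (sym (top≡ _)) (trans eq (top≡ _))))
        where
        top≡ : ∀ v → top (merged s c₂) v ≡ top F v
        top≡ = top-cong (below≡ s ≤-refl)
        clash : ∀ {σ₁ σ₂} → Picked e σ₁ → Picked e' σ₂ → top F (ep e σ₁) ≢ top F (ep e' (not σ₂))
        clash (m , _ , _) (m' , refl , refl) eq = centre-still m' eq m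
        unique : ∀ {σ₁ σ₂} → Picked e σ₁ → Picked e' σ₂ → top F (ep e σ₁) ≡ top F (ep e' σ₂) → e ≡ e'
        unique (m , refl , _) (m' , refl , _) eq = proj₁ (move-unique eq m m')

    clustered : Clustered (suc s) c₂
    clustered = record
      { node-id = λ v → trans (Q.keepNode nodeId (λ _ _ _ → refl) v) (trans (P.keepNode nodeId (λ _ _ _ → refl) v) (node-id v))
      ; edge-id = λ e → trans (Q.keepEdge edgeId (λ _ _ → refl) e) (trans (P.keepEdge edgeId (λ _ _ → refl) e) (edge-id e))
      ; level   = level₂
      ; cid<    = λ v → subst (_< 2 ^ L) (sym (cid₂ v)) (cid< (centre v))
      ; cid-top = λ u v eq → trans (top₂-centre u) (trans (top-mono F⊆F₂ (cid-top _ _ (trans (sym (cid₂ u)) (trans eq (cid₂ v))))) (sym (top₂-centre v)))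
      ; top-cid = λ u v eq → trans (cid₂ u) (trans (top-cid _ _ (centre-top₂ u v eq)) (sym (cid₂ v)))
      ; stars   = stars₂
      }
      where
      level₂ : ∀ e → tau (proj₂ c₂ e) < suc s ⊎ tau (proj₂ c₂ e) ≡ T
      level₂ e with tau₂-view e
      ... | inj₁ (_ , lt) = inj₁ (m<n⇒m<1+n lt)
      ... | inj₂ (inj₁ (_ , eq , _)) = inj₁ (≤-reflexive (cong suc eq))
      ... | inj₂ (inj₂ (_ , eq)) = inj₂ eq
      stars₂ : ∀ s' → s' < suc s → StarAt s' c₂
      stars₂ s' s'<1+s with m≤n⇒m<n∨m≡n (≤-pred s'<1+s)
      ... | inj₁ lt   = old-star s' lt
      ... | inj₂ refl = new-star

    csize-mono : ∀ v → csize F v ≤ csize F₂ v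
    csize-mono v = ∑-mono (λ u → aux u (top F u ≟ top F v) (top F₂ u ≟ top F₂ v))
      where
      aux : ∀ u (d : Dec (top F u ≡ top F v)) (d' : Dec (top F₂ u ≡ top F₂ v)) → 𝟙 d ≤ 𝟙 d'
      aux u (no _)   _ = z≤n
      aux u (yes eq) d' = ≤-reflexive (sym (𝟙-yes d' (top-mono F⊆F₂ eq)))

    move-grows : ∀ {v} (m : Move v) → csize F (ep (via m) (σ m)) + csize F (ep (via m) (not (σ m))) ≤ csize F₂ v
    move-grows {v} m = ≤-trans (≤-reflexive (sym (∑-distrib-+ (λ u → 𝟙 (top F u ≟ top F a)) _)))
      (∑-mono (λ u → aux u (top F u ≟ top F a) (top F u ≟ top F z) (top F₂ u ≟ top F₂ v)))
      where
      a z : V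
      a = ep (via m) (σ m)
      z = ep (via m) (not (σ m))
      aux : ∀ u (d : Dec (top F u ≡ top F a)) (d' : Dec (top F u ≡ top F z)) (d'' : Dec (top F₂ u ≡ top F₂ v)) → 𝟙 d + 𝟙 d' ≤ 𝟙 d''
      aux u (yes p) (yes q) _   = ⊥-elim (top-ends≢ F (out m) (σ m) (trans (sym p) q))
      aux u (yes p) (no _)  d'' = ≤-reflexive (sym (𝟙-yes d'' (top-mono F⊆F₂ (trans p (at m)))))
      aux u (no _)  (yes q) d'' = ≤-reflexive (sym (𝟙-yes d'' (trans (top-mono F⊆F₂ q) (sym (top₂-picked m)))))
      aux u (no _)  (no _)  _   = z≤n

    cid-changes : ∀ v → cid (proj₁ c₂ v) ≡ cid (proj₁ c v) ⊎ Move v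
    cid-changes v with move? v | cid₂ v
    ... | inj₂ m | _  = inj₂ m
    ... | inj₁ _ | eq = inj₁ eq

  module ReadDepth {c c'} (p : Round readDepth c c') (edge-ori : ∀ e → ori (proj₂ c e) ≡ childSide e)
                   (bounded : ∀ v → ndep (proj₁ c v) < 2 ^ W) where

    private
      module P = Round p

      send : Sendable readDepth c
      send = (λ v → fits 0<2^W (bounded v) 0<2^W 0<2^W) , ≤-<-trans (≤-reflexive (∑-zero {n} (λ _ → refl))) 0<2^W

      Y-dep : ∀ v → f1 (P.Y v) ≡ ndep (proj₁ c v)
      Y-dep v with P.Y-rest send v
      ... | u , at , rs = trans (cong proj₁ rs) (cong (ndep ∘ proj₁ c)
              (trans (sym (top-none (λ _ → refl) u)) (trans at (top-none (λ _ → refl) v))))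

    pd≡ : ∀ e → pd (proj₂ c' e) ≡ ndep (proj₁ c (pa e))
    pd≡ e = trans (cong pd (P.edge-out refl)) (trans (cong f1 (select-ep P.Y e (not (ori (proj₂ c e)))))
      (trans (Y-dep _) (cong (λ s → ndep (proj₁ c (ep e (not s)))) (edge-ori e))))

-- Growth of the components over sweeps and phases

mergeProg : (s θ : ℕ) → List (ℕ × Bool) → List Instr
mergeProg s θ []             = []
mergeProg s θ ((i , b) ∷ xs) = propose s θ i b ∷ commit s ∷ mergeProg (suc s) θ xs

-- Both values of each bit are tried, so that either end of an unmerged edge gets its turn as the
-- mover.
sweep : ℕ → List (ℕ × Bool)
sweep zero    = []
sweep (suc i) = (i , false) ∷ (i , true) ∷ sweep i

sweep-∈ : ∀ {L i} b → i < L → (i , b) ∈ sweep L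
sweep-∈ {suc L} {i} b i<1+L with m≤n⇒m<n∨m≡n (≤-pred i<1+L)
sweep-∈ b     _ | inj₁ i<L  = there (there (sweep-∈ b i<L))
sweep-∈ true  _ | inj₂ refl = there (here refl)
sweep-∈ false _ | inj₂ refl = here refl

-- Here `m` is a lower bound on the sizes of the components with unmerged edges; each phase doubles
-- it.
phases : (L s m q : ℕ) → List Instr
phases L s m zero    = []
phases L s m (suc q) = mergeProg s (2 * m) (sweep L) ++ (mergeProg (s + k) (2 * m) (sweep L) ++ phases L (s + k + k) (2 * m) q)
  where
  k : ℕ
  k = length (sweep L)

module Clustering (S : Setting) where

  open Analysis S

  compSize : ℕ → Config → V → ℕ
  compSize s c = csize (merged s c)

  cidAt : Config → V → ℕ
  cidAt c v = cid (proj₁ c v)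

  -- Only components with an unmerged edge are bounded: a component without one is the whole tree,
  -- and no bound above `n` could hold for it.
  AtLeast : ℕ → ℕ → Config → Set
  AtLeast m s c = ∀ e σ → merged s c e ≡ false → m ≤ compSize s c (ep e σ)

  -- D holds of the pairs of component identifiers that the steps between c and c' have told apart.
  record Grows (θ : ℕ) (D : ℕ → ℕ → Set) (s : ℕ) (c : Config) (s' : ℕ) (c' : Config) : Set where
    field
      sub    : ∀ {e} → merged s c e ≡ true → merged s' c' e ≡ true
      larger : ∀ v → compSize s c v ≤ compSize s' c' v
      cid-or : ∀ v → cidAt c' v ≡ cidAt c v ⊎ (compSize s c v < θ × θ ≤ compSize s' c' v)
      done   : ∀ e σ → merged s' c' e ≡ false → D (cidAt c (ep e σ)) (cidAt c (ep e (not σ))) →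
               θ ≤ compSize s' c' (ep e σ) ⊎ (compSize s c (ep e (not σ)) < θ × θ ≤ compSize s' c' (ep e (not σ)))
  open Grows

  unmerged-before : ∀ {θ D s c s' c'} → Grows θ D s c s' c' → ∀ {e} → merged s' c' e ≡ false → merged s c e ≡ false
  unmerged-before {s = s} {c} g {e} p with bool-cases (merged s c e)
  ... | inj₁ q = ⊥-elim (true≢false (trans (sym (sub g q)) p))
  ... | inj₂ q = q

  grows-atLeast : ∀ {θ D s c s' c' m} → Grows θ D s c s' c' → AtLeast m s c → AtLeast m s' c'
  grows-atLeast g big e σ p = ≤-trans (big e σ (unmerged-before g p)) (larger g _)

  grows-refl : ∀ {θ s c} → Grows θ (λ _ _ → ⊥) s c s c
  grows-refl = record { sub = λ p → p ; larger = λ _ → ≤-refl ; cid-or = λ _ → inj₁ refl ; done = λ _ _ _ () }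

  -- A pair told apart only by the later steps may have changed identifiers meanwhile. By `cid-or`
  -- an identifier changes only if its component has grown from below `θ` to at least `θ`, and this
  -- already gives one of the alternatives of `done`; otherwise the later steps see the original
  -- identifiers.
  grows-trans : ∀ {θ D D' s c s' c' s'' c''} → Grows θ D s c s' c' → Grows θ D' s' c' s'' c'' →
                Grows θ (λ x y → D x y ⊎ D' x y) s c s'' c''
  grows-trans {θ} {D} {D'} {s} {c} {s'} {c'} {s''} {c''} g h = record
    { sub    = λ p → sub h (sub g p)
    ; larger = λ v → ≤-trans (larger g v) (larger h v)
    ; cid-or = cids
    ; done   = fin
    }
    where
    cids : ∀ v → cidAt c'' v ≡ cidAt c v ⊎ (compSize s c v < θ × θ ≤ compSize s'' c'' v)
    cids v with cid-or g v | cid-or h v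
    ... | inj₂ (a , b) | _            = inj₂ (a , ≤-trans b (larger h v))
    ... | inj₁ _       | inj₂ (a , b) = inj₂ (≤-<-trans (larger g v) a , b)
    ... | inj₁ p       | inj₁ q       = inj₁ (trans q p)
    fin : ∀ e σ → merged s'' c'' e ≡ false → D (cidAt c (ep e σ)) (cidAt c (ep e (not σ))) ⊎ D' (cidAt c (ep e σ)) (cidAt c (ep e (not σ))) →
          θ ≤ compSize s'' c'' (ep e σ) ⊎ (compSize s c (ep e (not σ)) < θ × θ ≤ compSize s'' c'' (ep e (not σ)))
    fin e σ p (inj₁ d) with done g e σ (unmerged-before h p) d
    ... | inj₁ a       = inj₁ (≤-trans a (larger h _))
    ... | inj₂ (a , b) = inj₂ (a , ≤-trans b (larger h _))
    fin e σ p (inj₂ d) with cid-or g (ep e σ) | cid-or g (ep e (not σ))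
    ... | inj₂ (_ , a) | _            = inj₁ (≤-trans a (larger h _))
    ... | inj₁ _       | inj₂ (a , b) = inj₂ (a , ≤-trans b (larger h _))
    ... | inj₁ eq      | inj₁ eq' with done h e σ p (subst₂ D' (sym eq) (sym eq') d)
    ...   | inj₁ a       = inj₁ a
    ...   | inj₂ (a , b) = inj₂ (≤-<-trans (larger g _) a , b)

  Separates : ℕ × Bool → ℕ → ℕ → Set
  Separates (i , b) x y = bit i x ≡ b × bit i y ≢ b

  SomeSeparates : List (ℕ × Bool) → ℕ → ℕ → Set
  SomeSeparates xs x y = ∃[ a ] (a ∈ xs × Separates a x y)

  -- A mover and its target are joined by an unmerged edge, so each has at least `m` vertices; after
  -- the move they share a component of at least `2 * m`. This is where the threshold comes from.
  step-grows : ∀ m {s i b c c₁ c₂} → s < T → Round (propose s (2 * m) i b) c c₁ → Round (commit s) c₁ c₂ →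
               Clustered s c → AtLeast m s c →
               Clustered (suc s) c₂ × Grows (2 * m) (Separates (i , b)) s c (suc s) c₂
  step-grows m {s} {i} {b} {c} {c₁} {c₂} s<T p q inv big = M.clustered , grown
    where
    module M = MergeStep s (2 * m) i b s<T p q inv
    moved : ∀ {v} → M.Move v → 2 * m ≤ compSize (suc s) c₂ v
    moved mv = ≤-trans (+-mono-≤ (big _ (M.Move.σ mv) (M.Move.out mv)) (≤-trans (≤-reflexive (+-identityʳ m)) (big _ (not (M.Move.σ mv)) (M.Move.out mv)))) (M.move-grows mv)
    grown : Grows (2 * m) (Separates (i , b)) s c (suc s) c₂
    grown = record { sub = M.F⊆F₂ ; larger = M.csize-mono ; cid-or = cids ; done = fin }
      where
      cids : ∀ v → cidAt c₂ v ≡ cidAt c v ⊎ (compSize s c v < 2 * m × 2 * m ≤ compSize (suc s) c₂ v)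
      cids v with M.cid-changes v
      ... | inj₁ eq = inj₁ eq
      ... | inj₂ mv = inj₂ (subst (_< 2 * m) (csize-cong (merged s c) (M.Move.at mv)) (proj₁ (M.Move.cand mv)) , moved mv)
      fin : ∀ e σ → merged (suc s) c₂ e ≡ false → Separates (i , b) (cidAt c (ep e σ)) (cidAt c (ep e (not σ))) →
            2 * m ≤ compSize (suc s) c₂ (ep e σ) ⊎ (compSize s c (ep e (not σ)) < 2 * m × 2 * m ≤ compSize (suc s) c₂ (ep e (not σ)))
      fin e σ out (x , y) with compSize s c (ep e σ) <? 2 * m
      ... | no ¬lt = inj₁ (≤-trans (≮⇒≥ ¬lt) (M.csize-mono _))
      ... | yes lt = inj₁ (moved (M.candidate-moves {e} {σ} before (lt , x , y)))
        where
        before : merged s c e ≡ false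
        before with bool-cases (merged s c e)
        ... | inj₁ q = ⊥-elim (true≢false (trans (sym (M.F⊆F₂ q)) out))
        ... | inj₂ q = q

  weaken : ∀ {θ D D' s c s' c'} → (∀ {x y} → D' x y → D x y) → Grows θ D s c s' c' → Grows θ D' s c s' c'
  weaken f g = record { sub = sub g ; larger = larger g ; cid-or = cid-or g ; done = λ e σ p d → done g e σ p (f d) }

  merge-grows : ∀ m xs {s c c'} → s + length xs ≤ T → Run (mergeProg s (2 * m) xs) c c' → Clustered s c → AtLeast m s c →
                Clustered (s + length xs) c' × Grows (2 * m) (SomeSeparates xs) s c (s + length xs) c'
  merge-grows m [] {s} _ [] inv big rewrite +-identityʳ s = inv , weaken (λ { (_ , () , _) }) grows-refl
  merge-grows m ((i , b) ∷ xs) {s} ≤T (p ∷ q ∷ run) inv big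
    with step-grows m (≤-trans (s≤s (m≤m+n s _)) (≤-trans (≤-reflexive (sym (+-suc s _))) ≤T)) p q inv big
  ... | inv₁ , g with merge-grows m xs (≤-trans (≤-reflexive (sym (+-suc s _))) ≤T) run inv₁ (grows-atLeast g big)
  ...   | inv₂ , h rewrite +-suc s (length xs) = inv₂ , weaken split (grows-trans g h)
    where
    split : ∀ {x y} → SomeSeparates ((i , b) ∷ xs) x y → Separates (i , b) x y ⊎ SomeSeparates xs x y
    split (_ , here refl , d) = inj₁ d
    split (a , there a∈ , d)  = inj₂ (a , a∈ , d)

  sweep-separates : ∀ {s c} → Clustered s c → ∀ e σ → merged s c e ≡ false →
                    SomeSeparates (sweep L) (cidAt c (ep e σ)) (cidAt c (ep e (not σ)))
  sweep-separates {s} {c} inv e σ p with separating-bit L (cid< (ep e σ)) (cid< (ep e (not σ)))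
                                           (λ eq → top-ends≢ (merged s c) p σ (cid-top _ _ eq))
    where open Clustered inv
  ... | i , i<L , ne = (i , bit i (cidAt c (ep e σ))) , sweep-∈ _ i<L , refl , ne ∘ sym

  sweep-grows : ∀ m {s c s' c'} → Clustered s c → Grows (2 * m) (SomeSeparates (sweep L)) s c s' c' →
    ∀ e σ → merged s' c' e ≡ false → 2 * m ≤ compSize s' c' (ep e σ) ⊎
      (compSize s c (ep e (not σ)) < 2 * m × 2 * m ≤ compSize s' c' (ep e (not σ)))
  sweep-grows m inv g e σ p = done g e σ p (sweep-separates inv e σ (unmerged-before g p))

  -- After the first sweep, one end of every unmerged edge is large; it no longer moves, so the other end
  -- finds it during the second sweep.
  two-sweeps : ∀ m {s c s' c' s'' c''} → Clustered s c → Clustered s' c' →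
    Grows (2 * m) (SomeSeparates (sweep L)) s c s' c' → Grows (2 * m) (SomeSeparates (sweep L)) s' c' s'' c'' →
    AtLeast (2 * m) s'' c''
  two-sweeps m inv inv' g h e σ p with sweep-grows m inv' h e σ p
  ... | inj₁ a = a
  ... | inj₂ (small , _) with sweep-grows m inv g e σ (unmerged-before h p)
  ...   | inj₁ a       = ≤-trans a (larger h _)
  ...   | inj₂ (_ , b) = ⊥-elim (<⇒≱ small b)

  phases-cluster : ∀ q m {s c c'} → s + q * (length (sweep L) + length (sweep L)) ≡ T → Run (phases L s m q) c c' →
    Clustered s c → AtLeast m s c → Clustered T c' × AtLeast (2 ^ q * m) T c'
  phases-cluster zero m {s} {c} ≡T [] inv big rewrite +-identityʳ s | ≡T = inv , subst (λ k → AtLeast k T c) (sym (+-identityʳ m)) big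
  phases-cluster (suc q) m {s} {c} {c'} ≡T run inv big
    with run-++ (mergeProg s (2 * m) (sweep L)) run
  ... | c₁ , run₁ , run' with run-++ (mergeProg (s + length (sweep L)) (2 * m) (sweep L)) run'
  ...   | c₂ , run₂ , run₃ = subst (λ k → Clustered T c' × AtLeast k T c') pow (phases-cluster q (2 * m) eqT run₃ (proj₁ second) (two-sweeps m inv (proj₁ first) (proj₂ first) (proj₂ second)))
    where
    k = length (sweep L)
    eqT : s + k + k + q * (k + k) ≡ T
    eqT = trans (trans (cong (_+ q * (k + k)) (+-assoc s k k)) (+-assoc s (k + k) _)) ≡T
    pow : 2 ^ q * (2 * m) ≡ 2 ^ suc q * m
    pow = trans (sym (*-assoc (2 ^ q) 2 m)) (cong (_* m) (*-comm (2 ^ q) 2))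
    first : Clustered (s + k) c₁ × Grows (2 * m) (SomeSeparates (sweep L)) s c (s + k) c₁
    first = merge-grows m (sweep L) (≤-trans (≤-trans (m≤m+n _ k) (m≤m+n _ _)) (≤-reflexive eqT)) run₁ inv big
    second : Clustered (s + k + k) c₂ × Grows (2 * m) (SomeSeparates (sweep L)) (s + k) c₁ (s + k + k) c₂
    second = merge-grows m (sweep L) (≤-trans (m≤m+n _ _) (≤-reflexive eqT)) run₂ (proj₁ first) (grows-atLeast (proj₂ first) big)

  cluster-all : ∀ {c} → T ≡ lg n * (length (sweep L) + length (sweep L)) → Run (phases L 0 1 (lg n)) initConfig c →
                Clustered T c × (∀ e → tau (proj₂ c e) < T)
  cluster-all {c} T≡ run = proj₁ result , complete
    where
    none : ∀ e → merged 0 initConfig e ≡ false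
    none e = ⌊⌋-no (T <? 0) n≮0
    init : Clustered 0 initConfig
    init = record
      { node-id = λ _ → refl
      ; edge-id = λ _ → refl
      ; level   = λ _ → inj₂ refl
      ; cid<    = ids<
      ; cid-top = λ u v eq → cong (top (merged 0 initConfig)) (ids-inj eq)
      ; top-cid = λ u v eq → cong ids (trans (sym (top-none none u)) (trans eq (top-none none v)))
      ; stars   = λ _ ()
      }
    init-large : AtLeast 1 0 initConfig
    init-large e σ _ = ≤-trans (≤-reflexive (sym (𝟙-yes (top (merged 0 initConfig) (ep e σ) ≟ top (merged 0 initConfig) (ep e σ)) refl)))
      (term≤∑ (λ u → 𝟙 (top (merged 0 initConfig) u ≟ top (merged 0 initConfig) (ep e σ))) (ep e σ))
    result : Clustered T c × AtLeast (2 ^ lg n * 1) T c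
    result = phases-cluster (lg n) 1 (sym T≡) run init init-large
    complete : ∀ e → tau (proj₂ c e) < T
    complete e with bool-cases (merged T c e)
    ... | inj₁ p = ⌊⌋-true (tau (proj₂ c e) <? T) p
    -- An edge still unmerged after `lg n` doublings would lie at a component of at least `2 ^ lg n`
    -- vertices, more than there are.
    ... | inj₂ p = ⊥-elim (<⇒≱ (n<2^lg n) (≤-trans (≤-reflexive (sym (*-identityʳ _)))
                     (≤-trans (proj₂ result e true p) (csize≤n (merged T c) (ep e true)))))

-- Orientation of the edges

∨-true : ∀ {a b} → a ∨ b ≡ true → a ≡ true ⊎ b ≡ true
∨-true {true}  _ = inj₁ refl
∨-true {false} p = inj₂ p

∨-trueˡ : ∀ {a b} → a ≡ true → a ∨ b ≡ true
∨-trueˡ refl = refl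

orientProg : ℕ → List Instr
orientProg zero    = []
orientProg (suc t) = orient t ∷ orient t ∷ orientProg t

module Orientation (S : Setting)
                   (τ : Fin (length (Setting.es S)) → ℕ) (μ : Fin (length (Setting.es S)) → Bool)
                   (star : ∀ t → Ranking.StarAt (Setting.R S) τ μ t) where

  open Analysis S
  open Ranking R τ μ

  edgeFix : EdgeSt → (Bool → ℕ) × ℕ × Bool × ℕ
  edgeFix x = eid x , tau x , mov x , sz x

  -- Two bounds are kept because between the two rounds of a level its edges are only partly
  -- oriented: `lo` then includes the level and `hi` does not yet.
  record Oriented (lo hi : ℕ) (c : Config) : Set where
    field
      node-id : ∀ v → nodeFix (proj₁ c v) ≡ (ids v , 0 , [])
      edge-id : ∀ e → edgeFix (proj₂ c e) ≡ (endIds e , τ e , μ e , 0)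
      flag-r  : flag (proj₁ c r) ≡ true
      flag-ch : ∀ e → orid (proj₂ c e) ≡ true → flag (proj₁ c (ch e)) ≡ true
      flagged : ∀ v → flag (proj₁ c v) ≡ true → v ≡ r ⊎ ∃[ e ] (v ≡ ch e × orid (proj₂ c e) ≡ true)
      correct : ∀ e → orid (proj₂ c e) ≡ true → ori (proj₂ c e) ≡ childSide e × lo ≤ τ e
      done    : ∀ e → hi ≤ τ e → orid (proj₂ c e) ≡ true

  module OrientRound {t hi c c'} (p : Round (orient t) c c') (inv : Oriented t hi c) where

    open Oriented inv
    private
      module P = Round p
      ns = proj₁ c
      est = proj₂ c

      tau≡ : ∀ e → tau (est e) ≡ τ e
      tau≡ e = cong (proj₁ ∘ proj₂) (edge-id e)

      eid≡ : ∀ e s → eid (est e) s ≡ ids (ep e s)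
      eid≡ e s = trans (cong (λ f → proj₁ f s) (edge-id e)) (endIds-ep e s)

      cls : V → V
      cls = top P.F

      F≡ : ∀ e → P.F e ≡ Below t e
      F≡ e = cong (λ x → ⌊ x <? t ⌋) (tau≡ e)

      out : ∀ {e} → t ≤ τ e → P.F e ≡ false
      out {e} t≤ = trans (F≡ e) (not-below t≤)

      send : Sendable (orient t) c
      send = (λ v → fits (𝔹< (flag (ns v))) 0<2^W 0<2^W 0<2^W) , ≤-<-trans (∑≤n {n} (λ v → 𝔹≤1 (flag (ns v)))) n<W
        where
        𝔹≤1 : ∀ b → 𝔹 b ≤ 1
        𝔹≤1 true  = ≤-refl
        𝔹≤1 false = z≤n
        𝔹< : ∀ b → 𝔹 b < 2 ^ W
        𝔹< b = ≤-<-trans (𝔹≤1 b) 1<2^W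

      -- The parent edge of a flagged vertex has been oriented, hence has step at least `t`, and is
      -- not contracted in this round. So the consensus reveals whether the top is flagged.
      flagged-top : ∀ {v} → flag (ns v) ≡ true → cls v ≡ v
      flagged-top {v} f with flagged v f
      ... | inj₁ refl = top-r P.F
      ... | inj₂ (e , refl , o) = top-out P.F (out (proj₂ (correct e o)))

      Y-flag : ∀ v → 0 < f0 (P.Y v) → flag (ns (cls v)) ≡ true
      Y-flag v 0<Y with ∑-pos (λ u → 𝟙 (cls u ≟ cls v) * 𝔹 (flag (ns u))) (subst (0 <_) (P.Y-sum send v) 0<Y)
      ... | u , q with cls u ≟ cls v | flag (ns u) in f
      ...   | no _   | _     = ⊥-elim (n≮0 q)
      ...   | yes _  | false = ⊥-elim (n≮0 q)
      ...   | yes eq | true  = trans (cong (flag ∘ ns) (trans (sym eq) (flagged-top f))) f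

      flag-Y : ∀ v → flag (ns (cls v)) ≡ true → 0 < f0 (P.Y v)
      flag-Y v f = ≤-trans (≤-reflexive (sym (cong₂ _*_ (𝟙-yes (cls (cls v) ≟ cls v) (top-idem P.F v)) (cong 𝔹 f))))
        (≤-trans (term≤∑ (λ u → 𝟙 (cls u ≟ cls v) * 𝔹 (flag (ns u))) (cls v)) (≤-reflexive (sym (P.Y-sum send v))))

      Advances : E → Set
      Advances e = orid (est e) ≡ false × τ e ≡ t × flag (ns (cls (pa e))) ≡ true

      -- The top of a component with a flagged vertex is flagged, but the child end of an unoriented edge is not.
      reached-side : ∀ e s → Reached t (est e) (P.Y (ep e (not s))) → s ≡ childSide e × Advances e
      reached-side e s (o , q , 0<Y) = side , o , τe , subst (λ s → flag (ns (cls (ep e (not s)))) ≡ true) side (Y-flag _ 0<Y)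
        where
        τe : τ e ≡ t
        τe = trans (sym (tau≡ e)) q
        unflagged : flag (ns (cls (ch e))) ≢ true
        unflagged f with flagged (ch e) (trans (cong (flag ∘ ns) (sym (top-out P.F {e} (out (≤-reflexive (sym τe)))))) f)
        ... | inj₁ eq = ch≢r e eq
        ... | inj₂ (e' , eq , o') = true≢false (trans (sym o') (trans (cong (orid ∘ est) (sym (ch-inj eq))) o))
        side : s ≡ childSide e
        side = decide s (childSide e) λ ne → unflagged
          (subst (λ s → flag (ns (cls (ep e s))) ≡ true) (trans (cong not ne) (not-involutive _)) (Y-flag _ 0<Y))

      side-reached : ∀ e → Advances e → Reached t (est e) (P.Y (pa e))
      side-reached e (o , q , f) = o , trans (tau≡ e) q , flag-Y _ f

      sent-fits : ∀ e s → Fits (P.sent e s)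
      sent-fits e s = if-fits (reached? t (est e) (P.Y (ep e (not s)))) λ _ →
        fits 1<2^W (subst (_< 2 ^ W) (sym (eid≡ e s)) (ids<W _)) 0<2^W 0<2^W

      G-child : ∀ v → 0 < f0 (P.G v) → ∃[ e ] (Advances e × cls v ≡ ch e × f1 (P.G v) ≡ ids (ch e))
      G-child v 0<G = let (e , s , o , at , eq) = P.G-from refl sent-fits v 0<G in
          aux e s at eq (reached? t (est e) (P.Y (ep e (not s))))
        where
        aux : ∀ e s → cls (ep e s) ≡ cls v → P.G v ≡ P.sent e s → Dec (Reached t (est e) (P.Y (ep e (not s)))) →
              ∃[ e ] (Advances e × cls v ≡ ch e × f1 (P.G v) ≡ ids (ch e))
        aux e s at eq (no ¬h) = ⊥-elim (n≮0 (subst (0 <_) (trans (cong f0 eq)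
          (cong f0 (if-no (reached? t (est e) (P.Y (ep e (not s)))) ¬h))) 0<G))
        aux e s at eq (yes h) = let (side , adv@(_ , τe , _)) = reached-side e s h in
          e , adv , trans (sym at) (trans (cong (cls ∘ ep e) side) (top-out P.F (out (≤-reflexive (sym τe)))))
          , trans (cong f1 eq) (trans (cong f1 (if-yes (reached? t (est e) (P.Y (ep e (not s)))) h))
              (trans (eid≡ e s) (cong (ids ∘ ep e) side)))

      G-advance : ∀ e → Advances e → 0 < f0 (P.G (ch e))
      G-advance e adv@(_ , τe , _) = ≤-trans (≤-reflexive (sym (cong f0 (if-yes (reached? t (est e) (P.Y (pa e))) (side-reached e adv)))))
        (P.G-max refl sent-fits (ch e) e (childSide e) (out (≤-reflexive (sym τe))) refl)

      orid-out : ∀ {e} → P.F e ≡ false → orid (proj₂ c' e) ≡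
        orid (est e) ∨ ⌊ reached? t (est e) (P.Y (ep e true)) ⊎-dec reached? t (est e) (P.Y (ep e false)) ⌋
      orid-out q = cong orid (P.edge-out q)

      ori-out : ∀ {e} → P.F e ≡ false → ori (proj₂ c' e) ≡ (if ⌊ reached? t (est e) (P.Y (ep e true)) ⌋ then false
        else if ⌊ reached? t (est e) (P.Y (ep e false)) ⌋ then true else ori (est e))
      ori-out q = cong ori (P.edge-out q)

      orid-old : ∀ {e} → orid (est e) ≡ true → orid (proj₂ c' e) ≡ true
      orid-old {e} o = trans (orid-out (out (proj₂ (correct e o)))) (∨-trueˡ o)

      ori-old : ∀ {e} → orid (est e) ≡ true → ori (proj₂ c' e) ≡ childSide e
      ori-old {e} o = trans (ori-out (out (proj₂ (correct e o)))) (trans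
          (cong₂ (λ a b → if a then false else if b then true else ori (est e))
            (⌊⌋-no (reached? t (est e) (P.Y (ep e true))) (¬reached (P.Y (ep e true)))) (⌊⌋-no (reached? t (est e) (P.Y (ep e false))) (¬reached (P.Y (ep e false)))))
          (proj₁ (correct e o)))
        where
        ¬reached : ∀ y → ¬ Reached t (est e) y
        ¬reached _ (o' , _) = true≢false (trans (sym o) o')

      orid-new : ∀ {e} → Advances e → orid (proj₂ c' e) ≡ true
      orid-new {e} adv@(_ , τe , _) = trans (orid-out (out (≤-reflexive (sym τe))))
          (trans (cong (orid (est e) ∨_) (⌊⌋-yes (reached? t (est e) (P.Y (ep e true)) ⊎-dec reached? t (est e) (P.Y (ep e false)))
            (which (childSide e) refl (side-reached e adv)))) (∨-zeroʳ _))
        where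
        which : ∀ s → s ≡ childSide e → Reached t (est e) (P.Y (ep e (not s))) →
                Reached t (est e) (P.Y (ep e true)) ⊎ Reached t (est e) (P.Y (ep e false))
        which true  _ h = inj₂ h
        which false _ h = inj₁ h

      ori-new : ∀ {e} → Advances e → ori (proj₂ c' e) ≡ childSide e
      ori-new {e} adv@(_ , τe , _) = trans (ori-out (out (≤-reflexive (sym τe))))
          (aux (reached? t (est e) (P.Y (ep e true))) (reached? t (est e) (P.Y (ep e false))))
        where
        aux : (d : Dec (Reached t (est e) (P.Y (ep e true)))) (d' : Dec (Reached t (est e) (P.Y (ep e false)))) →
              (if ⌊ d ⌋ then false else if ⌊ d' ⌋ then true else ori (est e)) ≡ childSide e
        aux (yes h) _       = proj₁ (reached-side e false h)
        aux (no _)  (yes h) = proj₁ (reached-side e true h)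
        aux (no ¬h) (no ¬h') = ⊥-elim (neither (childSide e) refl (side-reached e adv))
          where
          neither : ∀ s → s ≡ childSide e → Reached t (est e) (P.Y (ep e (not s))) → ⊥
          neither true  _ h = ¬h' h
          neither false _ h = ¬h h

      orid-view : ∀ e → orid (proj₂ c' e) ≡ true → orid (est e) ≡ true ⊎ Advances e
      orid-view e o with bool-cases (P.F e)
      ... | inj₁ q = inj₁ (trans (cong orid (sym (P.edge-in q))) o)
      ... | inj₂ q with ∨-true (trans (sym (orid-out q)) o)
      ...   | inj₁ o' = inj₁ o'
      ...   | inj₂ h with ⌊⌋-true (reached? t (est e) (P.Y (ep e true)) ⊎-dec reached? t (est e) (P.Y (ep e false))) h
      ...     | inj₁ h' = inj₂ (proj₂ (reached-side e false h'))
      ...     | inj₂ h' = inj₂ (proj₂ (reached-side e true h'))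

      flag≡ : ∀ v → flag (proj₁ c' v) ≡ flag (ns v) ∨ ⌊ (0 <? f0 (P.G v)) ×-dec (f1 (P.G v) ℕ.≟ nid (ns v)) ⌋
      flag≡ v = cong flag (P.node v)

      nid≡ : ∀ v → nid (ns v) ≡ ids v
      nid≡ v = cong proj₁ (node-id v)

    flag-mono : ∀ v → flag (ns v) ≡ true → flag (proj₁ c' v) ≡ true
    flag-mono v f = trans (flag≡ v) (∨-trueˡ f)

    orid-mono : ∀ e → orid (est e) ≡ true → orid (proj₂ c' e) ≡ true
    orid-mono e = orid-old

    advance : ∀ e → τ e ≡ t → flag (ns (top (Below t) (pa e))) ≡ true → orid (proj₂ c' e) ≡ true
    advance e τe f with bool-cases (orid (est e))
    ... | inj₁ o = orid-old o
    ... | inj₂ o = orid-new (o , τe , trans (cong (flag ∘ ns) (top-cong F≡ (pa e))) f)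

    oriented : Oriented t hi c'
    oriented = record
      { node-id = λ v → trans (P.keepNode nodeFix (λ _ _ _ → refl) v) (node-id v)
      ; edge-id = λ e → trans (P.keepEdge edgeFix (λ _ _ → refl) e) (edge-id e)
      ; flag-r  = flag-mono r flag-r
      ; flag-ch = flag-ch'
      ; flagged = flagged'
      ; correct = correct'
      ; done    = λ e h → orid-old (done e h)
      }
      where
      -- The message reaches the whole component below `e`; the identifier in it singles out the
      -- vertex to flag. Any edge whose message wins has the same top as its child end, so that
      -- vertex is `ch e`.
      flag-ch' : ∀ e → orid (proj₂ c' e) ≡ true → flag (proj₁ c' (ch e)) ≡ true
      flag-ch' e o with orid-view e o
      ... | inj₁ o' = flag-mono (ch e) (flag-ch e o')
      ... | inj₂ adv@(_ , τe , _) = trans (flag≡ (ch e)) (trans (cong (flag (ns (ch e)) ∨_)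
              (⌊⌋-yes ((0 <? f0 (P.G (ch e))) ×-dec (f1 (P.G (ch e)) ℕ.≟ nid (ns (ch e)))) (G-advance e adv , own))) (∨-zeroʳ _))
        where
        own : f1 (P.G (ch e)) ≡ nid (ns (ch e))
        own with G-child (ch e) (G-advance e adv)
        ... | e' , _ , eq , f = trans f (trans (cong ids (trans (sym eq) (top-out P.F (out (≤-reflexive (sym τe)))))) (sym (nid≡ (ch e))))
      flagged' : ∀ v → flag (proj₁ c' v) ≡ true → v ≡ r ⊎ ∃[ e ] (v ≡ ch e × orid (proj₂ c' e) ≡ true)
      flagged' v f with ∨-true (trans (sym (flag≡ v)) f)
      ... | inj₂ h with ⌊⌋-true ((0 <? f0 (P.G v)) ×-dec (f1 (P.G v) ℕ.≟ nid (ns v))) h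
      ...   | 0<G , own with G-child v 0<G
      ...     | e , adv , _ , f1≡ = inj₂ (e , ids-inj (trans (sym (nid≡ v)) (trans (sym own) f1≡)) , orid-new adv)
      flagged' v f | inj₁ f' with flagged v f'
      ...   | inj₁ eq = inj₁ eq
      ...   | inj₂ (e , eq , o) = inj₂ (e , eq , orid-old o)
      correct' : ∀ e → orid (proj₂ c' e) ≡ true → ori (proj₂ c' e) ≡ childSide e × t ≤ τ e
      correct' e o with orid-view e o
      ... | inj₁ o' = ori-old o' , proj₂ (correct e o')
      ... | inj₂ adv@(_ , τe , _) = ori-new adv , ≤-reflexive (sym τe)

  -- The component above an edge of step `t` has a flagged top already, or its own parent edge has
  -- step `t` too. In the latter case `no-3-chain` makes the next component up flagged at the start,
  -- so the first round orients that parent edge and the second round the edge itself.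
  orient-level : ∀ {t c c₁ c₂} → Round (orient t) c c₁ → Round (orient t) c₁ c₂ → Oriented (suc t) (suc t) c → Oriented t t c₂
  orient-level {t} {c} {c₁} {c₂} p q inv = record
      { node-id = node-id ; edge-id = edge-id ; flag-r = flag-r ; flag-ch = flag-ch ; flagged = flagged ; correct = correct
      ; done = λ e t≤ → all-done e (m≤n⇒m<n∨m≡n t≤) }
    where
    inv₀ : Oriented t (suc t) c
    inv₀ = record { node-id = I.node-id ; edge-id = I.edge-id ; flag-r = I.flag-r ; flag-ch = I.flag-ch ; flagged = I.flagged
                  ; correct = λ e o → let (a , b) = I.correct e o in a , <⇒≤ b ; done = I.done }
      where module I = Oriented inv
    module A = OrientRound p inv₀
    module B = OrientRound q A.oriented
    open Oriented B.oriented
    late : ∀ {e} → t ≤ τ e → ¬ (t < τ e) → τ e ≡ t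
    late t≤ ¬t< with m≤n⇒m<n∨m≡n t≤
    ... | inj₁ lt = ⊥-elim (¬t< lt)
    ... | inj₂ eq = sym eq
    flag₀ : ∀ {e} → t < τ e → flag (proj₁ c (ch e)) ≡ true
    flag₀ {e} lt = Oriented.flag-ch inv₀ e (Oriented.done inv₀ e lt)
    t≤ : ∀ {e} → Below t e ≡ false → t ≤ τ e
    t≤ {e} out = ≮⇒≥ (⌊⌋-false (τ e <? t) out)
    flag₁ : ∀ e → τ e ≡ t → flag (proj₁ c₁ (top (Below t) (pa e))) ≡ true
    flag₁ e τe with top-view (Below t) (pa e)
    ... | inj₁ eq = A.flag-mono _ (trans (cong (flag ∘ proj₁ c) eq) (Oriented.flag-r inv₀))
    ... | inj₂ (e' , out , eq) with t <? τ e'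
    ...   | yes lt = A.flag-mono _ (trans (cong (flag ∘ proj₁ c) eq) (flag₀ lt))
    ...   | no ¬lt = trans (cong (flag ∘ proj₁ c₁) eq) (Oriented.flag-ch A.oriented e' (A.advance e' τe' parent-flag))
      where
      τe' : τ e' ≡ t
      τe' = late (t≤ out) ¬lt
      parent-flag : flag (proj₁ c (top (Below t) (pa e'))) ≡ true
      parent-flag with top-view (Below t) (pa e')
      ... | inj₁ eq' = trans (cong (flag ∘ proj₁ c) eq') (Oriented.flag-r inv₀)
      ... | inj₂ (e'' , out' , eq') with t <? τ e''
      ...   | yes lt' = trans (cong (flag ∘ proj₁ c) eq') (flag₀ lt')
      ...   | no ¬lt' = ⊥-elim (no-3-chain star τe τe' (late (t≤ out') ¬lt') eq eq')
    all-done : ∀ e → t < τ e ⊎ t ≡ τ e → orid (proj₂ c₂ e) ≡ true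
    all-done e (inj₁ lt) = B.orid-mono e (A.orid-mono e (Oriented.done inv₀ e lt))
    all-done e (inj₂ eq) = B.advance e (sym eq) (flag₁ e (sym eq))

  orient-all : ∀ t {c c'} → Run (orientProg t) c c' → Oriented t t c → Oriented 0 0 c'
  orient-all zero    []            inv = inv
  orient-all (suc t) (p ∷ q ∷ run) inv = orient-all t run (orient-level p q inv)

  oriented-start : ∀ {t c} → (∀ v → nodeId (proj₁ c v) ≡ (ids v , ⌊ v ≟ r ⌋ , 0 , [])) → (∀ e → edgeId (proj₂ c e) ≡ (endIds e , false , 0)) →
    (∀ e → tau (proj₂ c e) ≡ τ e) → (∀ e → mov (proj₂ c e) ≡ μ e) → (∀ e → τ e < t) → Oriented t t c
  oriented-start {t} {c} nodes edges taus movs τ<t = record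
    { node-id = λ v → cong (λ { (a , _ , k , l) → a , k , l }) (nodes v)
    ; edge-id = λ e → trans (cong (λ { (a , _ , k) → a , tau (proj₂ c e) , mov (proj₂ c e) , k }) (edges e))
                            (cong₂ (λ a m → endIds e , a , m , 0) (taus e) (movs e))
    ; flag-r  = trans (flag≡ r) (⌊⌋-yes (r ≟ r) refl)
    ; flag-ch = λ e o → ⊥-elim (true≢false (trans (sym o) (cong (proj₁ ∘ proj₂) (edges e))))
    ; flagged = λ v f → inj₁ (⌊⌋-true (v ≟ r) (trans (sym (flag≡ v)) f))
    ; correct = λ e o → ⊥-elim (true≢false (trans (sym o) (cong (proj₁ ∘ proj₂) (edges e))))
    ; done    = λ e h → ⊥-elim (<⇒≱ (τ<t e) h)
    }
    where
    flag≡ : ∀ v → flag (proj₁ c v) ≡ ⌊ v ≟ r ⌋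
    flag≡ v = cong (proj₁ ∘ proj₂) (nodes v)

-- Subtree sizes and depths

sizeProg : ℕ → List Instr
sizeProg zero    = []
sizeProg (suc l) = subtotal l ∷ storeSize l ∷ sizeProg l

depthProg : ℕ → List Instr
depthProg zero    = []
depthProg (suc l) = depthProg l ++ readDepth ∷ addDepth l ∷ []

module Measuring (S : Setting)
                 (ρ : Fin (length (Setting.es S)) → ℕ)
                 (ρ-increases : ∀ {e f} → ⌊ ρ f <? ρ e ⌋ ≡ false →
                    RootedTheory.top (Setting.R S) (λ g → ⌊ ρ g <? ρ e ⌋) (Rooted.pa (Setting.R S) e) ≡ Rooted.ch (Setting.R S) f → ρ e < ρ f) where

  open Analysis S

  Low : ℕ → E → Bool
  Low l e = ⌊ ρ e <? l ⌋

  edgeBase : EdgeSt → (Bool → ℕ) × Bool × ℕ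
  edgeBase x = eid x , ori x , lev x

  hanging-higher : ∀ {l e f} → ρ e ≡ l → Low l f ≡ false → top (Low l) (pa e) ≡ ch f → l < ρ f
  hanging-higher refl = ρ-increases

  not-low : ∀ {l e} → Low l e ≡ false → l ≤ ρ e
  not-low {l} {e} p = ≮⇒≥ (⌊⌋-false (ρ e <? l) p)

  -- Sizes not yet computed are kept at zero. They then enter the sums of other components
  -- harmlessly: such a sum may be too small, but it never exceeds `n` and so never overflows.
  record Sized (l : ℕ) (c : Config) : Set where
    field
      node-id : ∀ v → nodeFix (proj₁ c v) ≡ (ids v , 0 , [])
      edge-id : ∀ e → edgeBase (proj₂ c e) ≡ (endIds e , childSide e , ρ e)
      known   : ∀ e → l ≤ ρ e → sz (proj₂ c e) ≡ size (ch e)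
      unknown : ∀ e → ρ e < l → sz (proj₂ c e) ≡ 0

  module SizeLevel {l c c₁ c₂} (p : Round (subtotal l) c c₁) (q : Round (storeSize l) c₁ c₂) (inv : Sized (suc l) c) where

    open Sized inv
    private
      module P = Round p
      module Q = Round q
      est = proj₂ c

      lev≡ : ∀ e → lev (est e) ≡ ρ e
      lev≡ e = cong (proj₂ ∘ proj₂) (edge-id e)

      ori≡ : ∀ e → ori (est e) ≡ childSide e
      ori≡ e = cong (proj₁ ∘ proj₂) (edge-id e)

      F≡ : ∀ e → P.F e ≡ Low l e
      F≡ e = cong (λ x → ⌊ x <? l ⌋) (lev≡ e)

      est₁≡ : ∀ e → proj₂ c₁ e ≡ est e
      est₁≡ = P.keepEdge (λ x → x) (λ _ _ → refl)

      F₁≡ : ∀ e → Q.F e ≡ P.F e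
      F₁≡ e = cong (λ x → ⌊ lev x <? l ⌋) (est₁≡ e)

      cls : V → V
      cls = top P.F

      send : Sendable (subtotal l) c
      send = (λ v → fits 1<2^W 0<2^W 0<2^W 0<2^W) , ≤-<-trans (∑≤n {n} (λ v → ≤-refl)) n<W

      Y-size : ∀ v → f0 (P.Y v) ≡ ∑ (λ u → 𝟙 (cls u ≟ cls v))
      Y-size v = trans (P.Y-sum send v) (∑-cong {n} (λ u → *-identityʳ _))

      sz≤ : ∀ e → sz (est e) ≤ size (ch e)
      sz≤ e with ρ e <? suc l
      ... | yes lt = ≤-trans (≤-reflexive (unknown e lt)) z≤n
      ... | no ¬lt = ≤-reflexive (known e (≮⇒≥ ¬lt))

      sent-fits : ∀ e s → Fits (P.sent e s)
      sent-fits e s with s Bool.≟ ori (est e)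
      ... | yes _ = 0#-fits
      ... | no _  = fits (≤-<-trans (≤-trans (sz≤ e) (size≤n (ch e))) n<W) 0<2^W 0<2^W 0<2^W

      term : V → E → ℕ
      term v e = 𝟙 (boundary? P.F (cls v) e) * sz (est e)

      received≡ : ∀ v → P.received v ≡ ∑ (term v)
      received≡ v = ∑-cong λ e → per-edge e (childSide e) refl
        where
        zero-msg : ∀ e s → s ≡ childSide e → f0 (P.sent e s) ≡ 0
        zero-msg e s eq = cong f0 (if-yes (s Bool.≟ ori (est e)) (trans eq (sym (ori≡ e))))
        size-msg : ∀ e s → s ≡ not (childSide e) → f0 (P.sent e s) ≡ sz (est e)
        size-msg e s eq = cong f0 (if-no (s Bool.≟ ori (est e)) (λ eq' → b≢not (trans (sym (ori≡ e)) (trans (sym eq') eq))))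
        parent : ∀ e s → s ≡ not (childSide e) → 𝟙 (P.incident? v e s) * f0 (P.sent e s) ≡ term v e
        parent e s eq = cong₂ _*_ (cong (λ s → 𝟙 (P.incident? v e s)) eq) (size-msg e s eq)
        child : ∀ e s → s ≡ childSide e → 𝟙 (P.incident? v e s) * f0 (P.sent e s) ≡ 0
        child e s eq = trans (cong (𝟙 (P.incident? v e s) *_) (zero-msg e s eq)) (*-zeroʳ (𝟙 (P.incident? v e s)))
        per-edge : ∀ e s → s ≡ childSide e →
          𝟙 (P.incident? v e true) * f0 (P.sent e true) + 𝟙 (P.incident? v e false) * f0 (P.sent e false) ≡ term v e
        per-edge e true  eq = cong₂ _+_ (child e true eq) (parent e false (cong not eq))
        per-edge e false eq = trans (cong₂ _+_ (parent e true (cong not eq)) (child e false eq)) (+-identityʳ _)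

      total : ∀ v → f0 (P.Y v) + ∑ (term v) ≤ size (cls v)
      total v = ≤-trans (+-mono-≤ (≤-reflexive (Y-size v)) (∑-mono (λ e → *-monoʳ-≤ (𝟙 (boundary? P.F (cls v) e)) (sz≤ e))))
        (≤-reflexive (sym (size-split P.F (cls v) (top-idem P.F v))))

      G≡ : ∀ v → f0 (P.G v) ≡ ∑ (term v)
      G≡ v = trans (P.G-sum refl sent-fits v (subst (_< 2 ^ W) (sym (received≡ v))
        (≤-<-trans (≤-trans (m≤n+m _ _) (≤-trans (total v) (size≤n (cls v)))) n<W))) (received≡ v)

      sum≤n : ∀ v → f0 (P.Y v) + f0 (P.G v) ≤ n
      sum≤n v = ≤-trans (≤-reflexive (cong (f0 (P.Y v) +_) (G≡ v))) (≤-trans (total v) (size≤n (cls v)))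

      -- An edge hanging from the component below `g` has rank at least `l`, being uncontracted, and
      -- not exactly `l`, as that would force the rank of `g` above `l`. So every size entering the
      -- sum is known, and `size-split` applies.
      exact : ∀ v g → ρ g ≡ l → cls v ≡ ch g → f0 (P.Y v) + f0 (P.G v) ≡ size (ch g)
      exact v g ρg eq = trans (cong₂ _+_ (Y-size v) (G≡ v)) (trans (cong (∑ (λ u → 𝟙 (cls u ≟ cls v)) +_) (∑-cong terms))
          (trans (sym (size-split P.F (cls v) (top-idem P.F v))) (cong size eq)))
        where
        terms : ∀ e → term v e ≡ 𝟙 (boundary? P.F (cls v) e) * size (ch e)
        terms e with boundary? P.F (cls v) e
        ... | no _ = refl
        ... | yes (out , at) = cong (_+ 0) (known e (≤∧≢⇒< (not-low (trans (sym (F≡ e)) out)) λ l≡ρ →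
                <-irrefl (sym ρg) (hanging-higher (sym l≡ρ) (⌊⌋-no (ρ g <? l) (λ lt → <-irrefl ρg lt))
                  (trans (sym (top-cong F≡ (pa e))) (trans at eq)))))

      reg₁ : ∀ v → reg (proj₁ c₁ v) ≡ quad 0 (f0 (P.Y v) + f0 (P.G v)) 0 0
      reg₁ v = cong reg (P.node v)

      send₂ : Sendable (storeSize l) c₁
      send₂ = (λ v → subst Fits (sym (reg₁ v)) (fits 0<2^W (≤-<-trans (sum≤n v) n<W) 0<2^W 0<2^W))
            , ≤-<-trans (≤-reflexive (∑-zero {n} (λ v → cong f0 (reg₁ v)))) 0<2^W

      Y₂-size : ∀ g → ρ g ≡ l → f1 (Q.Y (ch g)) ≡ size (ch g)
      Y₂-size g ρg with Q.Y-rest send₂ (ch g)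
      ... | u , at , rs = trans (cong proj₁ rs) (trans (cong f1 (reg₁ u)) (exact u g ρg
            (trans (trans (sym (top-cong F₁≡ u)) (trans at (top-cong F₁≡ (ch g))))
                   (top-out P.F (trans (F≡ g) (⌊⌋-no (ρ g <? l) (λ lt → <-irrefl ρg lt)))))))

      sz₂ : ∀ e → Low l e ≡ false → sz (proj₂ c₂ e) ≡ (if ⌊ lev (est e) ℕ.≟ l ⌋ then f1 (Q.Y (ch e)) else sz (est e))
      sz₂ e out = trans (cong sz (Q.edge-out (trans (F₁≡ e) (trans (F≡ e) out))))
        (trans (cong (λ x → if ⌊ lev x ℕ.≟ l ⌋ then f1 (select (Q.Y (ep e true)) (Q.Y (ep e false)) (ori x)) else sz x) (est₁≡ e))
               (cong (λ y → if ⌊ lev (est e) ℕ.≟ l ⌋ then f1 y else sz (est e)) (trans (select-ep Q.Y e (ori (est e))) (cong (Q.Y ∘ ep e) (ori≡ e)))))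

    sized : Sized l c₂
    sized = record
      { node-id = λ v → trans (Q.keepNode nodeFix (λ _ _ _ → refl) v) (trans (P.keepNode nodeFix (λ _ _ _ → refl) v) (node-id v))
      ; edge-id = λ e → trans (Q.keepEdge edgeBase (λ _ _ → refl) e) (trans (P.keepEdge edgeBase (λ _ _ → refl) e) (edge-id e))
      ; known   = λ e l≤ → trans (sz₂ e (⌊⌋-no (ρ e <? l) (λ lt → <⇒≱ lt l≤))) (stored e l≤ (lev (est e) ℕ.≟ l))
      ; unknown = λ e lt → trans (cong sz (trans (Q.edge-in (trans (F₁≡ e) (trans (F≡ e) (⌊⌋-yes (ρ e <? l) lt)))) (est₁≡ e)))
                                 (unknown e (m<n⇒m<1+n lt))
      }
      where
      stored : ∀ e → l ≤ ρ e → (d : Dec (lev (est e) ≡ l)) → (if ⌊ d ⌋ then f1 (Q.Y (ch e)) else sz (est e)) ≡ size (ch e)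
      stored e l≤ (yes eq) = Y₂-size e (trans (sym (lev≡ e)) eq)
      stored e l≤ (no ne)  = known e (≤∧≢⇒< l≤ (λ eq → ne (trans (lev≡ e) (sym eq))))

  size-all : ∀ l {c c'} → Run (sizeProg l) c c' → Sized l c → Sized 0 c'
  size-all zero    []            inv = inv
  size-all (suc l) (p ∷ q ∷ run) inv = size-all l run (SizeLevel.sized p q inv)

  edgeSized : EdgeSt → (Bool → ℕ) × Bool × ℕ × ℕ
  edgeSized x = eid x , ori x , lev x , sz x

  record Deep (l : ℕ) (c : Config) : Set where
    field
      node-id : ∀ v → (nid (proj₁ c v) , lst (proj₁ c v)) ≡ (ids v , [])
      edge-id : ∀ e → edgeSized (proj₂ c e) ≡ (endIds e , childSide e , ρ e , size (ch e))
      deep    : ∀ v → ndep (proj₁ c v) + depth (top (Low l) v) ≡ depth v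

  module DepthLevel {l c c₁ c₂} (p : Round readDepth c c₁) (q : Round (addDepth l) c₁ c₂) (inv : Deep l c) where

    open Deep inv
    private
      module P = Round p
      module Q = Round q
      est₁ = proj₂ c₁
      nd : V → ℕ
      nd v = ndep (proj₁ c v)
      cls : V → V
      cls = top (Low l)

      nd≤ : ∀ v → nd v ≤ depth v
      nd≤ v = ≤-trans (m≤m+n _ _) (≤-reflexive (deep v))

      pd₁ : ∀ e → pd (est₁ e) ≡ nd (pa e)
      pd₁ = ReadDepth.pd≡ p (λ e → cong (proj₁ ∘ proj₂) (edge-id e)) (λ v → ≤-<-trans (nd≤ v) (<-trans (depth<n v) n<W))

      edge-id₁ : ∀ e → edgeSized (est₁ e) ≡ (endIds e , childSide e , ρ e , size (ch e))
      edge-id₁ e = trans (P.keepEdge edgeSized (λ _ _ → refl) e) (edge-id e)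

      ori≡ : ∀ e → ori (est₁ e) ≡ childSide e
      ori≡ e = cong (proj₁ ∘ proj₂) (edge-id₁ e)

      lev≡ : ∀ e → lev (est₁ e) ≡ ρ e
      lev≡ e = cong (proj₁ ∘ proj₂ ∘ proj₂) (edge-id₁ e)

      F≡ : ∀ e → Q.F e ≡ Low l e
      F≡ e = cong (λ x → ⌊ x <? l ⌋) (lev≡ e)

      top≡ : ∀ v → top Q.F v ≡ cls v
      top≡ = top-cong F≡

      down? : ∀ e s → Dec (s ≡ ori (est₁ e) × lev (est₁ e) ≡ l)
      down? e s = (s Bool.≟ ori (est₁ e)) ×-dec (lev (est₁ e) ℕ.≟ l)

      sent-fits : ∀ e s → Fits (Q.sent e s)
      sent-fits e s = if-fits (down? e s) λ _ → fits 1<2^W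
        (≤-<-trans (≤-trans (s≤s (≤-trans (≤-reflexive (pd₁ e)) (nd≤ (pa e)))) (≤-reflexive (sym (depth-ch e)))) (<-trans (depth<n (ch e)) n<W))
        0<2^W 0<2^W

      out : ∀ {e} → ρ e ≡ l → Low l e ≡ false
      out {e} ρe = ⌊⌋-no (ρ e <? l) (λ lt → <-irrefl ρe lt)

      G-above : ∀ v → 0 < f0 (Q.G v) → ∃[ e ] (ρ e ≡ l × cls v ≡ ch e × f1 (Q.G v) ≡ suc (nd (pa e)))
      G-above v 0<G = let (e , s , o , at , eq) = Q.G-from refl sent-fits v 0<G in aux e s at eq (down? e s)
        where
        aux : ∀ e s → top Q.F (ep e s) ≡ top Q.F v → Q.G v ≡ Q.sent e s → Dec (s ≡ ori (est₁ e) × lev (est₁ e) ≡ l) →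
              ∃[ e ] (ρ e ≡ l × cls v ≡ ch e × f1 (Q.G v) ≡ suc (nd (pa e)))
        aux e s at eq (no ¬h) = ⊥-elim (n≮0 (subst (0 <_) (trans (cong f0 eq)
          (cong f0 (if-no (down? e s) ¬h))) 0<G))
        aux e s at eq (yes h@(side , lv)) = e , ρe
          , trans (trans (sym (top≡ v)) (trans (sym at) (top≡ (ep e s)))) (trans (cong (cls ∘ ep e) (trans side (ori≡ e))) (top-out (Low l) (out ρe)))
          , trans (cong f1 eq) (trans (cong f1 (if-yes (down? e s) h)) (cong suc (pd₁ e)))
          where
          ρe : ρ e ≡ l
          ρe = trans (sym (lev≡ e)) lv

      G-pos : ∀ v e → ρ e ≡ l → cls v ≡ ch e → 0 < f0 (Q.G v)
      G-pos v e ρe at = ≤-trans (≤-reflexive (sym (cong f0 (if-yes (down? e (childSide e)) (sym (ori≡ e) , trans (lev≡ e) ρe)))))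
        (Q.G-max refl sent-fits v e (childSide e) (trans (F≡ e) (out ρe))
          (trans (top≡ (ch e)) (trans (top-out (Low l) (out ρe)) (trans (sym at) (sym (top≡ v))))))

      low⊆ : ∀ {e} → Low l e ≡ true → Low (suc l) e ≡ true
      low⊆ {e} h = ⌊⌋-yes (ρ e <? suc l) (m<n⇒m<1+n (⌊⌋-true (ρ e <? l) h))

      next-top : ∀ v → top (Low (suc l)) v ≡ top (Low (suc l)) (cls v)
      next-top v = top-mono low⊆ (sym (top-idem (Low l) v))

      settled : ∀ v → (∀ {f} → Low l f ≡ false → cls v ≡ ch f → l < ρ f) → top (Low (suc l)) v ≡ cls v
      settled v above with top-view (Low l) v
      ... | inj₁ eq = trans (next-top v) (trans (cong (top (Low (suc l))) eq) (trans (top-r (Low (suc l))) (sym eq)))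
      ... | inj₂ (f , o , eq) = trans (next-top v) (trans (cong (top (Low (suc l))) eq)
              (trans (top-out (Low (suc l)) (⌊⌋-no (ρ f <? suc l) (λ lt → <⇒≱ (above o eq) (≤-pred lt)))) (sym eq)))

      -- The component above `e` has no parent edge or one of rank greater than `l`, so it keeps its
      -- top. Components are therefore never chained within one rank, and a single addition updates
      -- the relative depth.
      joined : ∀ v e → ρ e ≡ l → cls v ≡ ch e → top (Low (suc l)) v ≡ cls (pa e)
      joined v e ρe eq = trans (next-top v) (trans (cong (top (Low (suc l))) eq)
        (trans (top-in (Low (suc l)) (⌊⌋-yes (ρ e <? suc l) (≤-reflexive (cong suc ρe)))) (settled (pa e) (hanging-higher ρe))))

      ndep₁ : ∀ v → ndep (proj₁ c₁ v) ≡ nd v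
      ndep₁ = P.keepNode ndep (λ _ _ _ → refl)

      deeper : ∀ v → (d : Dec (0 < f0 (Q.G v))) →
               (if ⌊ d ⌋ then ndep (proj₁ c₁ v) + f1 (Q.G v) else ndep (proj₁ c₁ v)) + depth (top (Low (suc l)) v) ≡ depth v
      deeper v (yes pos) with G-above v pos
      ... | e , ρe , eq , g = begin
        ndep (proj₁ c₁ v) + f1 (Q.G v) + depth (top (Low (suc l)) v)
          ≡⟨ cong₂ _+_ (cong₂ _+_ (ndep₁ v) g) (cong depth (joined v e ρe eq)) ⟩
        nd v + suc (nd (pa e)) + depth (cls (pa e))   ≡⟨ +-assoc (nd v) _ _ ⟩
        nd v + suc (nd (pa e) + depth (cls (pa e)))   ≡⟨ cong (λ k → nd v + suc k) (deep (pa e)) ⟩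
        nd v + suc (depth (pa e))                     ≡⟨ cong (nd v +_) (sym (depth-ch e)) ⟩
        nd v + depth (ch e)                           ≡⟨ cong (λ x → nd v + depth x) eq ⟨
        nd v + depth (cls v)                          ≡⟨ deep v ⟩
        depth v                                       ∎
        where open ≡-Reasoning
      deeper v (no ¬pos) = trans (cong₂ _+_ (ndep₁ v) (cong depth (settled v λ {f} o eq →
        ≤∧≢⇒< (not-low o) (λ l≡ → ¬pos (G-pos v f (sym l≡) eq))))) (deep v)

    deepened : Deep (suc l) c₂
    deepened = record
      { node-id = λ v → trans (Q.keepNode (λ x → nid x , lst x) (λ _ _ _ → refl) v) (trans (P.keepNode (λ x → nid x , lst x) (λ _ _ _ → refl) v) (node-id v))
      ; edge-id = λ e → trans (Q.keepEdge edgeSized (λ _ _ → refl) e) (edge-id₁ e)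
      ; deep    = λ v → trans (cong (_+ depth (top (Low (suc l)) v)) (cong ndep (Q.node v))) (deeper v (0 <? f0 (Q.G v)))
      }

  depth-all : ∀ l {c c'} → Run (depthProg l) c c' → Deep 0 c → Deep l c'
  depth-all zero    []  inv = inv
  depth-all (suc l) run inv with run-++ (depthProg l) run
  ... | c₁ , run₁ , (p ∷ q ∷ []) = DepthLevel.deepened p q (depth-all l run₁ inv)

  deep-start : ∀ {c} → Sized 0 c → Deep 0 c
  deep-start {c} inv = record
    { node-id = λ v → cong (λ { (a , _ , l) → a , l }) (node-id v)
    ; edge-id = λ e → trans (cong (λ { (a , o , l) → a , o , l , sz (proj₂ c e) }) (edge-id e))
                            (cong (λ k → endIds e , childSide e , ρ e , k) (known e z≤n))
    ; deep    = λ v → cong₂ _+_ (cong (proj₁ ∘ proj₂) (node-id v)) (cong depth (top-none (λ e → ⌊⌋-no (ρ e <? 0) n≮0) v))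
    }
    where open Sized inv

  deep-end : ∀ {l c} → (∀ e → ρ e < l) → Deep l c → ∀ v → ndep (proj₁ c v) ≡ depth v
  deep-end {l} {c} ρ<l inv v = trans (sym (+-identityʳ _)) (trans (cong (ndep (proj₁ c v) +_)
    (sym (trans (cong depth (top-all (λ e → ⌊⌋-yes (ρ e <? l) (ρ<l e)) v)) depth-r))) (Deep.deep inv v))

-- Heavy children and the lists of light edges

nthQ : ℕ → List Quad → Quad
nthQ _       []       = 0#
nthQ zero    (x ∷ _)  = x
nthQ (suc k) (_ ∷ xs) = nthQ k xs

-- Genuine entries have first field one, so the default `0#` past the end of the list reads as no
-- message; this is how a vertex notices that its list is complete.
nthQ-flag : ∀ k {xs} → All (λ m → f0 m ≡ 1) xs → nthQ k xs ≡ 0# ⊎ f0 (nthQ k xs) ≡ 1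
nthQ-flag _       []       = inj₁ refl
nthQ-flag zero    (p ∷ _)  = inj₂ p
nthQ-flag (suc k) (_ ∷ ps) = nthQ-flag k ps

nthQ-zero : ∀ k {xs} → All (λ m → f0 m ≡ 1) xs → ¬ (0 < f0 (nthQ k xs)) → nthQ k xs ≡ 0#
nthQ-zero k all ¬pos with nthQ-flag k all
... | inj₁ eq = eq
... | inj₂ eq = ⊥-elim (¬pos (≤-reflexive (sym eq)))

nthQ-All : ∀ k {xs} {P : Quad → Set} → P 0# → All P xs → P (nthQ k xs)
nthQ-All _       z []       = z
nthQ-All zero    _ (p ∷ _)  = p
nthQ-All (suc k) z (_ ∷ ps) = nthQ-All k z ps

take-nthQ : ∀ k {xs} → All (λ m → f0 m ≡ 1) xs → (d : Dec (0 < f0 (nthQ k xs))) →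
  take (suc k) xs ≡ take k xs ++ (if ⌊ d ⌋ then nthQ k xs ∷ [] else [])
take-nthQ zero    []       (no _)  = refl
take-nthQ (suc k) []       (no _)  = refl
take-nthQ zero    (p ∷ _)  (yes _) = refl
take-nthQ zero    (p ∷ _)  (no ¬q) = ⊥-elim (¬q (≤-reflexive (sym p)))
take-nthQ (suc k) (_ ∷ ps) d       = cong (_ ∷_) (take-nthQ k ps d)

reverse-take-nthQ : ∀ k {xs} → All (λ m → f0 m ≡ 1) xs → (d : Dec (0 < f0 (nthQ k xs))) →
  map entry (reverse (take (suc k) xs)) ≡
  (if ⌊ d ⌋ then entry (nthQ k xs) ∷ map entry (reverse (take k xs)) else map entry (reverse (take k xs)))
reverse-take-nthQ k {xs} all d = trans (cong (map entry ∘ reverse) (take-nthQ k all d)) (aux d)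
  where
  aux : (d : Dec (0 < f0 (nthQ k xs))) → map entry (reverse (take k xs ++ (if ⌊ d ⌋ then nthQ k xs ∷ [] else []))) ≡
    (if ⌊ d ⌋ then entry (nthQ k xs) ∷ map entry (reverse (take k xs)) else map entry (reverse (take k xs)))
  aux (yes _) = cong (map entry) (reverse-++ (take k xs) (nthQ k xs ∷ []))
  aux (no _)  = cong (map entry ∘ reverse) (++-identityʳ (take k xs))

lightProg : ℕ → List Instr
lightProg q = firstLight ∷ replicate q nextLight

heavyProg : List Instr
heavyProg = readDepth ∷ pickHeavy ∷ markHeavy ∷ []

module HeavyLight (S : Setting) where

  open Analysis S

  depth<W : ∀ v → depth v < 2 ^ W
  depth<W v = <-trans (depth<n v) n<W

  no-contraction : ∀ {u v} → top (λ _ → false) u ≡ top (λ _ → false) v → u ≡ v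
  no-contraction {u} {v} eq = trans (sym (top-none (λ _ → refl) u)) (trans eq (top-none (λ _ → refl) v))

  record Measured (c : Config) : Set where
    field
      node-id : ∀ v → nodeFix (proj₁ c v) ≡ (ids v , depth v , [])
      edge-id : ∀ e → (eid (proj₂ c e) , ori (proj₂ c e) , sz (proj₂ c e)) ≡ (endIds e , childSide e , size (ch e))

  record Marked (hc : HeavyChoice n) (H : E → Bool) (c : Config) : Set where
    field
      node-id : ∀ v → nodeFix (proj₁ c v) ≡ (ids v , depth v , [])
      edge-id : ∀ e → (eid (proj₂ c e) , ori (proj₂ c e) , pd (proj₂ c e) , hvy (proj₂ c e)) ≡ (endIds e , childSide e , depth (pa e) , H e)
      some    : ∀ u h → hc u ≡ just h → ∃[ e ] (pa e ≡ u × h ≡ ch e × ∀ e' → pa e' ≡ u → size (ch e') ≤ size (ch e))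
      none    : ∀ u → hc u ≡ nothing → ∀ e → pa e ≢ u
      heavy-H : ∀ e → hc (pa e) ≡ just (ch e) → H e ≡ true
      H-heavy : ∀ e → H e ≡ true → hc (pa e) ≡ just (ch e)

  module Heavy {c c₁ c₂ c₃} (p : Round readDepth c c₁) (q : Round pickHeavy c₁ c₂) (m : Round markHeavy c₂ c₃) (inv : Measured c) where

    open Measured inv
    private
      module P = Round p
      module Q = Round q
      module M = Round m
      est₁ = proj₂ c₁

      pd₁ : ∀ e → pd (est₁ e) ≡ depth (pa e)
      pd₁ e = trans (RD.pd≡ e) (cong (proj₁ ∘ proj₂) (node-id (pa e)))
        where
        module RD = ReadDepth p (λ e → cong (proj₁ ∘ proj₂) (edge-id e))
          (λ v → subst (_< 2 ^ W) (sym (cong (proj₁ ∘ proj₂) (node-id v))) (depth<W v))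

      edge-id₁ : ∀ e → (eid (est₁ e) , ori (est₁ e) , sz (est₁ e)) ≡ (endIds e , childSide e , size (ch e))
      edge-id₁ e = trans (P.keepEdge (λ x → eid x , ori x , sz x) (λ _ _ → refl) e) (edge-id e)

      ori₁ : ∀ e → ori (est₁ e) ≡ childSide e
      ori₁ e = cong (proj₁ ∘ proj₂) (edge-id₁ e)

      sz₁ : ∀ e → sz (est₁ e) ≡ size (ch e)
      sz₁ e = cong (proj₂ ∘ proj₂) (edge-id₁ e)

      eid₁ : ∀ e → eid (est₁ e) (ori (est₁ e)) ≡ ids (ch e)
      eid₁ e = trans (cong₂ (λ f s → f s) (cong proj₁ (edge-id₁ e)) (ori₁ e)) (endIds-ep e (childSide e))

      up-message : ∀ e s → s ≢ ori (est₁ e) → Q.sent e s ≡ quad (size (ch e)) (ids (ch e)) 0 0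
      up-message e s ne = trans (if-no (s Bool.≟ ori (est₁ e)) ne) (cong₂ (λ a b → quad a b 0 0) (sz₁ e) (eid₁ e))

      down-message : ∀ e s → s ≡ ori (est₁ e) → Q.sent e s ≡ 0#
      down-message e s eq = if-yes (s Bool.≟ ori (est₁ e)) eq

      sent-fits : ∀ e s → Fits (Q.sent e s)
      sent-fits e s = aux (s Bool.≟ ori (est₁ e))
        where
        aux : Dec (s ≡ ori (est₁ e)) → Fits (Q.sent e s)
        aux (yes eq) = subst Fits (sym (down-message e s eq)) 0#-fits
        aux (no ne)  = subst Fits (sym (up-message e s ne)) (fits (≤-<-trans (size≤n (ch e)) n<W) (ids<W (ch e)) 0<2^W 0<2^W)

      parent-side : ∀ e → not (childSide e) ≢ ori (est₁ e)
      parent-side e eq = b≢not (sym (trans eq (ori₁ e)))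

      G-bound : ∀ e → size (ch e) ≤ f0 (Q.G (pa e))
      G-bound e = ≤-trans (≤-reflexive (sym (cong f0 (up-message e (not (childSide e)) (parent-side e)))))
        (Q.G-max refl sent-fits (pa e) e (not (childSide e)) refl refl)

      Pick : V → Set
      Pick u = ∃[ e ] (pa e ≡ u × Q.G u ≡ quad (size (ch e)) (ids (ch e)) 0 0)

      pick : ∀ u → f0 (Q.G u) ≡ 0 ⊎ Pick u
      pick u with f0 (Q.G u) in eq
      ... | zero = inj₁ refl
      ... | suc _ = inj₂ (found (Q.G-from refl sent-fits u 0<G))
        where
        0<G : 0 < f0 (Q.G u)
        0<G = subst (0 <_) (sym eq) z<s
        found : ∃[ e ] ∃[ s ] (false ≡ false × top Q.F (ep e s) ≡ top Q.F u × Q.G u ≡ Q.sent e s) → Pick u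
        found (e , s , _ , at , g) = aux (s Bool.≟ ori (est₁ e))
          where
          aux : Dec (s ≡ ori (est₁ e)) → Pick u
          aux (yes s≡) = ⊥-elim (n≮0 (subst (0 <_) (cong f0 (trans g (down-message e s s≡))) 0<G))
          aux (no s≢)  = e , trans (cong (ep e) (sym (≢⇒≡not (λ s≡ → s≢ (trans s≡ (sym (ori₁ e))))))) (no-contraction at)
                           , trans g (up-message e s s≢)

      -- The decomposition is read off the aggregate delivered in this particular execution, since
      -- the order of aggregation decides ties between children of equal size.
      choice : ∀ {u} → f0 (Q.G u) ≡ 0 ⊎ Pick u → Maybe V
      choice (inj₁ _)       = nothing
      choice (inj₂ (e , _)) = just (ch e)

      reg₂ : ∀ u → reg (proj₁ c₂ u) ≡ quad 0 (f1 (Q.G u)) 0 0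
      reg₂ u = cong reg (Q.node u)

      send₃ : Sendable markHeavy c₂
      send₃ = (λ u → subst Fits (sym (reg₂ u)) (fits 0<2^W (b1 (Q.G-fits u)) 0<2^W 0<2^W))
            , ≤-<-trans (≤-reflexive (∑-zero {n} (λ u → cong f0 (reg₂ u)))) 0<2^W

      Y₃ : ∀ u → f1 (M.Y u) ≡ f1 (Q.G u)
      Y₃ u with M.Y-rest send₃ u
      ... | w , at , rs = trans (cong proj₁ rs) (trans (cong f1 (reg₂ w)) (cong (f1 ∘ Q.G) (no-contraction at)))

      est₂≡ : ∀ e → proj₂ c₂ e ≡ est₁ e
      est₂≡ = Q.keepEdge (λ x → x) (λ _ _ → refl)

    hc : HeavyChoice n
    hc u = choice (pick u)

    H : E → Bool
    H e = ⌊ f1 (Q.G (pa e)) ℕ.≟ ids (ch e) ⌋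

    marked : Marked hc H c₃
    marked = record
      { node-id = λ v → trans (M.keepNode nodeFix (λ _ _ _ → refl) v) (trans (Q.keepNode nodeFix (λ _ _ _ → refl) v)
                          (trans (P.keepNode nodeFix (λ _ _ _ → refl) v) (node-id v)))
      ; edge-id = λ e → cong₂ (λ { (a , b , k) h → a , b , k , h })
          (trans (M.keepEdge (λ x → eid x , ori x , pd x) (λ _ _ → refl) e) (trans (cong (λ x → eid x , ori x , pd x) (est₂≡ e))
            (cong₂ (λ { (a , b , _) k → a , b , k }) (edge-id₁ e) (pd₁ e))))
          (hvy≡ e)
      ; some    = some
      ; none    = none
      ; heavy-H = λ e → heavy-H e (pick (pa e))
      ; H-heavy = λ e → H-heavy e (pick (pa e))
      }
      where
      hvy≡ : ∀ e → hvy (proj₂ c₃ e) ≡ H e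
      hvy≡ e = trans (cong hvy (M.edge-out refl)) (trans
        (cong (λ x → ⌊ f1 (select (M.Y (ep e true)) (M.Y (ep e false)) (not (ori x))) ℕ.≟ eid x (ori x) ⌋) (est₂≡ e))
        (cong₂ (λ a b → ⌊ a ℕ.≟ b ⌋) (trans (cong f1 (trans (select-ep M.Y e _) (cong (λ s → M.Y (ep e (not s))) (ori₁ e)))) (Y₃ (pa e))) (eid₁ e)))
      some : ∀ u h → hc u ≡ just h → ∃[ e ] (pa e ≡ u × h ≡ ch e × ∀ e' → pa e' ≡ u → size (ch e') ≤ size (ch e))
      some u h eq with pick u
      ... | inj₂ (e , pa≡ , g) = e , pa≡ , sym (just-injective eq) , λ { e' refl → ≤-trans (G-bound e') (≤-reflexive (cong f0 g)) }
      none : ∀ u → hc u ≡ nothing → ∀ e → pa e ≢ u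
      none u eq e refl with pick u
      -- Every child announces a positive size, so a zero maximum occurs only at a leaf.
      ... | inj₁ z = n≮0 (≤-trans (size-pos (ch e)) (≤-trans (G-bound e) (≤-reflexive z)))
      heavy-H : ∀ e (k : f0 (Q.G (pa e)) ≡ 0 ⊎ Pick (pa e)) → choice k ≡ just (ch e) → H e ≡ true
      heavy-H e (inj₂ (e' , _ , g)) eq = ⌊⌋-yes (f1 (Q.G (pa e)) ℕ.≟ ids (ch e)) (trans (cong f1 g) (cong ids (just-injective eq)))
      H-heavy : ∀ e (k : f0 (Q.G (pa e)) ≡ 0 ⊎ Pick (pa e)) → H e ≡ true → choice k ≡ just (ch e)
      H-heavy e (inj₁ z) _ = ⊥-elim (n≮0 (≤-trans (size-pos (ch e)) (≤-trans (G-bound e) (≤-reflexive z))))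
      H-heavy e (inj₂ (e' , _ , g)) h = cong just (ids-inj (trans (sym (cong f1 g)) (⌊⌋-true (f1 (Q.G (pa e)) ℕ.≟ ids (ch e)) h)))

  module Lists (hc : HeavyChoice n) (H : E → Bool) where

    lightMsg : E → Quad
    lightMsg e = quad 1 (depth (pa e)) (ids (pa e)) (ids (ch e))

    -- The light edges above a vertex, starting from the lowest one.
    lights : V → List Quad
    lights = fold [] (λ e xs → if H e then xs else lightMsg e ∷ xs)

    lights-r : lights r ≡ []
    lights-r = fold-r _ _

    lights-heavy : ∀ {e} → H e ≡ true → lights (ch e) ≡ lights (pa e)
    lights-heavy {e} h = trans (fold-ch [] _ e) (cong (λ b → if b then lights (pa e) else lightMsg e ∷ lights (pa e)) h)

    lights-light : ∀ {e} → H e ≡ false → lights (ch e) ≡ lightMsg e ∷ lights (pa e)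
    lights-light {e} h = trans (fold-ch [] _ e) (cong (λ b → if b then lights (pa e) else lightMsg e ∷ lights (pa e)) h)

    lights-All : ∀ {P : Quad → Set} → (∀ e → P (lightMsg e)) → ∀ v → All P (lights v)
    lights-All {P} all = tree-ind _ (subst (All P) (sym lights-r) []) λ e ih → aux e ih (bool-cases (H e))
      where
      aux : ∀ e → All P (lights (pa e)) → H e ≡ true ⊎ H e ≡ false → All P (lights (ch e))
      aux e ih (inj₁ h) = subst (All P) (sym (lights-heavy h)) ih
      aux e ih (inj₂ h) = subst (All P) (sym (lights-light h)) (all e ∷ ih)

    lights-top : ∀ v → lights v ≡ lights (top H v)
    lights-top = top-const {H} lights lights-heavy

    flags : ∀ v → All (λ m → f0 m ≡ 1) (lights v)
    flags = lights-All (λ _ → refl)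

    nthQ-fits : ∀ k v → Fits (nthQ k (lights v))
    nthQ-fits k v = nthQ-All k {P = Fits} 0#-fits (lights-All (λ e → fits 1<2^W (depth<W (pa e)) (ids<W (pa e)) (ids<W (ch e))) v)

    nthQ≤1 : ∀ k v → f0 (nthQ k (lights v)) ≤ 1
    nthQ≤1 k v = nthQ-All k {P = λ m → f0 m ≤ 1} z≤n (lights-All (λ e → ≤-refl) v)

    record Base (c : Config) : Set where
      field
        node-id : ∀ v → (nid (proj₁ c v) , ndep (proj₁ c v)) ≡ (ids v , depth v)
        edge-id : ∀ e → (eid (proj₂ c e) , ori (proj₂ c e) , pd (proj₂ c e) , hvy (proj₂ c e)) ≡ (endIds e , childSide e , depth (pa e) , H e)

    -- Light edges arrive from the lowest upwards and are put in front of the list, so the stored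
    -- part is always in root-to-vertex order, as `LightEntries` demands.
    record Listed (k : ℕ) (c : Config) : Set where
      field
        base   : Base c
        listed : ∀ v → lst (proj₁ c v) ≡ map entry (reverse (take k (lights v)))

    record Current (k : ℕ) (c : Config) : Set where
      field current : ∀ v → reg (proj₁ c v) ≡ nthQ k (lights v)

    module _ {ins c c'} (p : Round ins c c') (isMax : aggregate ins ≡ _⊔#_) (k : ℕ)
             (F≡ : ∀ e → Round.F p e ≡ H e)
             (down : ∀ e s → s ≡ childSide e → H e ≡ false → Round.sent p e s ≡ nthQ k (lights (ch e)))
             (upwards : ∀ e s → s ≢ childSide e → Round.sent p e s ≡ 0#)
             (sent-fits : ∀ e s → Fits (Round.sent p e s)) where

      private
        module P = Round p
        cls = top H

        top≡ : ∀ v → top P.F v ≡ cls v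
        top≡ = top-cong F≡

      -- A heavy path hears a nonzero message only through the parent edge of its top, so the
      -- maximum is that message. All vertices of the path can use it because `lights` is constant
      -- along heavy edges.
      delivered : ∀ v → (d : Dec (0 < f0 (P.G v))) → (if ⌊ d ⌋ then P.G v else 0#) ≡ nthQ k (lights v)
      delivered v (yes pos) = let (e , s , out , at , g) = P.G-from isMax sent-fits v pos in
          aux e s (trans (sym (F≡ e)) out) (trans (sym (top≡ (ep e s))) (trans at (top≡ v))) g (s Bool.≟ childSide e)
        where
        aux : ∀ e s → H e ≡ false → cls (ep e s) ≡ cls v → P.G v ≡ P.sent e s → Dec (s ≡ childSide e) → P.G v ≡ nthQ k (lights v)
        aux e s h at g (no ne)  = ⊥-elim (n≮0 (subst (0 <_) (cong f0 (trans g (upwards e s ne))) pos))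
        aux e s h at g (yes eq) = trans g (trans (down e s eq h) (cong (nthQ k)
          (trans (lights-top (ch e)) (trans (cong lights (trans (cong (cls ∘ ep e) (sym eq)) at)) (sym (lights-top v))))))
      delivered v (no ¬pos) = sym (aux (top-view H v))
        where
        aux : IsTop H (cls v) → nthQ k (lights v) ≡ 0#
        aux (inj₁ eq) = cong (nthQ k) (trans (lights-top v) (trans (cong lights eq) lights-r))
        aux (inj₂ (e , h , eq)) = nthQ-zero k (flags v) λ pos → ¬pos (<-≤-trans pos (≤-trans
          (≤-reflexive (cong f0 (sym (trans (down e (childSide e) refl h) (cong (nthQ k) (sym (trans (lights-top v) (cong lights eq))))))))
          (P.G-max isMax sent-fits v e (childSide e) (trans (F≡ e) h) (trans (top≡ (ch e)) (trans (top-out H h) (trans (sym eq) (sym (top≡ v))))))))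

      appended : ∀ v → (d : Dec (0 < f0 (P.G v))) →
        (if ⌊ d ⌋ then entry (P.G v) ∷ map entry (reverse (take k (lights v))) else map entry (reverse (take k (lights v)))) ≡
        map entry (reverse (take (suc k) (lights v)))
      appended v d@(yes pos) = trans (cong (λ g → entry g ∷ _) G≡) (sym (reverse-take-nthQ k (flags v) (yes (subst (λ g → 0 < f0 g) G≡ pos))))
        where
        G≡ : P.G v ≡ nthQ k (lights v)
        G≡ = delivered v d
      appended v d@(no ¬pos) = sym (reverse-take-nthQ k (flags v) (no λ pos → n≮0 (subst (λ g → 0 < f0 g) (sym (delivered v d)) pos)))

    module FirstLight {c c'} (p : Round firstLight c c') (inv : Listed 0 c) where

      open Listed inv
      open Base base
      private
        module P = Round p
        est = proj₂ c

        ori≡ : ∀ e → ori (est e) ≡ childSide e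
        ori≡ e = cong (proj₁ ∘ proj₂) (edge-id e)

        F≡ : ∀ e → P.F e ≡ H e
        F≡ e = cong (proj₂ ∘ proj₂ ∘ proj₂) (edge-id e)

        lm : ∀ e → quad 1 (pd (est e)) (eid (est e) (not (ori (est e)))) (eid (est e) (ori (est e))) ≡ lightMsg e
        lm e = trans (cong (λ { (f , o , d , _) → quad 1 d (f (not o)) (f o) }) (edge-id e))
          (cong₂ (λ a b → quad 1 (depth (pa e)) a b) (endIds-ep e (not (childSide e))) (endIds-ep e (childSide e)))

        sent-down : ∀ e s → s ≡ childSide e → P.sent e s ≡ lightMsg e
        sent-down e s eq = trans (if-yes (s Bool.≟ ori (est e)) (trans eq (sym (ori≡ e)))) (lm e)

        sent-up : ∀ e s → s ≢ childSide e → P.sent e s ≡ 0#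
        sent-up e s ne = if-no (s Bool.≟ ori (est e)) (λ eq → ne (trans eq (ori≡ e)))

        down : ∀ e s → s ≡ childSide e → H e ≡ false → P.sent e s ≡ nthQ 0 (lights (ch e))
        down e s eq h = trans (sent-down e s eq) (cong (nthQ 0) (sym (lights-light h)))

        sent-fits : ∀ e s → Fits (P.sent e s)
        sent-fits e s = aux (s Bool.≟ childSide e)
          where
          aux : Dec (s ≡ childSide e) → Fits (P.sent e s)
          aux (yes eq) = subst Fits (sym (sent-down e s eq)) (fits 1<2^W (depth<W (pa e)) (ids<W (pa e)) (ids<W (ch e)))
          aux (no ne)  = subst Fits (sym (sent-up e s ne)) 0#-fits

      next : Listed 1 c' × Current 0 c'
      next = record
        { base = record { node-id = λ v → trans (P.keepNode (λ x → nid x , ndep x) (λ _ _ _ → refl) v) (node-id v)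
                        ; edge-id = λ e → trans (P.keepEdge (λ x → eid x , ori x , pd x , hvy x) (λ _ _ → refl) e) (edge-id e) }
        ; listed = λ v → trans (cong lst (P.node v)) (trans
            (cong (λ l → if ⌊ 0 <? f0 (P.G v) ⌋ then entry (P.G v) ∷ l else l) (listed v))
            (appended p refl 0 F≡ down sent-up sent-fits v (0 <? f0 (P.G v))))
        } , record { current = λ v → trans (cong reg (P.node v)) (delivered p refl 0 F≡ down sent-up sent-fits v (0 <? f0 (P.G v))) }

    module NextLight {k c c'} (p : Round nextLight c c') (inv : Listed (suc k) c) (cur : Current k c) where

      open Listed inv
      open Base base
      open Current cur
      private
        module P = Round p
        est = proj₂ c

        ori≡ : ∀ e → ori (est e) ≡ childSide e
        ori≡ e = cong (proj₁ ∘ proj₂) (edge-id e)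

        F≡ : ∀ e → P.F e ≡ H e
        F≡ e = cong (proj₂ ∘ proj₂ ∘ proj₂) (edge-id e)

        value-at : V → Quad
        value-at v = nthQ k (lights v)

        same-value : ∀ {u v} → top P.F u ≡ top P.F v → value-at u ≡ value-at v
        same-value {u} {v} eq = cong (nthQ k) (trans (lights-top u) (trans (cong lights
          (trans (sym (top-cong F≡ u)) (trans eq (top-cong F≡ v)))) (sym (lights-top v))))

        send : Sendable nextLight c
        send = (λ v → subst Fits (sym (current v)) (nthQ-fits k v))
             , ≤-<-trans (∑≤n {n} (λ v → ≤-trans (≤-reflexive (cong f0 (current v))) (nthQ≤1 k v))) n<W

        Y-rest' : ∀ v → rest (P.Y v) ≡ rest (value-at v)
        Y-rest' v with P.Y-rest send v
        ... | u , at , rs = trans rs (cong rest (trans (current u) (same-value at)))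

        Y-pos : ∀ v → 0 < f0 (P.Y v) → 0 < f0 (value-at v)
        Y-pos v pos with ∑-pos (λ u → 𝟙 (top P.F u ≟ top P.F v) * f0 (reg (proj₁ c u))) (subst (0 <_) (P.Y-sum send v) pos)
        ... | u , q with top P.F u ≟ top P.F v
        ...   | yes at = subst (0 <_) (trans (*-identityˡ _) (cong f0 (trans (current u) (same-value at)))) q
        ...   | no _   = ⊥-elim (n≮0 q)

        pos-Y : ∀ v → 0 < f0 (value-at v) → 0 < f0 (P.Y v)
        pos-Y v pos = ≤-trans pos (≤-trans (≤-reflexive (sym
            (trans (cong₂ _*_ (𝟙-yes (top P.F v ≟ top P.F v) refl) (cong f0 (current v))) (*-identityˡ _))))
          (≤-trans (term≤∑ (λ u → 𝟙 (top P.F u ≟ top P.F v) * f0 (reg (proj₁ c u))) v) (≤-reflexive (sym (P.Y-sum send v)))))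

        -- The consensus adds up the first fields along the whole heavy path, so only their
        -- positivity is informative; the copy restores the value one.
        copy : Quad → Quad
        copy y = quad 1 (f1 y) (f2 y) (f3 y)

        pass? : ∀ e s → Dec (s ≡ ori (est e) × 0 < f0 (P.Y (ep e (not s))))
        pass? e s = (s Bool.≟ ori (est e)) ×-dec (0 <? f0 (P.Y (ep e (not s))))

        sent-down : ∀ e s → s ≡ childSide e → P.sent e s ≡ value-at (pa e)
        sent-down e s refl = aux (pass? e s)
          where
          aux : (d : Dec (s ≡ ori (est e) × 0 < f0 (P.Y (pa e)))) → P.sent e s ≡ value-at (pa e)
          aux (yes h@(_ , pos)) = trans (if-yes (pass? e s) h) full
            where
            full : copy (P.Y (pa e)) ≡ value-at (pa e)
            full with nthQ-flag k (flags (pa e))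
            ... | inj₁ z = ⊥-elim (n≮0 (subst (λ g → 0 < f0 g) z (Y-pos (pa e) pos)))
            ... | inj₂ o = trans (cong (λ { (a , b , c) → quad 1 a b c }) (Y-rest' (pa e)))
                             (cong (λ a → quad a (f1 (value-at (pa e))) (f2 (value-at (pa e))) (f3 (value-at (pa e)))) (sym o))
          aux (no ¬h) = trans (if-no (pass? e s) ¬h)
            (sym (nthQ-zero k (flags (pa e)) (λ pos → ¬h (sym (ori≡ e) , pos-Y (pa e) pos))))

        sent-up : ∀ e s → s ≢ childSide e → P.sent e s ≡ 0#
        sent-up e s ne = if-no (pass? e s) (λ { (eq , _) → ne (trans eq (ori≡ e)) })

        -- The light edge `e` itself heads the list of its child, so what is at position `k` for the
        -- parent is at position `suc k` for the child.
        down : ∀ e s → s ≡ childSide e → H e ≡ false → P.sent e s ≡ nthQ (suc k) (lights (ch e))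
        down e s eq h = trans (sent-down e s eq) (cong (nthQ (suc k)) (sym (lights-light h)))

        sent-fits : ∀ e s → Fits (P.sent e s)
        sent-fits e s = aux (s Bool.≟ childSide e)
          where
          aux : Dec (s ≡ childSide e) → Fits (P.sent e s)
          aux (yes eq) = subst Fits (sym (sent-down e s eq)) (nthQ-fits k (pa e))
          aux (no ne)  = subst Fits (sym (sent-up e s ne)) 0#-fits

      next : Listed (suc (suc k)) c' × Current (suc k) c'
      next = record
        { base = record { node-id = λ v → trans (P.keepNode (λ x → nid x , ndep x) (λ _ _ _ → refl) v) (node-id v)
                        ; edge-id = λ e → trans (P.keepEdge (λ x → eid x , ori x , pd x , hvy x) (λ _ _ → refl) e) (edge-id e) }
        ; listed = λ v → trans (cong lst (P.node v)) (trans
            (cong (λ l → if ⌊ 0 <? f0 (P.G v) ⌋ then entry (P.G v) ∷ l else l) (listed v))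
            (appended p refl (suc k) F≡ down sent-up sent-fits v (0 <? f0 (P.G v))))
        } , record { current = λ v → trans (cong reg (P.node v)) (delivered p refl (suc k) F≡ down sent-up sent-fits v (0 <? f0 (P.G v))) }

    lists-all : ∀ q {k c c'} → Run (replicate q nextLight) c c' → Listed (suc k) c → Current k c → Listed (q + suc k) c'
    lists-all zero    []        inv _   = inv
    lists-all (suc q) {k} {c' = c'} (p ∷ run) inv cur = subst (λ k → Listed k c') (+-suc q (suc k))
      (lists-all q run (proj₁ (NextLight.next p inv cur)) (proj₂ (NextLight.next p inv cur)))

    module _ {c} (marked : Marked hc H c) where

      open Marked marked

      -- The heavy sibling has a subtree at least as large, and it is disjoint from that of the
      -- light child.
      light-halves : ∀ e → H e ≡ false → 2 * size (ch e) ≤ size (pa e)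
      light-halves e h with hc (pa e) in eq
      ... | nothing = ⊥-elim (none (pa e) eq e refl)
      ... | just w with some (pa e) w eq
      ...   | e' , pa≡ , refl , mx = ≤-trans (≤-reflexive (cong (size (ch e) +_) (+-identityʳ _)))
              (≤-trans (+-monoʳ-≤ (size (ch e)) (mx e refl)) (size-siblings (λ { refl → true≢false (trans (sym (heavy-H e eq)) h) }) (sym pa≡)))

      lights-bound : ∀ v → 2 ^ length (lights v) * size v ≤ n
      lights-bound = tree-ind _ base climb
        where
        open ≤-Reasoning
        base : 2 ^ length (lights r) * size r ≤ n
        base = ≤-trans (≤-reflexive (trans (cong (λ l → 2 ^ length l * size r) lights-r) (+-identityʳ _))) (size≤n r)
        climb : ∀ e → 2 ^ length (lights (pa e)) * size (pa e) ≤ n → 2 ^ length (lights (ch e)) * size (ch e) ≤ n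
        climb e ih with bool-cases (H e)
        ... | inj₁ h = begin
          2 ^ length (lights (ch e)) * size (ch e)   ≡⟨ cong (λ l → 2 ^ length l * size (ch e)) (lights-heavy h) ⟩
          2 ^ length (lights (pa e)) * size (ch e)   ≤⟨ *-monoʳ-≤ (2 ^ length (lights (pa e))) (size-child≤ e) ⟩
          2 ^ length (lights (pa e)) * size (pa e)   ≤⟨ ih ⟩
          n                                          ∎
        ... | inj₂ h = begin
          2 ^ length (lights (ch e)) * size (ch e)         ≡⟨ cong (λ l → 2 ^ length l * size (ch e)) (lights-light h) ⟩
          2 * 2 ^ length (lights (pa e)) * size (ch e)     ≡⟨ cong (_* size (ch e)) (*-comm 2 (2 ^ length (lights (pa e)))) ⟩
          2 ^ length (lights (pa e)) * 2 * size (ch e)     ≡⟨ *-assoc (2 ^ length (lights (pa e))) 2 _ ⟩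
          2 ^ length (lights (pa e)) * (2 * size (ch e))   ≤⟨ *-monoʳ-≤ (2 ^ length (lights (pa e))) (light-halves e h) ⟩
          2 ^ length (lights (pa e)) * size (pa e)         ≤⟨ ih ⟩
          n                                                ∎

      lights-short : ∀ v → length (lights v) ≤ lg n
      lights-short v = ≮⇒≥ λ lt → <⇒≱ (n<2^lg n) (begin
        2 ^ lg n                               ≤⟨ ^-monoʳ-≤ 2 (<⇒≤ lt) ⟩
        2 ^ length (lights v)                  ≡⟨ *-identityʳ _ ⟨
        2 ^ length (lights v) * 1              ≤⟨ *-monoʳ-≤ (2 ^ length (lights v)) (size-pos v) ⟩
        2 ^ length (lights v) * size v         ≤⟨ lights-bound v ⟩
        n                                      ∎)
        where open ≤-Reasoning

      -- `LightEntries` is built from the front of the path, while induction over the tree extends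
      -- the path at its end; this lemma and the next bridge the two directions.
      heavy-snoc : ∀ P {u w K} → LightEntries es r ids hc (P ++ u ∷ []) K → hc u ≡ just w → LightEntries es r ids hc (P ++ u ∷ w ∷ []) K
      heavy-snoc []          one              h = heavy h one
      heavy-snoc (x ∷ [])    (heavy h' l)     h = heavy h' (heavy-snoc [] l h)
      heavy-snoc (x ∷ [])    (light a b d l)  h = light a b d (heavy-snoc [] l h)
      heavy-snoc (x ∷ y ∷ P) (heavy h' l)     h = heavy h' (heavy-snoc (y ∷ P) l h)
      heavy-snoc (x ∷ y ∷ P) (light a b d l)  h = light a b d (heavy-snoc (y ∷ P) l h)

      light-snoc : ∀ P {u w K du dw} → LightEntries es r ids hc (P ++ u ∷ []) K → hc u ≢ just w → Depth es r u du → Depth es r w dw →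
                   LightEntries es r ids hc (P ++ u ∷ w ∷ []) (K ++ (du , ids u , dw , ids w) ∷ [])
      light-snoc []          one             ne du dw = light ne du dw one
      light-snoc (x ∷ [])    (heavy h l)     ne du dw = heavy h (light-snoc [] l ne du dw)
      light-snoc (x ∷ [])    (light a b d l) ne du dw = light a b d (light-snoc [] l ne du dw)
      light-snoc (x ∷ y ∷ P) (heavy h l)     ne du dw = heavy h (light-snoc (y ∷ P) l ne du dw)
      light-snoc (x ∷ y ∷ P) (light a b d l) ne du dw = light a b d (light-snoc (y ∷ P) l ne du dw)

      rootPath-ends : ∀ v → ∃[ P ] rootPath v ≡ P ++ v ∷ []
      rootPath-ends v with up v
      ... | inj₁ refl = [] , rootPath-r
      ... | inj₂ (e , refl) = rootPath (pa e) , rootPath-ch e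

      Correct : V → Set
      Correct v = LightEntries es r ids hc (rootPath v) (map entry (reverse (lights v)))

      lights-correct : ∀ v → Correct v
      lights-correct = tree-ind Correct
          (subst₂ (LightEntries es r ids hc) (sym rootPath-r) (cong (map entry ∘ reverse) (sym lights-r)) one)
          λ e ih → extend e ih (rootPath-ends (pa e)) (bool-cases (H e))
        where
        extend : ∀ e → Correct (pa e) → ∃[ P ] rootPath (pa e) ≡ P ++ pa e ∷ [] → H e ≡ true ⊎ H e ≡ false → Correct (ch e)
        extend e ih (P , ends) k = subst (λ Q → LightEntries es r ids hc Q (map entry (reverse (lights (ch e))))) path (aux k)
          where
          path : P ++ pa e ∷ ch e ∷ [] ≡ rootPath (ch e)
          path = trans (sym (++-assoc P (pa e ∷ []) (ch e ∷ []))) (trans (cong (_++ ch e ∷ []) (sym ends)) (sym (rootPath-ch e)))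
          prev : LightEntries es r ids hc (P ++ pa e ∷ []) (map entry (reverse (lights (pa e))))
          prev = subst (λ Q → LightEntries es r ids hc Q (map entry (reverse (lights (pa e))))) ends ih
          aux : H e ≡ true ⊎ H e ≡ false → LightEntries es r ids hc (P ++ pa e ∷ ch e ∷ []) (map entry (reverse (lights (ch e))))
          aux (inj₁ h) = subst (λ l → LightEntries es r ids hc _ (map entry (reverse l))) (sym (lights-heavy h)) (heavy-snoc P prev (H-heavy e h))
          aux (inj₂ h) = subst (LightEntries es r ids hc _)
            (sym (trans (cong (map entry ∘ reverse) (lights-light h)) (trans (cong (map entry) (unfold-reverse (lightMsg e) (lights (pa e))))
              (map-++ entry (reverse (lights (pa e))) (lightMsg e ∷ [])))))
            (light-snoc P prev (λ eq → true≢false (trans (sym (heavy-H e eq)) h)) (dist (pa e)) (subst (Dist es r (ch e)) (depth-ch e) (dist (ch e))))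

      isHLD : IsHLD es r hc
      isHLD u = heaviest , childless
        where
        heaviest : ∀ h → hc u ≡ just h → Child es r u h ×
                   (∀ x sx sh → Child es r u x → SubtreeSize es r x sx → SubtreeSize es r h sh → sx ≤ sh)
        heaviest h eq with some u h eq
        ... | e , refl , refl , mx = edge-child e , largest
          where
          largest : ∀ x sx sh → Child es r (pa e) x → SubtreeSize es r x sx → SubtreeSize es r (ch e) sh → sx ≤ sh
          largest x sx sh child sizex sizeh with child-edge child
          ... | e' , refl , pa≡ = ≤-trans (≤-reflexive (subtreeSize-unique sizex))
                (≤-trans (mx e' (sym pa≡)) (≤-reflexive (sym (subtreeSize-unique sizeh))))
        childless : hc u ≡ nothing → ∀ x → ¬ Child es r u x
        childless eq x child with child-edge child
        ... | e , _ , pa≡ = none u eq e (sym pa≡)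

      listed-start : Listed 0 c
      listed-start = record
        { base   = record { node-id = λ v → cong (λ { (a , b , _) → a , b }) (node-id v) ; edge-id = edge-id }
        ; listed = λ v → cong (proj₂ ∘ proj₂) (node-id v)
        }

      listed-info : ∀ {c'} → Listed (lg n + 1) c' → ∀ v → IsHLInfo es r ids hc v (ndep (proj₁ c' v) , lst (proj₁ c' v))
      listed-info {c'} fin v = subst (Depth es r v) (sym (cong proj₂ (Base.node-id (Listed.base fin) v))) (dist v)
        , rootPath v , rootPath-valid v , subst (LightEntries es r ids hc (rootPath v)) (sym complete) (lights-correct v)
        where
        complete : lst (proj₁ c' v) ≡ map entry (reverse (lights v))
        complete = trans (Listed.listed fin v) (cong (map entry ∘ reverse)
          (take-all (lg n + 1) (lights v) (≤-trans (lights-short v) (m≤m+n _ _))))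

  heavy-light : ∀ {c c'} → Run (heavyProg ++ lightProg (lg n)) c c' → Measured c →
    ∃[ hc ] (IsHLD es r hc × (∀ v → IsHLInfo es r ids hc v (ndep (proj₁ c' v) , lst (proj₁ c' v))))
  heavy-light (p ∷ q ∷ m ∷ f ∷ run) inv = A.hc , isHLD A.marked
      , listed-info A.marked (lists-all (lg n) run (proj₁ start) (proj₂ start))
    where
    module A = Heavy p q m inv
    open Lists A.hc A.H
    start = FirstLight.next f (listed-start A.marked)

-- The complete program and its complexity

module Program (k n : ℕ) where

  -- `L` is the number of bits of an identifier, and `W` adds `lg n` bits so that counts up to `n`
  -- fit as well. `T` counts the merging steps, two sweeps in each of `lg n` phases. `H` bounds the
  -- ranks, two for every step.
  L W T H : ℕ
  L = k * lg n ^ k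
  W = L + lg n
  T = lg n * (length (sweep L) + length (sweep L))
  H = 2 * T

  program : List Instr
  program = phases L 0 1 (lg n) ++ (orientProg T ++ (sizeProg H ++ (depthProg H ++ (heavyProg ++ lightProg (lg n)))))

  open Compile W T program using (algorithm; width) public

  module _ {es : EdgeList n} {r : Fin n} (R : Rooted es r) (ids : Fin n → ℕ)
           (ids-inj : Injective _≡_ _≡_ ids) (ids< : ∀ v → ids v < 2 ^ L) where

    setting : Setting
    setting = record
      { n = n ; W = W ; T = T ; L = L ; prog = program ; es = es ; r = r ; R = R ; ids = ids ; ids-inj = ids-inj ; ids< = ids<
      ; L≤W = ^-monoʳ-≤ 2 (m≤m+n L (lg n))
      ; n<W = <-≤-trans (n<2^lg n) (^-monoʳ-≤ 2 (m≤n+m (lg n) L)) }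

    private
      module A = Analysis setting
      open A using (run-++; run-program; Clustered; E; childSide)

    correct : ∀ {c} → Execution.Reach algorithm es ids r (length program) c →
      ∃[ hc ] (IsHLD es r hc × (∀ v → IsHLInfo es r ids hc v (ndep (proj₁ c v) , lst (proj₁ c v))))
    correct {c} reach with run-++ (phases L 0 1 (lg n)) (run-program reach)
    ... | c₁ , run₁ , rest₁ with run-++ (orientProg T) rest₁
    ...   | c₂ , run₂ , rest₂ with run-++ (sizeProg H) rest₂
    ...     | c₃ , run₃ , rest₃ with run-++ (depthProg H) rest₃
    ...       | c₄ , run₄ , run₅ = HeavyLight.heavy-light setting run₅ measured
      where
      clusters : Clustered T c₁ × (∀ e → tau (proj₂ c₁ e) < T)
      clusters = Clustering.cluster-all setting refl run₁
      τ : E → ℕ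
      τ e = tau (proj₂ c₁ e)
      μ : E → Bool
      μ e = mov (proj₂ c₁ e)
      star : ∀ t → Ranking.StarAt R τ μ t
      -- Every edge is merged by now, so a step that occurs as a level is below `T`, where the
      -- invariant applies.
      star t e e' τe = Clustered.stars (proj₁ clusters) t (subst (_< T) τe (proj₂ clusters e)) e e' τe
      module O = Orientation setting τ μ star
      open Ranking R τ μ using (rank; rank-<; rank-increases)
      module Q = Measuring setting rank (λ {e} {f} → rank-increases star {e} {f})
      oriented : O.Oriented 0 0 c₂
      oriented = O.orient-all T run₂ (O.oriented-start (Clustered.node-id (proj₁ clusters)) (Clustered.edge-id (proj₁ clusters))
        (λ _ → refl) (λ _ → refl) (proj₂ clusters))
      module Or = O.Oriented oriented
      rank<H : ∀ e → rank e < H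
      rank<H e = rank-< (proj₂ clusters e)
      ori≡ : ∀ e → ori (proj₂ c₂ e) ≡ childSide e
      ori≡ e = proj₁ (Or.correct e (Or.done e z≤n))
      sized : Q.Sized H c₂
      sized = record
        { node-id = Or.node-id
        -- The level computed by an edge uses the orientation it has learned, and `rank` uses the
        -- true child side; once orientations are correct, the two agree.
        ; edge-id = λ e → cong₂ (λ { (f , t , m , _) o → f , o , 2 * t + (if ⌊ m Bool.≟ o ⌋ then 0 else 1) }) (Or.edge-id e) (ori≡ e)
        ; known   = λ e H≤ → ⊥-elim (<⇒≱ (rank<H e) H≤)
        ; unknown = λ e _ → cong (proj₂ ∘ proj₂ ∘ proj₂) (Or.edge-id e)
        }
      deep : Q.Deep H c₄
      deep = Q.depth-all H run₄ (Q.deep-start (Q.size-all H run₃ sized))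
      measured : HeavyLight.Measured setting c₄
      measured = record
        { node-id = λ v → cong₂ (λ { (a , l) d → a , d , l }) (Q.Deep.node-id deep v) (Q.deep-end rank<H deep v)
        ; edge-id = λ e → cong (λ { (f , o , _ , s) → f , o , s }) (Q.Deep.edge-id deep e)
        }

  length-sweep : ∀ i → length (sweep i) ≡ 2 * i
  length-sweep zero    = refl
  length-sweep (suc i) = trans (cong (2 +_) (length-sweep i)) (sym (*-suc 2 i))

  length-mergeProg : ∀ s θ xs → length (mergeProg s θ xs) ≡ 2 * length xs
  length-mergeProg s θ []       = refl
  length-mergeProg s θ (_ ∷ xs) = trans (cong (2 +_) (length-mergeProg (suc s) θ xs)) (sym (*-suc 2 (length xs)))

  length-phases : ∀ s m q → length (phases L s m q) ≡ q * (8 * L)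
  length-phases s m zero    = refl
  length-phases s m (suc q) = begin
    length (A ++ (B ++ C))             ≡⟨ trans (length-++ A) (cong (length A +_) (length-++ B)) ⟩
    length A + (length B + length C)   ≡⟨ cong₂ _+_ (twice s) (cong₂ _+_ (twice (s + j)) (length-phases (s + j + j) (2 * m) q)) ⟩
    4 * L + (4 * L + q * (8 * L))      ≡⟨ solve 2 (λ l x → con 4 :* l :+ (con 4 :* l :+ x) := con 8 :* l :+ x) refl L (q * (8 * L)) ⟩
    suc q * (8 * L)                    ∎
    where
    open ≡-Reasoning
    j : ℕ
    j = length (sweep L)
    A B C : List Instr
    A = mergeProg s (2 * m) (sweep L)
    B = mergeProg (s + j) (2 * m) (sweep L)
    C = phases L (s + j + j) (2 * m) q
    twice : ∀ s → length (mergeProg s (2 * m) (sweep L)) ≡ 4 * L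
    twice s = trans (length-mergeProg s (2 * m) (sweep L)) (trans (cong (2 *_) (length-sweep L)) (sym (*-assoc 2 2 L)))

  length-orientProg : ∀ t → length (orientProg t) ≡ 2 * t
  length-orientProg zero    = refl
  length-orientProg (suc t) = trans (cong (2 +_) (length-orientProg t)) (sym (*-suc 2 t))

  length-sizeProg : ∀ l → length (sizeProg l) ≡ 2 * l
  length-sizeProg zero    = refl
  length-sizeProg (suc l) = trans (cong (2 +_) (length-sizeProg l)) (sym (*-suc 2 l))

  length-depthProg : ∀ l → length (depthProg l) ≡ 2 * l
  length-depthProg zero    = refl
  length-depthProg (suc l) = trans (length-++ (depthProg l)) (trans (cong (_+ 2) (length-depthProg l))
    (trans (+-comm _ 2) (sym (*-suc 2 l))))

  T≡ : T ≡ 4 * (lg n * L)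
  T≡ = trans (cong (λ j → lg n * (j + j)) (length-sweep L))
    (solve 2 (λ x l → x :* (con 2 :* l :+ con 2 :* l) := con 4 :* (x :* l)) refl (lg n) L)

  -- In units of `lg n * L`, where `T` is 4: merging takes 8, orienting 8, sizes and depths 16 each.
  -- The heavy edges take three rounds, the light lists `lg n + 1`.
  length-program : length program ≡ 48 * (lg n * L) + lg n + 4
  length-program = begin
    length program
      ≡⟨ trans (length-++ (phases L 0 1 (lg n))) (cong₂ _+_ (length-phases 0 1 (lg n)) (trans (length-++ (orientProg T))
           (cong₂ _+_ (length-orientProg T) (trans (length-++ (sizeProg H)) (cong₂ _+_ (length-sizeProg H)
             (trans (length-++ (depthProg H)) (cong₂ _+_ (length-depthProg H) (cong (4 +_) (length-replicate (lg n)))))))))) ⟩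
    lg n * (8 * L) + (2 * T + (2 * (2 * T) + (2 * (2 * T) + (4 + lg n))))
      ≡⟨ cong (λ t → lg n * (8 * L) + (2 * t + (2 * (2 * t) + (2 * (2 * t) + (4 + lg n))))) T≡ ⟩
    lg n * (8 * L) + (2 * (4 * (lg n * L)) + (2 * (2 * (4 * (lg n * L))) + (2 * (2 * (4 * (lg n * L))) + (4 + lg n))))
      ≡⟨ solve 2 (λ x l → x :* (con 8 :* l) :+ (con 2 :* (con 4 :* (x :* l)) :+ (con 2 :* (con 2 :* (con 4 :* (x :* l)))
           :+ (con 2 :* (con 2 :* (con 4 :* (x :* l))) :+ (con 4 :+ x)))) := con 48 :* (x :* l) :+ x :+ con 4) refl (lg n) L ⟩
    48 * (lg n * L) + lg n + 4 ∎
    where open ≡-Reasoning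

  -- One number serves as factor and as exponent. It dominates the factor `48 * k + 5` of the round
  -- count, the factor `4 * k + 4` of the width, and the power `suc k` of `lg n` in both.
  exponent : ℕ
  exponent = 48 * k + 8

  private
    P : ℕ
    P = lg n ^ suc k

    1≤power : ∀ j → 1 ≤ lg n ^ j
    1≤power j = m^n>0 (lg n) j

    lg≤P : lg n ≤ P
    lg≤P = ≤-trans (≤-reflexive (sym (*-identityʳ (lg n)))) (*-monoʳ-≤ (lg n) (1≤power k))

    P≤ : P ≤ lg n ^ exponent
    P≤ = ^-monoʳ-≤ (lg n) (≤-trans (s≤s (≤-trans (m≤n*m k 48) (m≤m+n (48 * k) 7))) (≤-reflexive (sym (+-suc (48 * k) 7))))

    scale : ∀ {a b} → a ≤ b * P → b ≤ exponent → a ≤ exponent * lg n ^ exponent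
    scale a≤ b≤ = ≤-trans a≤ (*-mono-≤ b≤ P≤)

  rounds-bound : length program ≤ exponent * lg n ^ exponent
  rounds-bound = scale {b = 48 * k + 5} (begin
    length program                        ≡⟨ length-program ⟩
    48 * (lg n * L) + lg n + 4            ≤⟨ +-mono-≤ (+-monoʳ-≤ (48 * (lg n * L)) lg≤P) (*-monoʳ-≤ 4 (1≤power (suc k))) ⟩
    48 * (lg n * L) + P + 4 * P           ≡⟨ solve 3 (λ x j p → con 48 :* (x :* (j :* p)) :+ x :* p :+ con 4 :* (x :* p)
                                               := (con 48 :* j :+ con 5) :* (x :* p)) refl (lg n) k (lg n ^ k) ⟩
    (48 * k + 5) * P                      ∎)
    (+-monoʳ-≤ (48 * k) (m≤m+n 5 3))
    where open ≤-Reasoning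

  width-bound : width ≤ exponent * lg n ^ exponent
  width-bound = scale {b = 4 * k + 4} (begin
    W + (W + (W + W))                     ≡⟨ solve 1 (λ w → w :+ (w :+ (w :+ w)) := con 4 :* w) refl W ⟩
    4 * (k * lg n ^ k + lg n)             ≤⟨ *-monoʳ-≤ 4 (+-mono-≤ (*-monoʳ-≤ k (m≤n*m (lg n ^ k) (lg n))) lg≤P) ⟩
    4 * (k * P + P)                       ≡⟨ solve 2 (λ j p → con 4 :* (j :* p :+ p) := (con 4 :* j :+ con 4) :* p) refl k P ⟩
    (4 * k + 4) * P                       ∎)
    (+-mono-≤ (*-monoˡ-≤ k (m≤m+n 4 44)) (m≤m+n 4 4))
    where open ≤-Reasoning

theoremA5 : ∀ (k : ℕ) →
    ∃[ c ] Σ (ℕ → ℕ) λ B → Σ ((n : ℕ) → Algorithm (B n)) λ A →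
    ∀ (n : ℕ) →
    B n ≤ c * lg n ^ c
    × Algorithm.rounds (A n) ≤ c * lg n ^ c
    × (∀ (es : EdgeList n) → IsTree es → (r : Fin n) →
    (ids : Fin n → ℕ) → Injective _≡_ _≡_ ids → (∀ v → ids v < 2 ^ (k * lg n ^ k)) →
    ∀ cfg → Execution.Reach (A n) es ids r (Algorithm.rounds (A n)) cfg →
    ∃[ hc ] (IsHLD es r hc ×
    (∀ v → IsHLInfo es r ids hc v (Algorithm.output (A n) (proj₁ cfg v)))))
theoremA5 k = 48 * k + 8 , (λ n → Program.width k n) , (λ n → Program.algorithm k n) , λ n →
  Program.width-bound k n , Program.rounds-bound k n ,
  λ es tree r ids inj ids< cfg reach → Program.correct k n (rootTree es tree r) ids inj ids< reach
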